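{- Let $\mathbf{M}$ be a Markov chain with $n$ states whose transition matrix has at most $d$ non-zero entries in each row. Given an $\ell_1$ distance tester with time complexity $T(n,\epsilon,\delta)$ and gap $f$, and an oracle next_node for $\mathbf{M}$, there exists a test (taking parameters $t,\epsilon$) with the following behavior: if $\mathbf{M}$ is $(f(\epsilon),t)$-mixing then the test accepts with probability at least $2/3$; if $\mathbf{M}$ is not $(2\epsilon,1.01\epsilon)$-close to any $\widetilde{\mathbf{M}}$ which is $(4\epsilon,2t)$-mixing then the test rejects with probability at least $2/3$. The running time of the test is $O\left(\frac{1}{\epsilon^2}\cdot t^2\cdot T\left(n,\epsilon,\frac{1}{6t}\right)\right)$.
   Context: A Markov chain on $n$ states is represented by its $n\times n$ transition probability matrix $\mathbf{M}$. For a state $u$, $\mathbf{e}_u$ is the row vector with a one in position $u$ and zeros elsewhere, so $\mathbf{e}_u\mathbf{M}^t$ is the distribution of the endpoint of a $t$-step random walk started at $u$. $\|\mathbf{v}\|_1=\sum_i|v_i|$. The chain $\mathbf{M}$ is $(\epsilon,t)$-mixing if there exists a distribution $\mathbf{s}$ such that $\|\mathbf{e}_u\mathbf{M}^t-\mathbf{s}\|_1\le\epsilon$ for all states $u$. The average $t$-step distribution of $\mathbf{M}$ is $\mathbf{s}_{\mathbf{M},t}=\frac1n\sum_u\mathbf{e}_u\mathbf{M}^t$. For $n$-state Markov chains $\mathbf{M}_1,\mathbf{M}_2$ with at most $d$ non-zero entries in each row, $\Delta(\mathbf{M}_1,\mathbf{M}_2)=(\epsilon_1,\epsilon_2)$ means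 that $\mathbf{M}_1$ and $\mathbf{M}_2$ differ on $\epsilon_1 dn$ entries and $\|\mathbf{s}_{\mathbf{M}_1,t}-\mathbf{s}_{\mathbf{M}_2,t}\|_1=\epsilon_2$. They are $(\epsilon_1,\epsilon_2)$-close if $\Delta(\mathbf{M}_1,\mathbf{M}_2)\le(\epsilon_1,\epsilon_2)$ coordinatewise. Here $t$ is the parameter given to the test. The oracle next_node, on input a state $u$, responds at unit cost with a state $v$ with probability $\mathbf{M}(u,v)$ (independently across calls). An $\ell_1$ distance tester with gap $f$ and time complexity $T(n,\epsilon,\delta)$ is a randomized algorithm which, given parameters $\epsilon,\delta$ and oracle (sample) access to two distributions over the same $n$-element set, runs in time $T(n,\epsilon,\delta)$ (each sample counted at unit cost) and decides with confidence $1-\delta$ whether their $\ell_1$ distance is at most $f(\epsilon)$ (in which case it accepts) or more than $\epsilon$ (in which case it rejects).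
   Formalization: The running-time bound is claimed for ε ≤ 2 (an ℓ1 distance never exceeds 2); for unboundedly large ε the bound C·t²·T/ε² can fall below one step and fails. Acceptance and rejection are claimed for every ε > 0. -}

module Defs where

open import Algebra.Bundles using (CommutativeRing; RawMonoid)
import Algebra.Definitions.RawMonoid as RawMonoidOps
open import Algebra.Structures using (IsCommutativeRing)
open import Data.Bool.Base using (Bool; true; false; not; if_then_else_)
open import Data.Fin.Base using (Fin; toℕ; fromℕ<)
import Data.Fin.Properties as Fin
open import Data.List.Base
  using (List; []; _∷_; _++_; length; filter; allFin; cartesianProduct)
open import Data.Nat.Base as ℕ using (ℕ; zero; suc)
import Data.Nat.Properties as ℕ
open import Data.Product.Base using (Σ-syntax; ∃-syntax; _×_; _,_; proj₁; proj₂)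
open import Level using (0ℓ)
open import Relation.Binary.PropositionalEquality.Core using (_≡_; _≢_)
open import Relation.Binary.Structures using (IsDecTotalOrder)
open import Relation.Nullary.Decidable.Core using (yes; no; ¬?; ⌊_⌋)

-- The real numbers enter through the interface of an Archimedean ordered
-- field.  The order is decidable because probabilities are treated
-- classically.  The value of 0# ⁻¹ is left unspecified.
record ArchimedeanField : Set₁ where
  infix  4 _≤_
  infix  8 _⁻¹
  infixl 7 _*_
  infixl 6 _+_
  infix  8 -_
  field
    Carrier           : Set
    _≤_               : Carrier → Carrier → Set
    _+_ _*_           : Carrier → Carrier → Carrier
    -_ _⁻¹            : Carrier → Carrier
    0# 1#             : Carrier
    isCommutativeRing : IsCommutativeRing _≡_ _+_ _*_ -_ 0# 1#
    isDecTotalOrder   : IsDecTotalOrder _≡_ _≤_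
    0≢1               : 0# ≢ 1#
    *-inverseʳ        : ∀ x → x ≢ 0# → x * x ⁻¹ ≡ 1#
    +-monoʳ-≤         : ∀ x {y z} → y ≤ z → x + y ≤ x + z
    *-nonNegative     : ∀ {x y} → 0# ≤ x → 0# ≤ y → 0# ≤ x * y

  +-rawMonoid : RawMonoid 0ℓ 0ℓ
  +-rawMonoid = record { _≈_ = _≡_ ; _∙_ = _+_ ; ε = 0# }

  fromℕ : ℕ → Carrier
  fromℕ n = RawMonoidOps._×_ +-rawMonoid n 1#

  field
    archimedean : ∀ x → ∃[ n ] x ≤ fromℕ n

  commutativeRing : CommutativeRing 0ℓ 0ℓ
  commutativeRing = record { isCommutativeRing = isCommutativeRing }

  open CommutativeRing commutativeRing public using (_-_)
  open RawMonoidOps +-rawMonoid public using (sum)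
  open IsDecTotalOrder isDecTotalOrder public using (_≟_; _≤?_)

  infix 4 _<_
  _<_ : Carrier → Carrier → Set
  x < y = x ≤ y × x ≢ y

  ∣_∣ : Carrier → Carrier
  ∣ x ∣ with 0# ≤? x
  ... | yes _ = x
  ... | no  _ = - x

  infix 8 _÷_
  _÷_ : ℕ → ℕ → Carrier
  a ÷ b = fromℕ a * fromℕ b ⁻¹

-- Algorithms are programs for a randomised real RAM with oracle access.  The
-- memory consists of cells N[0], N[1], … holding natural numbers and cells
-- R[0], R[1], … holding reals; addresses may be computed.  Since a program is
-- a finite object that contains no real constants, one program serves all
-- values of the parameters.
data NatOp  : Set where add sub mul quo : NatOp
data RealOp : Set where add sub mul div : RealOp

data NExp : Set where
  lit  : ℕ → NExp
  N[_] : NExp → NExp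
  nop  : NatOp → NExp → NExp → NExp

data RExp : Set where
  cast : NExp → RExp
  R[_] : NExp → RExp
  rop  : RealOp → RExp → RExp → RExp

data Test : Set where
  leqN : NExp → NExp → Test
  leqR : RExp → RExp → Test
  neg  : Test → Test

data Instr : Set where
  N[_]≔_      : NExp → NExp → Instr
  R[_]≔_      : NExp → RExp → Instr
  -- uniform element of {0,…,m-1}, where m is the value of the expression
  -- (0 if m = 0)
  N[_]≔rand_  : NExp → NExp → Instr
  -- the answer of the oracle to the value of the expression
  N[_]≔query_ : NExp → NExp → Instr
  cond        : Test → List Instr → List Instr → Instr
  while       : Test → List Instr → Instr

Program : Set
Program = List Instr

data Outcome : Set where
  accept reject timeout : Outcome

isAccept isReject : Outcome → Bool
isAccept accept = true
isAccept _      = false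
isReject reject = true
isReject _      = false

evalNatOp : NatOp → ℕ → ℕ → ℕ
evalNatOp add m n       = m ℕ.+ n
evalNatOp sub m n       = m ℕ.∸ n
evalNatOp mul m n       = m ℕ.* n
evalNatOp quo m zero    = 0
evalNatOp quo m (suc n) = m ℕ./ suc n

update : {A : Set} → (ℕ → A) → ℕ → A → ℕ → A
update f i a j = if ⌊ i ℕ.≟ j ⌋ then a else f j

load : {A : Set} → A → List A → ℕ → A
load z []       i       = z
load z (x ∷ xs) zero    = x
load z (x ∷ xs) (suc i) = load z xs i

module Model (ℝ : ArchimedeanField) where

  open ArchimedeanField ℝ public

  record Distribution (n : ℕ) : Set where
    field
      prob        : Fin n → Carrier
      nonNegative : ∀ i → 0# ≤ prob i
      total       : sum prob ≡ 1#

  open Distribution public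

  ‖_‖₁ : ∀ {n} → (Fin n → Carrier) → Carrier
  ‖ v ‖₁ = sum λ i → ∣ v i ∣

  ℓ₁ : ∀ {n} → (Fin n → Carrier) → (Fin n → Carrier) → Carrier
  ℓ₁ v w = ‖ (λ i → v i - w i) ‖₁

  Matrix : ℕ → Set
  Matrix n = Fin n → Fin n → Carrier

  e : ∀ {n} → Fin n → Fin n → Carrier
  e u v = if ⌊ u Fin.≟ v ⌋ then 1# else 0#

  infixl 7 _⊡_ _⊗_
  infixr 8 _^_

  _⊡_ : ∀ {n} → (Fin n → Carrier) → Matrix n → Fin n → Carrier
  (v ⊡ A) j = sum λ i → v i * A i j

  _⊗_ : ∀ {n} → Matrix n → Matrix n → Matrix n
  (A ⊗ B) i = A i ⊡ B

  _^_ : ∀ {n} → Matrix n → ℕ → Matrix n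
  A ^ zero  = e
  A ^ suc t = A ⊗ A ^ t

  MarkovChain : ℕ → Set
  MarkovChain n = Fin n → Distribution n

  matrix : ∀ {n} → MarkovChain n → Matrix n
  matrix M u = prob (M u)

  Sparse : ∀ {n} → ℕ → MarkovChain n → Set
  Sparse {n} d M =
    ∀ u → length (filter (λ v → ¬? (matrix M u v ≟ 0#)) (allFin n)) ℕ.≤ d

  Mixing : ∀ {n} → Carrier → ℕ → MarkovChain n → Set
  Mixing {n} ε t M =
    Σ[ s ∈ Distribution n ] ∀ u → ℓ₁ (e u ⊡ matrix M ^ t) (prob s) ≤ ε

  average : ∀ {n} → MarkovChain n → ℕ → Fin n → Carrier
  average {n} M t v = fromℕ n ⁻¹ * sum λ u → (e u ⊡ matrix M ^ t) v

  differences : ∀ {n} → MarkovChain n → MarkovChain n → ℕ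
  differences {n} M₁ M₂ = length
    (filter (λ (u , v) → ¬? (matrix M₁ u v ≟ matrix M₂ u v))
            (cartesianProduct (allFin n) (allFin n)))

  Δ : ∀ {n} → ℕ → ℕ → MarkovChain n → MarkovChain n → Carrier × Carrier
  Δ {n} d t M₁ M₂ =
    differences M₁ M₂ ÷ (d ℕ.* n) , ℓ₁ (average M₁ t) (average M₂ t)

  Close : ∀ {n} → ℕ → ℕ → Carrier → Carrier →
          MarkovChain n → MarkovChain n → Set
  Close d t ε₁ ε₂ M₁ M₂ =
    proj₁ (Δ d t M₁ M₂) ≤ ε₁ × proj₂ (Δ d t M₁ M₂) ≤ ε₂

  -- Finite probability trees: a choice lists the probability of each branch.
  data Tree (A : Set) : Set where
    leaf   : A → Tree A
    choice : ∀ m → (Fin m → Carrier) → (Fin m → Tree A) → Tree A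

  infixl 1 _>>=_
  _>>=_ : {A B : Set} → Tree A → (A → Tree B) → Tree B
  leaf a        >>= k = k a
  choice m w ts >>= k = choice m w λ i → ts i >>= k

  Pr : {A : Set} → (A → Bool) → Tree A → Carrier
  Pr P (leaf a)        = if P a then 1# else 0#
  Pr P (choice m w ts) = sum λ i → w i * Pr P (ts i)

  Always : {A : Set} → (A → Set) → Tree A → Set
  Always P (leaf a)        = P a
  Always P (choice m w ts) = ∀ i → Always P (ts i)

  draw : ∀ {n} → Distribution n → Tree ℕ
  draw {n} p = choice n (prob p) λ i → leaf (toℕ i)

  uniform : ℕ → Tree ℕ
  uniform zero      = leaf 0
  uniform m@(suc _) = choice m (λ _ → fromℕ m ⁻¹) λ i → leaf (toℕ i)

  Oracle : Set
  Oracle = ℕ → Tree ℕ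

  samplers : ∀ {n} → Distribution n → Distribution n → Oracle
  samplers p q zero    = draw p
  samplers p q (suc _) = draw q

  -- Queries that do not name a state are answered by 0.
  nextNode : ∀ {n} → MarkovChain n → Oracle
  nextNode {n} M u with u ℕ.<? n
  ... | yes u<n = draw (M (fromℕ< u<n))
  ... | no  _   = leaf 0

  record Memory : Set where
    constructor ⟨_,_⟩
    field
      nats  : ℕ → ℕ
      reals : ℕ → Carrier

  open Memory public

  evalRealOp : RealOp → Carrier → Carrier → Carrier
  evalRealOp add x y = x + y
  evalRealOp sub x y = x - y
  evalRealOp mul x y = x * y
  evalRealOp div x y = x * y ⁻¹

  ⟦_⟧ⁿ : NExp → Memory → ℕ
  ⟦ lit k ⟧ⁿ     s = k
  ⟦ N[ a ] ⟧ⁿ    s = nats s (⟦ a ⟧ⁿ s)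
  ⟦ nop o a b ⟧ⁿ s = evalNatOp o (⟦ a ⟧ⁿ s) (⟦ b ⟧ⁿ s)

  ⟦_⟧ʳ : RExp → Memory → Carrier
  ⟦ cast a ⟧ʳ    s = fromℕ (⟦ a ⟧ⁿ s)
  ⟦ R[ a ] ⟧ʳ    s = reals s (⟦ a ⟧ⁿ s)
  ⟦ rop o x y ⟧ʳ s = evalRealOp o (⟦ x ⟧ʳ s) (⟦ y ⟧ʳ s)

  ⟦_⟧ᵗ : Test → Memory → Bool
  ⟦ leqN a b ⟧ᵗ s = ⌊ ⟦ a ⟧ⁿ s ℕ.≤? ⟦ b ⟧ⁿ s ⌋
  ⟦ leqR x y ⟧ᵗ s = ⌊ ⟦ x ⟧ʳ s ≤? ⟦ y ⟧ʳ s ⌋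
  ⟦ neg b ⟧ᵗ    s = not (⟦ b ⟧ᵗ s)

  setN : NExp → Memory → ℕ → Memory
  setN a s k = record s { nats = update (nats s) (⟦ a ⟧ⁿ s) k }

  setR : NExp → Memory → Carrier → Memory
  setR a s x = record s { reals = update (reals s) (⟦ a ⟧ⁿ s) x }

  verdict : ℕ → Outcome
  verdict zero    = reject
  verdict (suc _) = accept

  -- `run O k P s` runs P for at most k steps.  Every instruction, every
  -- evaluation of a branch or loop condition, and halting takes one step;
  -- the expressions in a fixed program have bounded size, so charging for
  -- individual arithmetic operations would change times by a constant factor
  -- only.  The final content of N[0] is the verdict.
  run : Oracle → ℕ → Program → Memory → Tree Outcome
  run O zero    P                      s = leaf timeout
  run O (suc k) []                     s = leaf (verdict (nats s 0))
  run O (suc k) (N[ a ]≔ b      ∷ P) s = run O k P (setN a s (⟦ b ⟧ⁿ s))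
  run O (suc k) (R[ a ]≔ x      ∷ P) s = run O k P (setR a s (⟦ x ⟧ʳ s))
  run O (suc k) (N[ a ]≔rand b  ∷ P) s =
    uniform (⟦ b ⟧ⁿ s) >>= λ v → run O k P (setN a s v)
  run O (suc k) (N[ a ]≔query b ∷ P) s =
    O (⟦ b ⟧ⁿ s) >>= λ v → run O k P (setN a s v)
  run O (suc k) (cond b P₁ P₂   ∷ P) s =
    run O k ((if ⟦ b ⟧ᵗ s then P₁ else P₂) ++ P) s
  run O (suc k) (while b P₁     ∷ P) s =
    run O k (if ⟦ b ⟧ᵗ s then P₁ ++ while b P₁ ∷ P else P) s

  Halts : Tree Outcome → Set
  Halts = Always (_≢ timeout)

  runTester : Program → (k n : ℕ) (ε δ : Carrier) →
              Distribution n → Distribution n → Tree Outcome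
  runTester P k n ε δ p q =
    run (samplers p q) k P ⟨ load 0 (n ∷ []) , load 0# (ε ∷ δ ∷ []) ⟩

  runTest : Program → (k : ℕ) {n : ℕ} (t : ℕ) (ε : Carrier) →
            MarkovChain n → Tree Outcome
  runTest P k {n} t ε M =
    run (nextNode M) k P ⟨ load 0 (n ∷ t ∷ []) , load 0# (ε ∷ []) ⟩

  record IsDistanceTester (P : Program) (f : Carrier → Carrier)
                          (T : ℕ → Carrier → Carrier → ℕ) : Set where
    field
      halts   : ∀ {n ε δ} → 0# < ε → 0# < δ → δ < 1# →
                (p q : Distribution n) →
                Halts (runTester P (T n ε δ) n ε δ p q)
      accepts : ∀ {n ε δ} → 0# < ε → 0# < δ → δ < 1# →
                (p q : Distribution n) → ℓ₁ (prob p) (prob q) ≤ f ε →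
                1# - δ ≤ Pr isAccept (runTester P (T n ε δ) n ε δ p q)
      rejects : ∀ {n ε δ} → 0# < ε → 0# < δ → δ < 1# →
                (p q : Distribution n) → ε < ℓ₁ (prob p) (prob q) →
                1# - δ ≤ Pr isReject (runTester P (T n ε δ) n ε δ p q)

-- Let a be the average t-step distribution.  If M is (f ε, t)-mixing, then e_w M^t is only known to be
-- within 2 f ε of a, so the tester is given the midpoint of e_w M^t and a together with a; call w bad
-- if these two are more than ε apart.  The test makes K ≈ 10/ε² walks from uniform states and visits
-- 2t states on each.  At a visited state a counter starts at 1, goes down when the tester accepts and
-- up when it rejects, and the walk continues once the counter is 0; the test accepts if all walks are
-- completed within 10Kt runs of the tester.  If M is mixing, a state costs at most 3/2 runs on average,
-- while at a bad state the counter never returns to 0 with probability at least 4/5.  This needs no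
-- amplification of the confidence 1 - 1/(6t) and detects bad states that a walk meets with
-- probability of order ε².
--
-- If a walk from a uniform state meets bad states with probability at most ε²/4, let M′ be M with the
-- row of every bad state replaced by the row of the state u₀ that is least likely to lead to a bad one.
-- Consider the M′-walk of 2t steps from u.  If it is redirected during the first t steps, it continues
-- for at least t steps like a walk of M from u₀, so it ends within 2ε + O(ε²) of a.  Otherwise its
-- distribution c at time t is dominated by e_u M^t, hence by a plus an excess of mass at most ε.  The
-- part below a almost never meets a bad state again and ends within 2ε + O(ε²) of a; the excess may end
-- anywhere, at distance at most 2.  The sum is at most 2ε(1 - ε) + 2ε + 2ε² = 4ε.
module Submission where

open import Defs
open import Data.Nat using (ℕ; NonZero)
import Data.Nat as ℕ
open import Data.Product using (Σ-syntax; ∃-syntax; _×_)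
open import Relation.Nullary using (¬_)

open import Algebra.Bundles using (CommutativeRing)
import Algebra.Properties.Ring as RingProperties
import Algebra.Properties.Semiring.Mult as Mult
import Algebra.Properties.Semiring.Sum as Sum
import Algebra.Solver.Ring
open import Algebra.Solver.Ring.AlmostCommutativeRing using (_-Raw-AlmostCommutative⟶_; fromCommutativeRing)
open import Data.Bool.Base using (Bool; true; false; not; if_then_else_)
open import Data.Fin.Base as Fin using (Fin; zero; suc; toℕ; fromℕ<)
import Data.Fin.Properties as Fin
open import Data.Integer.Base as ℤ using (ℤ; -[1+_]; _⊖_; _◃_) renaming (+_ to pos)
import Data.Integer.Properties as ℤ
open import Data.List.Base using (List; []; _∷_; _++_; length; filter; allFin; tabulate; cartesianProduct)
import Data.List.Base as List
import Data.List.Properties as List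
open import Data.Maybe.Base using (map)
open import Data.Nat.Base using (zero; suc; z≤n; s≤s)
import Data.Nat.DivMod as ℕ
import Data.Nat.Properties as ℕ
open import Data.Nat.Solver using (module +-*-Solver)
open import Data.Product using (_,_; proj₁; proj₂)
import Data.Sign.Base as Sign
open import Data.Sum.Base using (_⊎_; inj₁; inj₂; [_,_]′)
open import Data.Unit.Base using (⊤; tt)
open import Function.Base using (_∘_; id)
open import Relation.Binary.Bundles using (Poset)
open import Relation.Binary.PropositionalEquality
  using (_≡_; _≢_; refl; sym; trans; cong; cong₂; subst; subst₂; module ≡-Reasoning)
import Relation.Binary.Reasoning.PartialOrder as PosetReasoning
open import Relation.Binary.Structures using (IsDecTotalOrder)
open import Relation.Nullary using (Dec; yes; no; contradiction)
open import Relation.Nullary.Decidable using (⌊_⌋; ¬?; dec⇒maybe)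
open import Relation.Unary using (Decidable)

-- Let κ be the probability that a uniform walk meets a bad state among 2t visited ones. The bound
-- 4ε leaves no room for errors: for walks that are never redirected, the part below `a` already
-- costs 2ε, and an excess of mass ε at distance 2 costs 2ε more. The room is gained by charging 2ε
-- to all of the mass at once, so that the excess pays only 2 - 2ε on top. This saves 2ε², while the
-- errors add up to at most 8κ; hence the threshold κ ≤ ε²/4 and a number of walks of order 1/ε².
-- The walks visit 2t states because `a` is the law of a uniform walk at time t: the second half of
-- such a walk is a t-step walk from `a`. On the algorithmic side, the tester may be called about
-- t/ε² times in all, each call draws up to T samples, and a sample is a walk of t steps. Nothing is
-- left for repeating the tester a fixed logarithmic number of times at each state, so the budget is
-- shared by all visits and only its average use matters.

-- Arithmetic in an ordered field, a ring solver, finite sums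

module OrderedField (ℝ : ArchimedeanField) where

  open Model ℝ public
  open CommutativeRing commutativeRing public
    using (+-assoc; +-comm; +-identityˡ; +-identityʳ; *-assoc; *-comm; *-identityˡ; *-identityʳ; zeroˡ; zeroʳ;
      distribˡ; distribʳ; -‿inverseʳ; -‿inverseˡ)
  open IsDecTotalOrder isDecTotalOrder public
    using () renaming (refl to ≤-refl; trans to ≤-trans; antisym to ≤-antisym; total to ≤-total; reflexive to
      ≤-reflexive)
  open Sum (CommutativeRing.semiring commutativeRing) public
    using (sum-cong-≗; ∑-distrib-+; ∑-comm; *-distribˡ-sum; *-distribʳ-sum; sum-replicate-zero)

  ≤-poset : Poset _ _ _
  ≤-poset = record { isPartialOrder = IsDecTotalOrder.isPartialOrder isDecTotalOrder }

  module ≤-Reasoning = PosetReasoning ≤-poset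

  private
    module CR = CommutativeRing commutativeRing
    module RP = RingProperties CR.ring
    module SM = Mult CR.semiring

  fromℕ-+ : ∀ m n → fromℕ (m ℕ.+ n) ≡ fromℕ m + fromℕ n
  fromℕ-+ = SM.×-homo-+ 1#

  fromℕ-* : ∀ m n → fromℕ (m ℕ.* n) ≡ fromℕ m * fromℕ n
  fromℕ-* = SM.×1-homo-*

  fromℕ-1 : fromℕ 1 ≡ 1#
  fromℕ-1 = +-identityʳ 1#

  private
    -- The coefficient 1 must evaluate to 1# itself rather than to fromℕ 1.
    fromℕ′ : ℕ → Carrier
    fromℕ′ zero          = 0#
    fromℕ′ (suc zero)    = 1#
    fromℕ′ (suc (suc n)) = fromℕ (suc (suc n))

    fromℕ′≡fromℕ : ∀ n → fromℕ′ n ≡ fromℕ n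
    fromℕ′≡fromℕ zero          = refl
    fromℕ′≡fromℕ (suc zero)    = sym fromℕ-1
    fromℕ′≡fromℕ (suc (suc n)) = refl

    -- Coefficients for the ring solver. They are integers rather than field elements because
    -- equality of coefficients has to compute for terms to cancel in normal forms.
    fromℤ : ℤ → Carrier
    fromℤ (pos n)    = fromℕ′ n
    fromℤ -[1+ n ] = - fromℕ′ (suc n)

    fromℤ-neg : ∀ i → fromℤ (ℤ.- i) ≡ - fromℤ i
    fromℤ-neg (pos zero)  = sym RP.-0#≈0#
    fromℤ-neg (pos (suc n)) = refl
    fromℤ-neg -[1+ n ]  = sym (RP.-‿involutive _)

    suc-minus-suc : ∀ x y → (1# + x) - (1# + y) ≡ x - y
    suc-minus-suc x y = begin
      (1# + x) + - (1# + y)     ≡⟨ cong ((1# + x) +_) (RP.-‿+-comm 1# y) ⟨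
      (1# + x) + (- 1# + - y)   ≡⟨ cong (_+ (- 1# + - y)) (+-comm 1# x) ⟩
      (x + 1#) + (- 1# + - y)   ≡⟨ +-assoc x 1# _ ⟩
      x + (1# + (- 1# + - y))   ≡⟨ cong (x +_) (+-assoc 1# (- 1#) (- y)) ⟨
      x + ((1# + - 1#) + - y)   ≡⟨ cong (λ z → x + (z + - y)) (-‿inverseʳ 1#) ⟩
      x + (0# + - y)            ≡⟨ cong (x +_) (+-identityˡ (- y)) ⟩
      x - y                     ∎
      where open ≡-Reasoning

    fromℤ-⊖ : ∀ m n → fromℤ (m ⊖ n) ≡ fromℕ m - fromℕ n
    fromℤ-⊖ m zero = trans (fromℕ′≡fromℕ m)
      (trans (sym (+-identityʳ (fromℕ m))) (cong (λ z → fromℕ m + z) (sym RP.-0#≈0#)))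
    fromℤ-⊖ zero (suc n) =
      trans (cong -_ (fromℕ′≡fromℕ (suc n))) (sym (+-identityˡ _))
    fromℤ-⊖ (suc m) (suc n) = begin
      fromℤ (suc m ⊖ suc n)               ≡⟨ cong fromℤ (ℤ.[1+m]⊖[1+n]≡m⊖n m n) ⟩
      fromℤ (m ⊖ n)                       ≡⟨ fromℤ-⊖ m n ⟩
      fromℕ m - fromℕ n                   ≡⟨ suc-minus-suc (fromℕ m) (fromℕ n) ⟨
      fromℕ (suc m) - fromℕ (suc n)       ∎
      where open ≡-Reasoning

    fromℤ-+ : ∀ i j → fromℤ (i ℤ.+ j) ≡ fromℤ i + fromℤ j
    fromℤ-+ (pos m) (pos n) = trans (fromℕ′≡fromℕ (m ℕ.+ n)) (trans (fromℕ-+ m n)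
      (cong₂ _+_ (sym (fromℕ′≡fromℕ m)) (sym (fromℕ′≡fromℕ n))))
    fromℤ-+ (pos m) -[1+ n ] = trans (fromℤ-⊖ m (suc n))
      (cong₂ (λ x y → x - y) (sym (fromℕ′≡fromℕ m)) (sym (fromℕ′≡fromℕ (suc n))))
    fromℤ-+ -[1+ m ] (pos n) = trans (fromℤ-⊖ n (suc m))
      (trans (cong₂ (λ x y → x - y) (sym (fromℕ′≡fromℕ n)) (sym (fromℕ′≡fromℕ (suc m)))) (+-comm _ _))
    fromℤ-+ -[1+ m ] -[1+ n ] = begin
      - fromℕ (2 ℕ.+ (m ℕ.+ n))             ≡⟨ cong (λ k → - fromℕ (suc k)) (ℕ.+-suc m n) ⟨
      - fromℕ (suc m ℕ.+ suc n)             ≡⟨ cong -_ (fromℕ-+ (suc m) (suc n)) ⟩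
      - (fromℕ (suc m) + fromℕ (suc n))     ≡⟨ RP.-‿+-comm _ _ ⟨
      - fromℕ (suc m) - fromℕ (suc n)       ≡⟨ cong₂ (λ x y → - x - y) (fromℕ′≡fromℕ (suc m))
        (fromℕ′≡fromℕ (suc n)) ⟨
      - fromℕ′ (suc m) - fromℕ′ (suc n)     ∎
      where open ≡-Reasoning

    fromℕ′-* : ∀ m n → fromℕ′ (m ℕ.* n) ≡ fromℕ′ m * fromℕ′ n
    fromℕ′-* m n = trans (fromℕ′≡fromℕ (m ℕ.* n)) (trans (fromℕ-* m n)
      (cong₂ _*_ (sym (fromℕ′≡fromℕ m)) (sym (fromℕ′≡fromℕ n))))

    fromℤ-◃ : ∀ n → fromℤ (Sign.- ◃ n) ≡ - fromℕ′ n
    fromℤ-◃ zero    = sym RP.-0#≈0#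
    fromℤ-◃ (suc n) = refl

    fromℤ-+◃ : ∀ n → fromℤ (Sign.+ ◃ n) ≡ fromℕ′ n
    fromℤ-+◃ zero    = refl
    fromℤ-+◃ (suc n) = refl

    fromℤ-* : ∀ i j → fromℤ (i ℤ.* j) ≡ fromℤ i * fromℤ j
    fromℤ-* (pos m) (pos n) = trans (fromℤ-+◃ (m ℕ.* n)) (fromℕ′-* m n)
    fromℤ-* (pos m) -[1+ n ] = trans (fromℤ-◃ (m ℕ.* suc n))
      (trans (cong -_ (fromℕ′-* m (suc n))) (RP.-‿distribʳ-* _ _))
    fromℤ-* -[1+ m ] (pos n) = trans (fromℤ-◃ (suc m ℕ.* n))
      (trans (cong -_ (fromℕ′-* (suc m) n)) (RP.-‿distribˡ-* _ _))
    fromℤ-* -[1+ m ] -[1+ n ] = begin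
      fromℕ′ (suc m ℕ.* suc n)                ≡⟨ fromℕ′-* (suc m) (suc n) ⟩
      fromℕ′ (suc m) * fromℕ′ (suc n)         ≡⟨ RP.-‿involutive _ ⟨
      - - (fromℕ′ (suc m) * fromℕ′ (suc n))   ≡⟨ cong -_ (RP.-‿distribˡ-* _ _) ⟩
      - (- fromℕ′ (suc m) * fromℕ′ (suc n))   ≡⟨ RP.-‿distribʳ-* _ _ ⟩
      - fromℕ′ (suc m) * - fromℕ′ (suc n)     ∎
      where open ≡-Reasoning

    fromℤ-morphism : ℤ.+-*-rawRing -Raw-AlmostCommutative⟶ fromCommutativeRing commutativeRing
    fromℤ-morphism = record
      { ⟦_⟧ = fromℤ ; +-homo = fromℤ-+ ; *-homo = fromℤ-* ; -‿homo = fromℤ-neg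
      ; 0-homo = refl ; 1-homo = refl }

  open Algebra.Solver.Ring ℤ.+-*-rawRing (fromCommutativeRing commutativeRing) fromℤ-morphism
    (λ i j → map (cong fromℤ) (dec⇒maybe (i ℤ.≟ j))) public
    using (solve; _:+_; _:*_; _:-_; :-_; con; _:=_)

  -- Nearly all later estimates have this shape: the difference `d` is written as a sum of products
  -- of nonnegative slacks, and the remaining identity is left to the solver.
  ≤-by : ∀ {x y} d → 0# ≤ d → x + d ≡ y → x ≤ y
  ≤-by {x} d 0≤d x+d≡y = subst₂ _≤_ (+-identityʳ x) x+d≡y (+-monoʳ-≤ x 0≤d)

  slack : ∀ {x y} → x ≤ y → 0# ≤ y - x
  slack {x} {y} x≤y =
    subst₂ _≤_ (-‿inverseˡ x) (+-comm (- x) y) (+-monoʳ-≤ (- x) x≤y)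

  0≤+ : ∀ {x y} → 0# ≤ x → 0# ≤ y → 0# ≤ x + y
  0≤+ {x} 0≤x 0≤y = ≤-trans 0≤x (≤-by _ 0≤y refl)

  +-mono-≤ : ∀ {x y u v} → x ≤ y → u ≤ v → x + u ≤ y + v
  +-mono-≤ {x} {y} {u} {v} x≤y u≤v = ≤-by _ (0≤+ (slack x≤y) (slack u≤v))
    (solve 4 (λ x y u v → (x :+ u) :+ ((y :- x) :+ (v :- u)) := y :+ v) refl x y u v)

  *-monoˡ-≤ : ∀ {x y z} → 0# ≤ z → x ≤ y → z * x ≤ z * y
  *-monoˡ-≤ {x} {y} {z} 0≤z x≤y = ≤-by _ (*-nonNegative 0≤z (slack x≤y))
    (solve 3 (λ x y z → z :* x :+ z :* (y :- x) := z :* y) refl x y z)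

  neg-mono-≤ : ∀ {x y} → x ≤ y → - y ≤ - x
  neg-mono-≤ {x} {y} x≤y = ≤-by _ (slack x≤y)
    (solve 2 (λ x y → :- y :+ (y :- x) := :- x) refl x y)

  ≰⇒≥ : ∀ {x y} → ¬ (x ≤ y) → y ≤ x
  ≰⇒≥ {x} {y} x≰y = [ (λ x≤y → contradiction x≤y x≰y) , id ]′ (≤-total x y)

  ≰⇒> : ∀ {x y} → ¬ (x ≤ y) → y < x
  ≰⇒> x≰y = ≰⇒≥ x≰y , λ { refl → x≰y ≤-refl }

  <⇒≱ : ∀ {x y} → x < y → ¬ (y ≤ x)
  <⇒≱ (x≤y , x≢y) y≤x = x≢y (≤-antisym x≤y y≤x)

  0≤1 : 0# ≤ 1#
  0≤1 with ≤-total 0# 1#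
  ... | inj₁ 0≤1 = 0≤1
  ... | inj₂ 1≤0 = subst (0# ≤_) (solve 0 (con -[1+ 0 ] :* con -[1+ 0 ] := con (pos 1)) refl)
                     (*-nonNegative 0≤-1 0≤-1)
    where
    0≤-1 : 0# ≤ - 1#
    0≤-1 = subst (0# ≤_) (+-identityˡ (- 1#)) (slack 1≤0)

  0<1 : 0# < 1#
  0<1 = 0≤1 , 0≢1

  0≤fromℕ : ∀ n → 0# ≤ fromℕ n
  0≤fromℕ zero    = ≤-refl
  0≤fromℕ (suc n) = 0≤+ 0≤1 (0≤fromℕ n)

  fromℕ-mono-≤ : ∀ {m n} → m ℕ.≤ n → fromℕ m ≤ fromℕ n
  fromℕ-mono-≤ {n = n} z≤n       = 0≤fromℕ n
  fromℕ-mono-≤         (s≤s m≤n) = +-monoʳ-≤ 1# (fromℕ-mono-≤ m≤n)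

  0<fromℕ : ∀ n .{{_ : NonZero n}} → 0# < fromℕ n
  0<fromℕ (suc n) = 0≤fromℕ (suc n) , λ 0≡1+n →
    <⇒≱ 0<1 (subst (1# ≤_) (sym 0≡1+n) (≤-by _ (0≤fromℕ n) refl))

  <⇒≢ : ∀ {x} → 0# < x → x ≢ 0#
  <⇒≢ (_ , 0≢x) = 0≢x ∘ sym

  0<* : ∀ {x y} → 0# < x → 0# < y → 0# < x * y
  0<* {x} {y} 0<x 0<y = *-nonNegative (proj₁ 0<x) (proj₁ 0<y) , λ 0≡xy →
    0≢1 (begin
      0#                     ≡⟨ zeroʳ _ ⟨
      (y ⁻¹ * x ⁻¹) * 0#     ≡⟨ cong ((y ⁻¹ * x ⁻¹) *_) 0≡xy ⟩
      (y ⁻¹ * x ⁻¹) * (x * y) ≡⟨ solve 4 (λ x y x′ y′ → (y′ :* x′) :* (x :* y) := (x :* x′) :* (y :* y′)) refl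
        x y (x ⁻¹) (y ⁻¹) ⟩
      (x * x ⁻¹) * (y * y ⁻¹) ≡⟨ cong₂ _*_ (*-inverseʳ x (<⇒≢ 0<x)) (*-inverseʳ y (<⇒≢ 0<y)) ⟩
      1# * 1#                ≡⟨ *-identityʳ 1# ⟩
      1#                     ∎)
    where open ≡-Reasoning

  *-cancelˡ-≤ : ∀ {x y z} → 0# < z → z * x ≤ z * y → x ≤ y
  *-cancelˡ-≤ {x} {y} {z} 0<z zx≤zy with x ≤? y
  ... | yes x≤y = x≤y
  ... | no  x≰y = contradiction
          (≤-by _ (slack zx≤zy) (solve 3 (λ x y z → z :* (x :- y) :+ (z :* y :- z :* x) := con (pos 0)) refl x
            y z))
          (<⇒≱ (0<* 0<z (slack (≰⇒≥ x≰y) , λ 0≡x-y → x≰y (≤-reflexive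
            (trans (solve 2 (λ x y → x := y :+ (x :- y)) refl x y)
              (trans (cong (y +_) (sym 0≡x-y)) (+-identityʳ y)))))))

  0<⁻¹ : ∀ {x} → 0# < x → 0# < x ⁻¹
  0<⁻¹ {x} 0<x = *-cancelˡ-≤ 0<x (subst₂ _≤_ (sym (zeroʳ x)) (sym x*x⁻¹≡1) 0≤1)
    , λ 0≡x⁻¹ → 0≢1 (trans (sym (zeroʳ x)) (trans (cong (x *_) 0≡x⁻¹) x*x⁻¹≡1))
    where x*x⁻¹≡1 = *-inverseʳ x (<⇒≢ 0<x)

  ∣∣-≤ : ∀ {x y} → x ≤ y → - x ≤ y → ∣ x ∣ ≤ y
  ∣∣-≤ {x} x≤y -x≤y with 0# ≤? x
  ... | yes _ = x≤y
  ... | no  _ = -x≤y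

  x≤∣x∣ : ∀ x → x ≤ ∣ x ∣
  x≤∣x∣ x with 0# ≤? x
  ... | yes _   = ≤-refl
  ... | no  0≰x = ≤-trans (≰⇒≥ 0≰x) (subst (_≤ - x) RP.-0#≈0# (neg-mono-≤ (≰⇒≥ 0≰x)))

  -x≤∣x∣ : ∀ x → - x ≤ ∣ x ∣
  -x≤∣x∣ x with 0# ≤? x
  ... | yes 0≤x = ≤-trans (subst (- x ≤_) RP.-0#≈0# (neg-mono-≤ 0≤x)) 0≤x
  ... | no  _   = ≤-refl

  0≤∣x∣ : ∀ x → 0# ≤ ∣ x ∣
  0≤∣x∣ x with 0# ≤? x
  ... | yes 0≤x = 0≤x
  ... | no  0≰x = subst (_≤ - x) RP.-0#≈0# (neg-mono-≤ (≰⇒≥ 0≰x))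

  triangle : ∀ x y → ∣ x + y ∣ ≤ ∣ x ∣ + ∣ y ∣
  triangle x y = ∣∣-≤ (+-mono-≤ (x≤∣x∣ x) (x≤∣x∣ y))
    (subst (_≤ ∣ x ∣ + ∣ y ∣) (RP.-‿+-comm x y) (+-mono-≤ (-x≤∣x∣ x) (-x≤∣x∣ y)))

  ∣*∣-≤ : ∀ {c} → 0# ≤ c → ∀ x → ∣ c * x ∣ ≤ c * ∣ x ∣
  ∣*∣-≤ {c} 0≤c x = ∣∣-≤ (*-monoˡ-≤ 0≤c (x≤∣x∣ x))
    (subst (_≤ c * ∣ x ∣) (sym (RP.-‿distribʳ-* c x)) (*-monoˡ-≤ 0≤c (-x≤∣x∣ x)))

  sum-mono : ∀ {n} {f g : Fin n → Carrier} → (∀ i → f i ≤ g i) → sum f ≤ sum g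
  sum-mono {zero}  f≤g = ≤-refl
  sum-mono {suc n} f≤g = +-mono-≤ (f≤g zero) (sum-mono (f≤g ∘ suc))

  sum-nonNeg : ∀ {n} {f : Fin n → Carrier} → (∀ i → 0# ≤ f i) → 0# ≤ sum f
  sum-nonNeg {zero}  0≤f = ≤-refl
  sum-nonNeg {suc n} 0≤f = 0≤+ (0≤f zero) (sum-nonNeg (0≤f ∘ suc))

  ∣sum∣-≤ : ∀ {n} (f : Fin n → Carrier) → ∣ sum f ∣ ≤ sum (λ i → ∣ f i ∣)
  ∣sum∣-≤ {zero}  f = ∣∣-≤ ≤-refl (≤-reflexive RP.-0#≈0#)
  ∣sum∣-≤ {suc n} f = ≤-trans (triangle _ _) (+-monoʳ-≤ _ (∣sum∣-≤ (f ∘ suc)))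

  sum-neg : ∀ {n} (f : Fin n → Carrier) → sum (λ i → - f i) ≡ - sum f
  sum-neg {zero}  f = sym RP.-0#≈0#
  sum-neg {suc n} f = trans (cong (- f zero +_) (sum-neg (f ∘ suc))) (RP.-‿+-comm _ _)

  sum-sub : ∀ {n} (f g : Fin n → Carrier) → sum (λ i → f i - g i) ≡ sum f - sum g
  sum-sub f g = trans (∑-distrib-+ f (λ i → - g i)) (cong (sum f +_) (sum-neg g))

  sum-const : ∀ n x → sum {n} (λ _ → x) ≡ fromℕ n * x
  sum-const zero    x = sym (zeroˡ x)
  sum-const (suc n) x = trans (cong (x +_) (sum-const n x))
    (solve 2 (λ k x → x :+ k :* x := (con (pos 1) :+ k) :* x) refl (fromℕ n) x)

  sum-0 : ∀ {n} {f : Fin n → Carrier} → (∀ i → f i ≡ 0#) → sum f ≡ 0#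
  sum-0 {n} f≡0 = trans (sum-cong-≗ f≡0) (sum-replicate-zero n)

  argmax : ∀ {n} .{{_ : NonZero n}} (f : Fin n → Carrier) → ∃[ i ] (∀ j → f j ≤ f i)
  argmax {suc zero}    f = zero , λ { zero → ≤-refl }
  argmax {suc (suc n)} f with argmax (f ∘ suc)
  ... | i , max with f zero ≤? f (suc i)
  ...   | yes f0≤ = suc i , λ { zero → f0≤ ; (suc j) → max j }
  ...   | no  f0≰ = zero , λ { zero → ≤-refl ; (suc j) → ≤-trans (max j) (≰⇒≥ f0≰) }

-- Row vectors, powers of transition matrices, the norm

module Chains (ℝ : ArchimedeanField) where

  open OrderedField ℝ

  infix 8 _·_
  _·_ : ∀ {n} → (Fin n → Carrier) → (Fin n → Carrier) → Carrier
  x · f = sum λ i → x i * f i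

  ·-congʳ : ∀ {n} (x : Fin n → Carrier) {f g} → (∀ i → f i ≡ g i) → x · f ≡ x · g
  ·-congʳ x f≡g = sum-cong-≗ λ i → cong (x i *_) (f≡g i)

  ·-mono : ∀ {n} {x y f g : Fin n → Carrier} → (∀ i → 0# ≤ x i) → (∀ i → x i ≤ y i) →
           (∀ i → 0# ≤ g i) → (∀ i → f i ≤ g i) → x · f ≤ y · g
  ·-mono {x = x} {y} {f} {g} 0≤x x≤y 0≤g f≤g = sum-mono λ i →
    ≤-trans (*-monoˡ-≤ (0≤x i) (f≤g i))
      (subst₂ _≤_ (*-comm (g i) (x i)) (*-comm (g i) (y i)) (*-monoˡ-≤ (0≤g i) (x≤y i)))

  ·-monoʳ : ∀ {n} {x f g : Fin n → Carrier} → (∀ i → 0# ≤ x i) → (∀ i → f i ≤ g i) → x · f ≤ x · g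
  ·-monoʳ 0≤x f≤g = sum-mono λ i → *-monoˡ-≤ (0≤x i) (f≤g i)

  ·-nonNeg : ∀ {n} {x f : Fin n → Carrier} → (∀ i → 0# ≤ x i) → (∀ i → 0# ≤ f i) → 0# ≤ x · f
  ·-nonNeg 0≤x 0≤f = sum-nonNeg λ i → *-nonNegative (0≤x i) (0≤f i)

  ·-+ : ∀ {n} (x f g : Fin n → Carrier) → x · (λ i → f i + g i) ≡ x · f + x · g
  ·-+ {n} x f g = trans (sum-cong-≗ λ i → distribˡ (x i) (f i) (g i)) (∑-distrib-+ {n} _ _)

  ·-const : ∀ {n} (x : Fin n → Carrier) c → x · (λ _ → c) ≡ sum x * c
  ·-const x c = sym (*-distribʳ-sum c x)

  ·-scale : ∀ {n} (x f : Fin n → Carrier) c → x · (λ i → c * f i) ≡ c * x · f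
  ·-scale x f c = trans
    (sum-cong-≗ λ i → solve 3 (λ x c f → x :* (c :* f) := c :* (x :* f)) refl (x i) c (f i))
    (sym (*-distribˡ-sum c λ i → x i * f i))

  ·-sub : ∀ {n} (x f g : Fin n → Carrier) → x · (λ i → f i - g i) ≡ x · f - x · g
  ·-sub {n} x f g = trans
    (sum-cong-≗ λ i → solve 3 (λ x f g → x :* (f :- g) := x :* f :- x :* g) refl (x i) (f i) (g i))
    (sum-sub {n} _ _)

  ⊡-· : ∀ {n} (x : Fin n → Carrier) (A : Matrix n) f → (x ⊡ A) · f ≡ x · (λ i → A i · f)
  ⊡-· {n} x A f = begin
    sum (λ j → sum (λ i → x i * A i j) * f j)     ≡⟨ sum-cong-≗ (λ j → *-distribʳ-sum {n} (f j) _) ⟩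
    sum (λ j → sum (λ i → x i * A i j * f j))     ≡⟨ ∑-comm {n} {n} _ ⟩
    sum (λ i → sum (λ j → x i * A i j * f j))     ≡⟨ sum-cong-≗
      (λ i → sum-cong-≗ λ j → *-assoc (x i) (A i j) (f j)) ⟩
    sum (λ i → sum (λ j → x i * (A i j * f j)))   ≡⟨ sum-cong-≗ (λ i → sym (*-distribˡ-sum {n} (x i) _)) ⟩
    sum (λ i → x i * A i · f)                     ∎
    where open ≡-Reasoning

  sum-⊡ : ∀ {n} (x : Fin n → Carrier) (A : Matrix n) → sum (x ⊡ A) ≡ x · (sum ∘ A)
  sum-⊡ {n} x A = trans (∑-comm {n} {n} _) (sum-cong-≗ λ i → sym (*-distribˡ-sum (x i) (A i)))

  e-suc : ∀ {n} (u v : Fin n) → e (suc u) (suc v) ≡ e u v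
  e-suc u v with u Fin.≟ v
  ... | yes _ = refl
  ... | no  _ = refl

  e-· : ∀ {n} (u : Fin n) f → e u · f ≡ f u
  e-· {suc n} zero f = trans
    (cong (1# * f zero +_) (sum-0 λ i → zeroˡ (f (suc i))))
    (trans (+-identityʳ _) (*-identityˡ _))
  e-· {suc n} (suc u) f = trans
    (cong₂ _+_ (zeroˡ (f zero)) (sum-cong-≗ λ v → cong (_* f (suc v)) (e-suc u v)))
    (trans (+-identityˡ _) (e-· u (f ∘ suc)))

  ^-+ : ∀ {n} (A : Matrix n) i j u v → (A ^ (i ℕ.+ j)) u v ≡ ((A ^ i) u ⊡ A ^ j) v
  ^-+ A zero    j u v = sym (e-· u λ w → (A ^ j) w v)
  ^-+ A (suc i) j u v = trans (·-congʳ (A u) λ w → ^-+ A i j w v) (sym (⊡-· (A u) (A ^ i) _))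

  NonNegM : ∀ {n} → Matrix n → Set
  NonNegM A = ∀ u v → 0# ≤ A u v

  infix 4 _≼_
  _≼_ : ∀ {n} → Matrix n → Matrix n → Set
  A ≼ B = ∀ u v → A u v ≤ B u v

  e-nonNeg : ∀ {n} → NonNegM (e {n})
  e-nonNeg u v with u Fin.≟ v
  ... | yes _ = 0≤1
  ... | no  _ = ≤-refl

  ^-nonNeg : ∀ {n} {A : Matrix n} → NonNegM A → ∀ t → NonNegM (A ^ t)
  ^-nonNeg 0≤A zero    u v = e-nonNeg u v
  ^-nonNeg 0≤A (suc t) u v = ·-nonNeg (0≤A u) λ w → ^-nonNeg 0≤A t w v

  ^-mono : ∀ {n} {A B : Matrix n} → NonNegM A → A ≼ B → ∀ t → A ^ t ≼ B ^ t
  ^-mono 0≤A A≼B zero    u v = ≤-refl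
  ^-mono 0≤A A≼B (suc t) u v = ·-mono (0≤A u) (A≼B u)
    (λ w → ≤-trans (^-nonNeg 0≤A t w v) (^-mono 0≤A A≼B t w v)) λ w → ^-mono 0≤A A≼B t w v

  matrix-nonNeg : ∀ {n} (M : MarkovChain n) → NonNegM (matrix M)
  matrix-nonNeg M u = nonNegative (M u)

  sum-e : ∀ {n} (u : Fin n) → sum (e u) ≡ 1#
  sum-e u = trans (sum-cong-≗ λ i → sym (*-identityʳ (e u i))) (e-· u λ _ → 1#)

  sum-^ : ∀ {n} (M : MarkovChain n) t u → sum ((matrix M ^ t) u) ≡ 1#
  sum-^ M zero    u = sum-e u
  sum-^ M (suc t) u = begin
    sum (matrix M u ⊡ matrix M ^ t)           ≡⟨ sum-⊡ (matrix M u) (matrix M ^ t) ⟩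
    matrix M u · (sum ∘ (matrix M ^ t))       ≡⟨ ·-congʳ (matrix M u) (sum-^ M t) ⟩
    matrix M u · (λ _ → 1#)                   ≡⟨ ·-const (matrix M u) 1# ⟩
    sum (matrix M u) * 1#                     ≡⟨ *-identityʳ _ ⟩
    sum (matrix M u)                          ≡⟨ total (M u) ⟩
    1#                                        ∎
    where open ≡-Reasoning

  endpoint : ∀ {n} → MarkovChain n → ℕ → MarkovChain n
  endpoint M t u = record
    { prob        = (matrix M ^ t) u
    ; nonNegative = ^-nonNeg (matrix-nonNeg M) t u
    ; total       = sum-^ M t u
    }

  prob-·-≤ : ∀ {n} (p : Distribution n) {f c} → (∀ i → f i ≤ c) → prob p · f ≤ c
  prob-·-≤ p {f} {c} f≤c = ≤-trans (·-monoʳ (nonNegative p) f≤c)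
    (≤-reflexive (trans (·-const (prob p) c) (trans (cong (_* c) (total p)) (*-identityˡ c))))

  prob-·-const : ∀ {n} (p : Distribution n) c → prob p · (λ _ → c) ≡ c
  prob-·-const p c = trans (·-const (prob p) c) (trans (cong (_* c) (total p)) (*-identityˡ c))

  mean : ∀ {n} → (Fin n → Carrier) → Carrier
  mean {n} f = fromℕ n ⁻¹ * sum f

  mean-const : ∀ {n} .{{_ : NonZero n}} c → mean {n} (λ _ → c) ≡ c
  mean-const {n} c = begin
    fromℕ n ⁻¹ * sum {n} (λ _ → c)   ≡⟨ cong (fromℕ n ⁻¹ *_) (sum-const n c) ⟩
    fromℕ n ⁻¹ * (fromℕ n * c)       ≡⟨ solve 3 (λ n′ n c → n′ :* (n :* c) := (n :* n′) :* c) refl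
      (fromℕ n ⁻¹) (fromℕ n) c ⟩
    fromℕ n * fromℕ n ⁻¹ * c         ≡⟨ cong (_* c) (*-inverseʳ (fromℕ n) (<⇒≢ (0<fromℕ n))) ⟩
    1# * c                           ≡⟨ *-identityˡ c ⟩
    c                                ∎
    where open ≡-Reasoning

  0≤1/ : ∀ n .{{_ : NonZero n}} → 0# ≤ fromℕ n ⁻¹
  0≤1/ n = proj₁ (0<⁻¹ (0<fromℕ n))

  mean-mono : ∀ {n} .{{_ : NonZero n}} {f g : Fin n → Carrier} → (∀ i → f i ≤ g i) → mean f ≤ mean g
  mean-mono {n} f≤g = *-monoˡ-≤ (0≤1/ n) (sum-mono f≤g)

  mean-sub : ∀ {n} (f g : Fin n → Carrier) → mean (λ i → f i - g i) ≡ mean f - mean g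
  mean-sub {n} f g = trans (cong (fromℕ n ⁻¹ *_) (sum-sub f g))
    (solve 3 (λ c x y → c :* (x :- y) := c :* x :- c :* y) refl (fromℕ n ⁻¹) (sum f) (sum g))

  mean-cong : ∀ {n} {f g : Fin n → Carrier} → (∀ i → f i ≡ g i) → mean f ≡ mean g
  mean-cong {n} f≡g = cong (fromℕ n ⁻¹ *_) (sum-cong-≗ f≡g)

  sum-mean : ∀ {n} (A : Matrix n) → sum (λ v → mean (λ u → A u v)) ≡ mean (sum ∘ A)
  sum-mean {n} A = trans (sym (*-distribˡ-sum (fromℕ n ⁻¹) λ v → sum λ u → A u v))
    (cong (fromℕ n ⁻¹ *_) (∑-comm λ v u → A u v))

  mean-· : ∀ {n} (A : Matrix n) f → (λ v → mean (λ u → A u v)) · f ≡ mean (λ u → A u · f)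
  mean-· {n} A f = begin
    sum (λ v → fromℕ n ⁻¹ * sum (λ u → A u v) * f v)     ≡⟨ sum-cong-≗
      (λ v → *-assoc (fromℕ n ⁻¹) (sum λ u → A u v) (f v)) ⟩
    sum (λ v → fromℕ n ⁻¹ * (sum (λ u → A u v) * f v))   ≡⟨ *-distribˡ-sum (fromℕ n ⁻¹)
      (λ v → sum (λ u → A u v) * f v) ⟨
    fromℕ n ⁻¹ * sum (λ v → sum (λ u → A u v) * f v)     ≡⟨ cong (fromℕ n ⁻¹ *_)
      (sum-cong-≗ λ v → *-distribʳ-sum (f v) (λ u → A u v)) ⟩
    fromℕ n ⁻¹ * sum (λ v → sum (λ u → A u v * f v))     ≡⟨ cong (fromℕ n ⁻¹ *_) (∑-comm λ v u → A u v * f v) ⟩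
    mean (λ u → A u · f)                                 ∎
    where open ≡-Reasoning

  average≡mean : ∀ {n} (M : MarkovChain n) t v → average M t v ≡ mean (λ u → (matrix M ^ t) u v)
  average≡mean M t v = mean-cong λ u → e-· u λ w → (matrix M ^ t) w v

  averageD : ∀ {n} .{{_ : NonZero n}} → MarkovChain n → ℕ → Distribution n
  averageD {n} M t = record
    { prob        = λ v → mean λ u → (matrix M ^ t) u v
    ; nonNegative = λ v → *-nonNegative (0≤1/ n) (sum-nonNeg λ u → ^-nonNeg (matrix-nonNeg M) t u v)
    ; total       = trans (sum-mean (matrix M ^ t)) (trans (mean-cong (sum-^ M t)) (mean-const 1#))
    }

  ½ : Carrier
  ½ = fromℕ 2 ⁻¹

  ½+½ : ½ + ½ ≡ 1#
  ½+½ = trans (solve 1 (λ h → h :+ h := con (pos 2) :* h) refl ½) (*-inverseʳ (fromℕ 2) (<⇒≢ (0<fromℕ 2)))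

  0≤½ : 0# ≤ ½
  0≤½ = 0≤1/ 2

  midpoint : ∀ {n} → Distribution n → Distribution n → Distribution n
  midpoint {n} p q = record
    { prob        = λ v → ½ * prob p v + ½ * prob q v
    ; nonNegative = λ v → 0≤+ (*-nonNegative 0≤½ (nonNegative p v)) (*-nonNegative 0≤½ (nonNegative q v))
    ; total       = begin
        sum (λ v → ½ * prob p v + ½ * prob q v)   ≡⟨ ∑-distrib-+ {n} _ _ ⟩
        sum (λ v → ½ * prob p v) + sum (λ v → ½ * prob q v)
          ≡⟨ cong₂ _+_ (*-distribˡ-sum ½ (prob p)) (*-distribˡ-sum ½ (prob q)) ⟨
        ½ * sum (prob p) + ½ * sum (prob q)       ≡⟨ cong₂ (λ x y → ½ * x + ½ * y) (total p) (total q) ⟩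
        ½ * 1# + ½ * 1#                           ≡⟨ cong₂ _+_ (*-identityʳ ½) (*-identityʳ ½) ⟩
        ½ + ½                                     ≡⟨ ½+½ ⟩
        1#                                        ∎
    }
    where open ≡-Reasoning

  midpoint-· : ∀ {n} (p q : Distribution n) f → prob (midpoint p q) · f ≡ ½ * prob p · f + ½ * prob q · f
  midpoint-· {n} p q f = begin
    sum (λ v → (½ * prob p v + ½ * prob q v) * f v)
      ≡⟨ sum-cong-≗ (λ v → solve 4 (λ h p q f → (h :* p :+ h :* q) :* f := h :* (p :* f) :+ h :* (q :* f))
        refl ½ (prob p v) (prob q v) (f v)) ⟩
    sum (λ v → ½ * (prob p v * f v) + ½ * (prob q v * f v))   ≡⟨ ∑-distrib-+ {n} _ _ ⟩
    sum (λ v → ½ * (prob p v * f v)) + sum (λ v → ½ * (prob q v * f v))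
      ≡⟨ cong₂ _+_ (*-distribˡ-sum ½ λ v → prob p v * f v) (*-distribˡ-sum ½ λ v → prob q v * f v) ⟨
    ½ * prob p · f + ½ * prob q · f   ∎
    where open ≡-Reasoning

  ‖‖-cong : ∀ {n} {x y : Fin n → Carrier} → (∀ i → x i ≡ y i) → ‖ x ‖₁ ≡ ‖ y ‖₁
  ‖‖-cong x≡y = sum-cong-≗ λ i → cong ∣_∣ (x≡y i)

  ℓ₁-cong : ∀ {n} {x x′ y y′ : Fin n → Carrier} →
            (∀ i → x i ≡ x′ i) → (∀ i → y i ≡ y′ i) → ℓ₁ x y ≡ ℓ₁ x′ y′
  ℓ₁-cong x≡x′ y≡y′ = ‖‖-cong λ i → cong₂ (λ a b → a - b) (x≡x′ i) (y≡y′ i)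

  ‖‖-triangle : ∀ {n} (x y : Fin n → Carrier) → ‖ (λ i → x i + y i) ‖₁ ≤ ‖ x ‖₁ + ‖ y ‖₁
  ‖‖-triangle {n} x y = ≤-trans (sum-mono λ i → triangle (x i) (y i)) (≤-reflexive (∑-distrib-+ {n} _ _))

  ℓ₁-triangle : ∀ {n} (x y z : Fin n → Carrier) → ℓ₁ x z ≤ ℓ₁ x y + ℓ₁ y z
  ℓ₁-triangle x y z = ≤-trans
    (≤-reflexive (‖‖-cong λ i → solve 3 (λ x y z → x :- z := (x :- y) :+ (y :- z)) refl (x i) (y i) (z i)))
    (‖‖-triangle (λ i → x i - y i) (λ i → y i - z i))

  ℓ₁-sym : ∀ {n} (x y : Fin n → Carrier) → ℓ₁ x y ≤ ℓ₁ y x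
  ℓ₁-sym x y = sum-mono λ i → ∣∣-≤
    (≤-trans (≤-reflexive (solve 2 (λ x y → x :- y := :- (y :- x)) refl (x i) (y i))) (-x≤∣x∣ _))
    (≤-trans (≤-reflexive (solve 2 (λ x y → :- (x :- y) := y :- x) refl (x i) (y i))) (x≤∣x∣ _))

  ‖·‖-≤ : ∀ {n m} (x : Fin m → Carrier) (D : Fin m → Fin n → Carrier) → (∀ i → 0# ≤ x i) →
          ‖ (λ v → x · (λ i → D i v)) ‖₁ ≤ x · (λ i → ‖ D i ‖₁)
  ‖·‖-≤ x D 0≤x = ≤-trans
    (sum-mono λ v → ≤-trans (∣sum∣-≤ λ i → x i * D i v) (sum-mono λ i → ∣*∣-≤ (0≤x i) (D i v)))
    (≤-reflexive (trans (∑-comm λ v i → x i * ∣ D i v ∣)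
      (sum-cong-≗ λ i → sym (*-distribˡ-sum (x i) λ v → ∣ D i v ∣))))

  -- The coupling inequality: the common part `c` cancels in the difference, and what remains of
  -- each vector contributes at most its mass.
  ℓ₁-common : ∀ {n} (x y c : Fin n → Carrier) → (∀ i → c i ≤ x i) → (∀ i → c i ≤ y i) →
              ℓ₁ x y ≤ (sum x - sum c) + (sum y - sum c)
  ℓ₁-common {n} x y c c≤x c≤y = ≤-trans
    (sum-mono λ i → ∣∣-≤
      (≤-by (fromℕ 2 * (y i - c i)) (*-nonNegative (0≤fromℕ 2) (slack (c≤y i)))
        (solve 3 (λ x y c → (x :- y) :+ con (pos 2) :* (y :- c) := (x :- c) :+ (y :- c)) refl (x i) (y i)
          (c i)))
      (≤-by (fromℕ 2 * (x i - c i)) (*-nonNegative (0≤fromℕ 2) (slack (c≤x i)))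
        (solve 3 (λ x y c → :- (x :- y) :+ con (pos 2) :* (x :- c) := (x :- c) :+ (y :- c)) refl (x i) (y i)
          (c i))))
    (≤-reflexive (trans (∑-distrib-+ {n} _ _) (cong₂ _+_ (sum-sub x c) (sum-sub y c))))

  ℓ₁-≤2 : ∀ {n} (p q : Distribution n) → ℓ₁ (prob p) (prob q) ≤ fromℕ 2
  ℓ₁-≤2 {n} p q = ≤-trans (ℓ₁-common (prob p) (prob q) (λ _ → 0#) (nonNegative p) (nonNegative q))
    (≤-reflexive (trans
      (cong₂ _+_ (cong₂ (λ a b → a - b) (total p) (sum-0 {n} λ _ → refl))
        (cong₂ (λ a b → a - b) (total q) (sum-0 {n} λ _ → refl)))
      (solve 0 ((con (pos 1) :- con (pos 0)) :+ (con (pos 1) :- con (pos 0)) := con (pos 2)) refl)))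

-- Comparing mixtures, excess mass and counts of differing entries

module Repair (ℝ : ArchimedeanField) where

  open OrderedField ℝ
  open Chains ℝ

  ℓ₁-≡ : ∀ {n} {x y : Fin n → Carrier} → (∀ i → x i ≡ y i) → ℓ₁ x y ≤ 0#
  ℓ₁-≡ {n} {x} {y} x≡y = ≤-trans
    (sum-mono {f = λ i → ∣ x i - y i ∣} {g = λ _ → 0#} λ i → subst (λ z → ∣ z ∣ ≤ 0#)
      (sym (trans (cong (_- y i) (x≡y i)) (-‿inverseʳ (y i))))
        (∣∣-≤ ≤-refl (≤-reflexive (solve 0 (:- con (pos 0) := con (pos 0)) refl))))
    (≤-reflexive (sum-0 {n} λ _ → refl))

  -- Convexity of the norm. The target is scaled by `sum x` because `x` will also be the law of a
  -- killed walk, which has mass below 1.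
  mixture-close : ∀ {n} (x : Fin n → Carrier) (D : Matrix n) (a : Fin n → Carrier) → (∀ i → 0# ≤ x i) →
                  ℓ₁ (λ v → x · λ i → D i v) (λ v → sum x * a v) ≤ x · λ i → ℓ₁ (D i) a
  mixture-close x D a 0≤x = ≤-trans
    (≤-reflexive (‖‖-cong λ v → sym (trans (·-sub x (λ i → D i v) (λ _ → a v))
      (cong (λ z → x · (λ i → D i v) - z) (·-const x (a v))))))
    (‖·‖-≤ x (λ i v → D i v - a v) 0≤x)

  ℓ₁-shift : ∀ {n} (x b c : Fin n → Carrier) → ℓ₁ (λ v → x v + b v) c ≤ ℓ₁ x (λ v → c v - b v)
  ℓ₁-shift x b c = ≤-reflexive (‖‖-cong λ v → solve 3 (λ x b c → x :+ b :- c := x :- (c :- b)) refl (x v)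
    (b v) (c v))

  true-or-false : ∀ b → b ≡ true ⊎ b ≡ false
  true-or-false true  = inj₁ refl
  true-or-false false = inj₂ refl

  indicator : Bool → Carrier
  indicator b = if b then 1# else 0#

  -- With h = (p - q)/2, the vector |h| + h is the positive part of p - q. As h sums to 0, its mass
  -- is `‖ h ‖₁`, which is the midpoint distance itself: no factor 2 is lost.
  excess : ∀ {n} (p q : Distribution n) {ε} → ℓ₁ (prob (midpoint p q)) (prob q) ≤ ε →
           Σ[ y ∈ (Fin n → Carrier) ] (∀ v → 0# ≤ y v) × (∀ v → prob p v ≤ prob q v + y v) × sum y ≤ ε
  excess {n} p q {ε} close = (λ v → ∣ h v ∣ + h v)
    , (λ v → subst (_≤ ∣ h v ∣ + h v) (-‿inverseˡ (h v)) (+-mono-≤ (-x≤∣x∣ (h v)) ≤-refl))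
    , (λ v → ≤-by (∣ h v ∣ - h v) (slack (x≤∣x∣ (h v))) (begin
        prob p v + (∣ h v ∣ - h v)
          ≡⟨ cong (_+ (∣ h v ∣ - h v)) (trans (sym (*-identityˡ (prob p v))) (cong (_* prob p v) (sym ½+½))) ⟩
        (½ + ½) * prob p v + (∣ h v ∣ - h v)
          ≡⟨ solve 4 (λ c x y a → (c :+ c) :* x :+ (a :- (c :* x :+ c :* y :- y)) := (con (pos 2) :- (c :+ c))
            :* y :+ (a :+ (c :* x :+ c :* y :- y)) ) refl ½ (prob p v) (prob q v) ∣ h v ∣ ⟩
        (fromℕ 2 - (½ + ½)) * prob q v + (∣ h v ∣ + h v)
          ≡⟨ cong (λ c → (fromℕ 2 - c) * prob q v + (∣ h v ∣ + h v)) ½+½ ⟩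
        (fromℕ 2 - 1#) * prob q v + (∣ h v ∣ + h v)
          ≡⟨ cong (_+ (∣ h v ∣ + h v)) (solve 1 (λ y → (con (pos 2) :- con (pos 1)) :* y := y) refl
            (prob q v)) ⟩
        prob q v + (∣ h v ∣ + h v)   ∎))
    , subst (_≤ ε) (sym (begin
        sum (λ v → ∣ h v ∣ + h v)          ≡⟨ ∑-distrib-+ {n} _ _ ⟩
        ‖ h ‖₁ + sum h                     ≡⟨ cong (‖ h ‖₁ +_)
          (trans (sum-sub (prob m) (prob q)) (trans (cong₂ (λ a b → a - b) (total m) (total q))
          (-‿inverseʳ 1#))) ⟩
        ‖ h ‖₁ + 0#                        ≡⟨ +-identityʳ _ ⟩
        ‖ h ‖₁                             ∎)) close
    where
    open ≡-Reasoning
    m = midpoint p q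
    h : Fin n → Carrier
    h v = prob m v - prob q v

  midpoint-ℓ₁ : ∀ {n} (p q : Distribution n) → ℓ₁ (prob p) (prob q) ≤ fromℕ 2 * ℓ₁ (prob (midpoint p q))
    (prob q)
  midpoint-ℓ₁ {n} p q = ≤-trans
    (sum-mono λ v → ≤-trans (≤-reflexive (cong ∣_∣ (eq v))) (∣*∣-≤ (0≤fromℕ 2) _))
    (≤-reflexive (sym (*-distribˡ-sum {n} (fromℕ 2) _)))
    where
    eq : ∀ v → prob p v - prob q v ≡ fromℕ 2 * (prob (midpoint p q) v - prob q v)
    eq v = sym (trans
      (solve 3 (λ c x y → con (pos 2) :* (c :* x :+ c :* y :- y) := (c :+ c) :* x :+ (c :+ c :- con (pos 2))
        :* y)
        refl ½ (prob p v) (prob q v))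
      (trans (cong (λ c → c * prob p v + (c - fromℕ 2) * prob q v) ½+½)
        (solve 2 (λ x y → con (pos 1) :* x :+ (con (pos 1) :- con (pos 2)) :* y := x :- y) refl (prob p v)
          (prob q v))))

  midpoint-ℓ₁-≤ : ∀ {n} (p q : Distribution n) → ℓ₁ (prob (midpoint p q)) (prob q) ≤ ½ * ℓ₁ (prob p) (prob q)
  midpoint-ℓ₁-≤ {n} p q = ≤-trans
    (sum-mono λ v → ≤-trans (≤-reflexive (cong ∣_∣ (eq v))) (∣*∣-≤ 0≤½ (prob p v - prob q v)))
    (≤-reflexive (sym (*-distribˡ-sum {n} ½ _)))
    where
    eq : ∀ v → prob (midpoint p q) v - prob q v ≡ ½ * (prob p v - prob q v)
    eq v = trans
      (trans (solve 3 (λ c x y → c :* x :+ c :* y :- y := c :* x :+ c :* y :- con (pos 1) :* y) refl ½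
        (prob p v) (prob q v))
        (cong (λ k → ½ * prob p v + ½ * prob q v - k * prob q v) (sym ½+½)))
      (solve 3 (λ c x y → c :* x :+ c :* y :- (c :+ c) :* y := c :* (x :- y)) refl ½ (prob p v) (prob q v))

  -- First 2ε is charged to the whole weight `c`. If `D` exceeds 2ε, the remainder D - 2ε is charged
  -- to `a + y`, where it is at most 4δ on `a` and at most 2 - 2ε on `y`. If it does not, the first
  -- charge suffices, which explains the case split.
  weighted-bound : ∀ {c a y D δ ε} → 0# ≤ c → 0# ≤ a → 0# ≤ y → c ≤ a + y →
                   D ≤ fromℕ 2 → D ≤ fromℕ 2 * ε + fromℕ 4 * δ → 0# ≤ δ → ε ≤ 1# →
                   c * D ≤ (fromℕ 2 * ε) * c + fromℕ 4 * (a * δ) + (fromℕ 2 - fromℕ 2 * ε) * y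
  weighted-bound {c} {a} {y} {D} {δ} {ε} 0≤c 0≤a 0≤y c≤a+y D≤2 D≤2ε+4δ 0≤δ ε≤1 with ≤-total D (fromℕ 2 * ε)
  ... | inj₁ D≤2ε = ≤-by
    (c * (fromℕ 2 * ε - D) + (fromℕ 4 * (a * δ) + (fromℕ 2 * (1# - ε)) * y))
    (0≤+ (*-nonNegative 0≤c (slack D≤2ε))
      (0≤+ (*-nonNegative (0≤fromℕ 4) (*-nonNegative 0≤a 0≤δ))
           (*-nonNegative (*-nonNegative (0≤fromℕ 2) (slack ε≤1)) 0≤y)))
    (solve 6 (λ c a y D δ ε →
       c :* D :+ (c :* (con (pos 2) :* ε :- D) :+ (con (pos 4) :* (a :* δ) :+
         (con (pos 2) :* (con (pos 1) :- ε)) :* y))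
       := (con (pos 2) :* ε) :* c :+ con (pos 4) :* (a :* δ) :+ (con (pos 2) :- con (pos 2) :* ε) :* y) refl c
         a y D δ ε)
  ... | inj₂ 2ε≤D = ≤-by
    ((D - fromℕ 2 * ε) * (a + y - c) + (a * (fromℕ 2 * ε + fromℕ 4 * δ - D) + y * (fromℕ 2 - D)))
    (0≤+ (*-nonNegative (slack 2ε≤D) (slack c≤a+y))
      (0≤+ (*-nonNegative 0≤a (slack D≤2ε+4δ)) (*-nonNegative 0≤y (slack D≤2))))
    (solve 6 (λ c a y D δ ε →
       c :* D :+ ((D :- con (pos 2) :* ε) :* (a :+ y :- c) :+
         (a :* (con (pos 2) :* ε :+ con (pos 4) :* δ :- D) :+ y :* (con (pos 2) :- D)))
       := (con (pos 2) :* ε) :* c :+ con (pos 4) :* (a :* δ) :+ (con (pos 2) :- con (pos 2) :* ε) :* y) refl c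
         a y D δ ε)

  length-filter-map : ∀ {A B : Set} {P : B → Set} (P? : Decidable P) (g : A → B) xs →
                      length (filter P? (List.map g xs)) ≡ length (filter (λ x → P? (g x)) xs)
  length-filter-map P? g [] = refl
  length-filter-map P? g (x ∷ xs) with P? (g x)
  ... | yes _ = cong suc (length-filter-map P? g xs)
  ... | no  _ = length-filter-map P? g xs

  count-product : ∀ {A B : Set} {P : A × B → Set} (P? : Decidable P) {m} (f : Fin m → A) (ys : List B)
    (b : Fin m → Carrier) →
                  (∀ i → fromℕ (length (filter (λ y → P? (f i , y)) ys)) ≤ b i) →
                  fromℕ (length (filter P? (cartesianProduct (tabulate f) ys))) ≤ sum b
  count-product P? {zero}  f ys b row≤b = ≤-refl
  count-product P? {suc m} f ys b row≤b = subst (_≤ sum b) (sym eq)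
    (+-mono-≤ (row≤b zero) (count-product P? (f ∘ suc) ys (b ∘ suc) (row≤b ∘ suc)))
    where
    row  = List.map (f zero ,_) ys
    rest = cartesianProduct (tabulate (f ∘ suc)) ys
    eq : fromℕ (length (filter P? (row ++ rest)))
         ≡ fromℕ (length (filter (λ y → P? (f zero , y)) ys)) + fromℕ (length (filter P? rest))
    eq = begin
      fromℕ (length (filter P? (row ++ rest)))                        ≡⟨ cong (fromℕ ∘ length)
        (List.filter-++ P? row rest) ⟩
      fromℕ (length (filter P? row ++ filter P? rest))                ≡⟨ cong fromℕ
        (List.length-++ (filter P? row)) ⟩
      fromℕ (length (filter P? row) ℕ.+ length (filter P? rest))      ≡⟨ fromℕ-+ (length (filter P? row)) _ ⟩
      fromℕ (length (filter P? row)) + fromℕ (length (filter P? rest))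
        ≡⟨ cong (λ k → fromℕ k + fromℕ (length (filter P? rest))) (length-filter-map P? (f zero ,_) ys) ⟩
      fromℕ (length (filter (λ y → P? (f zero , y)) ys)) + fromℕ (length (filter P? rest))   ∎
      where open ≡-Reasoning

  -- Where two rows differ, at least one of them is nonzero.
  count-≢ : ∀ {n} (x y : Fin n → Carrier) (vs : List (Fin n)) →
            length (filter (λ v → ¬? (x v ≟ y v)) vs)
            ℕ.≤ length (filter (λ v → ¬? (x v ≟ 0#)) vs) ℕ.+ length (filter (λ v → ¬? (y v ≟ 0#)) vs)
  count-≢ x y [] = z≤n
  count-≢ x y (v ∷ vs) with x v ≟ y v | x v ≟ 0# | y v ≟ 0# | count-≢ x y vs
  ... | yes _   | yes _   | yes _   | IH = IH
  ... | yes _   | yes _   | no  _   | IH = ℕ.≤-trans IH (ℕ.+-monoʳ-≤ _ (ℕ.n≤1+n _))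
  ... | yes _   | no  _   | yes _   | IH = ℕ.m≤n⇒m≤1+n IH
  ... | yes _   | no  _   | no  _   | IH = ℕ.≤-trans IH (ℕ.+-mono-≤ (ℕ.n≤1+n _) (ℕ.n≤1+n _))
  ... | no  x≢y | yes x≡0 | yes y≡0 | IH = contradiction (trans x≡0 (sym y≡0)) x≢y
  ... | no  _   | yes _   | no  _   | IH = ℕ.≤-trans (s≤s IH) (ℕ.≤-reflexive (sym (ℕ.+-suc _ _)))
  ... | no  _   | no  _   | yes _   | IH = s≤s IH
  ... | no  _   | no  _   | no  _   | IH = s≤s (ℕ.≤-trans IH (ℕ.+-monoʳ-≤ _ (ℕ.n≤1+n _)))

  count-≡ : ∀ {n} (x : Fin n → Carrier) (vs : List (Fin n)) →
            length (filter (λ v → ¬? (x v ≟ x v)) vs) ≡ 0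
  count-≡ x [] = refl
  count-≡ x (v ∷ vs) with x v ≟ x v
  ... | yes _   = count-≡ x vs
  ... | no  x≢x = contradiction refl x≢x

  cancel-÷ : ∀ {k m x} → fromℕ k ≤ fromℕ m * x → 0# ≤ x → k ÷ m ≤ x
  -- The inverse of 0 is unspecified, but here the numerator is forced to be 0, so the quotient
  -- vanishes whatever that inverse is.
  cancel-÷ {k} {zero} {x} k≤0 0≤x = ≤-trans (≤-reflexive (trans (cong (_* fromℕ 0 ⁻¹)
    (≤-antisym (≤-trans k≤0 (≤-reflexive (zeroˡ x))) (0≤fromℕ k))) (zeroˡ _))) 0≤x
  cancel-÷ {k} {m@(suc _)} {x} k≤mx 0≤x = begin
    fromℕ k * fromℕ m ⁻¹         ≡⟨ *-comm _ _ ⟩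
    fromℕ m ⁻¹ * fromℕ k         ≤⟨ *-monoˡ-≤ (0≤1/ m) k≤mx ⟩
    fromℕ m ⁻¹ * (fromℕ m * x)   ≡⟨ solve 3 (λ i m x → i :* (m :* x) := (m :* i) :* x) refl (fromℕ m ⁻¹)
      (fromℕ m) x ⟩
    fromℕ m * fromℕ m ⁻¹ * x     ≡⟨ cong (_* x) (*-inverseʳ (fromℕ m) (<⇒≢ (0<fromℕ m))) ⟩
    1# * x                       ≡⟨ *-identityˡ x ⟩
    x                            ∎
    where open ≤-Reasoning

  -- The walk killed at bad states

  module _ {n} (M : MarkovChain n) (bad : Fin n → Bool) where

    -- The substochastic matrix of the walk that dies when it tries to leave a bad state. Thus
    -- `survival t u` is the probability that the states at times 0 to t - 1 are all good; the state
    -- at time t does not count.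
    taboo : Matrix n
    taboo u v = if bad u then 0# else matrix M u v

    survival : ℕ → Fin n → Carrier
    survival t u = sum ((taboo ^ t) u)

    taboo-nonNeg : NonNegM taboo
    taboo-nonNeg u v with bad u
    ... | true  = ≤-refl
    ... | false = nonNegative (M u) v

    -- Makes the killed walk a common part of the walks of `M` and of the repaired chain: take `ρ`
    -- to be the identity or the redirection.
    taboo-≼ : (ρ : Fin n → Fin n) → (∀ u → bad u ≡ false → ρ u ≡ u) → taboo ≼ matrix (M ∘ ρ)
    taboo-≼ ρ fix u v with bad u in eq
    ... | true  = nonNegative (M (ρ u)) v
    ... | false = ≤-reflexive (cong (λ w → matrix M w v) (sym (fix u eq)))

    survival-nonNeg : ∀ t u → 0# ≤ survival t u
    survival-nonNeg t u = sum-nonNeg (^-nonNeg taboo-nonNeg t u)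

    survival-≤1 : ∀ t u → survival t u ≤ 1#
    survival-≤1 t u = ≤-trans (sum-mono (^-mono taboo-nonNeg (taboo-≼ id λ _ _ → refl) t u))
      (≤-reflexive (sum-^ M t u))

    survival-+ : ∀ i j u → survival (i ℕ.+ j) u ≡ (taboo ^ i) u · survival j
    survival-+ i j u = trans (sum-cong-≗ (^-+ taboo i j u)) (sum-⊡ ((taboo ^ i) u) (taboo ^ j))

    survival-antitone : ∀ i j u → survival (i ℕ.+ j) u ≤ survival i u
    survival-antitone i j u = ≤-trans (≤-reflexive (survival-+ i j u)) (≤-trans
      (·-monoʳ (^-nonNeg taboo-nonNeg i u) (survival-≤1 j))
      (≤-reflexive (trans (·-const ((taboo ^ i) u) 1#) (*-identityʳ _))))

    survival-step : ∀ t u → survival (suc t) u ≡ taboo u · survival t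
    survival-step t u = sum-⊡ (taboo u) (taboo ^ t)

    survival-bad : ∀ t .{{_ : NonZero t}} u → bad u ≡ true → survival t u ≡ 0#
    survival-bad (suc t) u bad-u rewrite survival-step t u | bad-u = sum-0 λ v → zeroˡ (survival t v)

    survival-good : ∀ t u → bad u ≡ false → survival (suc t) u ≡ matrix M u · survival t
    survival-good t u good-u rewrite survival-step t u | good-u = refl

  -- The repaired chain: mixing and closeness to the original one

  module Repaired {n} .{{n≢0 : NonZero n}} (M : MarkovChain n) (bad : Fin n → Bool) (t : ℕ) .{{t≢0 : NonZero t}}
                  {ε : Carrier} (0≤ε : 0# ≤ ε) (ε≤1 : ε ≤ 1#)
                  (good : ∀ u → bad u ≡ false → ℓ₁ (prob (midpoint (endpoint M t u) (averageD M t)))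
                    (prob (averageD M t)) ≤ ε)
                  (safe : fromℕ 4 * (1# - mean (survival M bad (t ℕ.+ t))) ≤ ε * ε) where

    private
      σ = survival M bad
      N = taboo M bad
      a = averageD M t
      -- The probability that a walk from a uniform state meets a bad state among its first 2t
      -- states.
      κ = 1# - mean (σ (t ℕ.+ t))

    origin : Fin n
    origin = proj₁ (argmax (σ (t ℕ.+ t)))

    redirect : Fin n → Fin n
    redirect u = if bad u then origin else u

    repaired : MarkovChain n
    repaired = M ∘ redirect

    private
      A′ : ℕ → Matrix n
      A′ i = matrix repaired ^ i

      0≤N : NonNegM N
      0≤N = taboo-nonNeg M bad

      N≼M : N ≼ matrix M
      N≼M = taboo-≼ M bad id λ _ _ → refl

      N≼M′ : N ≼ matrix repaired
      N≼M′ = taboo-≼ M bad redirect fix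
        where
        fix : ∀ u → bad u ≡ false → redirect u ≡ u
        fix u good-u rewrite good-u = refl

      0≤1-σ : ∀ i u → 0# ≤ 1# - σ i u
      0≤1-σ i u = slack (survival-≤1 M bad i u)

      origin-safe : 1# - σ (t ℕ.+ t) origin ≤ κ
      origin-safe = +-monoʳ-≤ 1# (neg-mono-≤ (≤-trans
        (mean-mono (proj₂ (argmax (σ (t ℕ.+ t))))) (≤-reflexive (mean-const (σ (t ℕ.+ t) origin)))))

      0≤κ : 0# ≤ κ
      0≤κ = ≤-trans (0≤1-σ (t ℕ.+ t) origin) origin-safe

      4κ≤ε : fromℕ 4 * κ ≤ ε
      4κ≤ε = ≤-trans safe (≤-by (ε * (1# - ε)) (*-nonNegative 0≤ε (slack ε≤1))
        (solve 1 (λ ε → ε :* ε :+ ε :* (con (pos 1) :- ε) := ε) refl ε))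

      κ≤ε : κ ≤ ε
      κ≤ε = ≤-trans (≤-by (fromℕ 3 * κ) (*-nonNegative (0≤fromℕ 3) 0≤κ)
        (solve 1 (λ k → k :+ con (pos 3) :* k := con (pos 4) :* k) refl κ)) 4κ≤ε

      -- The two walks agree until they leave a bad state, so the killed walk is a common part of
      -- mass `σ i u`.
      follow : ∀ i u → ℓ₁ (A′ i u) ((matrix M ^ i) u) ≤ fromℕ 2 * (1# - σ i u)
      follow i u = ≤-trans
        (ℓ₁-common (A′ i u) ((matrix M ^ i) u) ((N ^ i) u)
          (^-mono 0≤N N≼M′ i u) (^-mono 0≤N N≼M i u))
        (≤-reflexive (trans (cong₂ (λ x y → (x - σ i u) + (y - σ i u)) (sum-^ repaired i u) (sum-^ M i u))
          (solve 1 (λ s → (con (pos 1) :- s) :+ (con (pos 1) :- s) := con (pos 2) :* (con (pos 1) :- s)) refl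
            (σ i u))))

      -- Uniform in `u`: at a good state the first term is enough, and at a bad one `σ t u` is 0, so
      -- the second term is the trivial bound 2.
      near-average : ∀ u → ℓ₁ ((matrix M ^ t) u) (prob a) ≤ fromℕ 2 * ε + fromℕ 2 * (1# - σ t u)
      near-average u with bad u in eq
      ... | false = ≤-trans (midpoint-ℓ₁ (endpoint M t u) a) (≤-by (fromℕ 2 * (ε - x) + fromℕ 2 * (1# - σ t u))
              (0≤+ (*-nonNegative (0≤fromℕ 2) (slack (good u eq))) (*-nonNegative (0≤fromℕ 2) (0≤1-σ t u)))
              (solve 3 (λ x ε s → con (pos 2) :* x :+ (con (pos 2) :* (ε :- x) :+ con (pos 2) :* s) := con
                (pos 2) :* ε :+ con (pos 2) :* s) refl x ε (1# - σ t u)))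
        where x = ℓ₁ (prob (midpoint (endpoint M t u) a)) (prob a)
      ... | true = ≤-trans (ℓ₁-≤2 (endpoint M t u) a) (≤-by (fromℕ 2 * ε) (*-nonNegative (0≤fromℕ 2) 0≤ε)
              (trans (solve 1 (λ ε → con (pos 2) :+ con (pos 2) :* ε := con (pos 2) :* ε :+ con (pos 2) :*
                (con (pos 1) :- con (pos 0))) refl ε)
                (cong (λ s → fromℕ 2 * ε + fromℕ 2 * (1# - s)) (sym (survival-bad M bad t u eq)))))

      distance : Fin n → Carrier
      distance w = ℓ₁ (A′ t w) (prob a)

      distance-≤ : ∀ w → distance w ≤ fromℕ 2 * ε + fromℕ 4 * (1# - σ t w)
      distance-≤ w = ≤-trans (ℓ₁-triangle (A′ t w) ((matrix M ^ t) w) (prob a))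
        (≤-trans (+-mono-≤ (follow t w) (near-average w))
          (≤-reflexive (solve 2 (λ s ε → con (pos 2) :* s :+ (con (pos 2) :* ε :+ con (pos 2) :* s) := con
            (pos 2) :* ε :+ con (pos 4) :* s) refl (1# - σ t w) ε)))

      γ : Carrier
      γ = fromℕ 2 * ε + fromℕ 4 * κ

      0≤γ : 0# ≤ γ
      0≤γ = 0≤+ (*-nonNegative (0≤fromℕ 2) 0≤ε) (*-nonNegative (0≤fromℕ 4) 0≤κ)

      σ-late : ∀ {i} → i ℕ.≤ t → σ (t ℕ.+ t) origin ≤ σ (i ℕ.+ t) origin
      σ-late {i} i≤t = subst (λ k → σ k origin ≤ σ (i ℕ.+ t) origin)
        (trans (ℕ.+-assoc i t (t ℕ.∸ i)) (trans (cong (i ℕ.+_) (ℕ.+-comm t (t ℕ.∸ i)))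
          (trans (sym (ℕ.+-assoc i (t ℕ.∸ i) t)) (cong (ℕ._+ t) (ℕ.m+[n∸m]≡n i≤t)))))
        (survival-antitone M bad (i ℕ.+ t) (t ℕ.∸ i) origin)

      -- `distance-≤` is averaged over the state after i steps. The repaired walk dominates the
      -- killed one, so from there t more steps are survived with probability at least
      -- `σ (i + t) origin`, which is at least `σ (t + t) origin` as `i ≤ t`.
      origin-close : ∀ i → i ℕ.≤ t → ℓ₁ (A′ (i ℕ.+ t) origin) (prob a) ≤ γ
      origin-close i i≤t = begin
        ℓ₁ (A′ (i ℕ.+ t) origin) (prob a)
          ≡⟨ ℓ₁-cong (^-+ (matrix repaired) i t origin) (λ v → sym
            (trans (cong (_* prob a v) (sum-^ repaired i origin)) (*-identityˡ _))) ⟩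
        ℓ₁ (A′ i origin ⊡ A′ t) (λ v → sum (A′ i origin) * prob a v)
          ≤⟨ mixture-close (A′ i origin) (A′ t) (prob a) (^-nonNeg (matrix-nonNeg repaired) i origin) ⟩
        A′ i origin · distance
          ≤⟨ ·-monoʳ (^-nonNeg (matrix-nonNeg repaired) i origin) distance-≤ ⟩
        A′ i origin · (λ w → fromℕ 2 * ε + fromℕ 4 * (1# - σ t w))
          ≡⟨ ·-affine ⟩
        fromℕ 2 * ε + fromℕ 4 * (1# - A′ i origin · σ t)
          ≤⟨ +-monoʳ-≤ _ (*-monoˡ-≤ (0≤fromℕ 4) (≤-trans (+-monoʳ-≤ 1# (neg-mono-≤ (≤-trans (σ-late i≤t)
               (≤-trans (≤-reflexive (survival-+ M bad i t origin))
                 (·-mono (^-nonNeg 0≤N i origin) (^-mono 0≤N N≼M′ i origin) (survival-nonNeg M bad t) λ _ →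
                   ≤-refl))))) origin-safe)) ⟩
        γ ∎
        where
        open ≤-Reasoning
        ·-affine : A′ i origin · (λ w → fromℕ 2 * ε + fromℕ 4 * (1# - σ t w))
                   ≡ fromℕ 2 * ε + fromℕ 4 * (1# - A′ i origin · σ t)
        ·-affine = trans (·-+ (A′ i origin) (λ _ → fromℕ 2 * ε) (λ w → fromℕ 4 * (1# - σ t w)))
          (cong₂ _+_ (prob-·-const (endpoint repaired i origin) (fromℕ 2 * ε))
            (trans (·-scale (A′ i origin) (λ w → 1# - σ t w) (fromℕ 4))
              (cong (fromℕ 4 *_) (trans (·-sub (A′ i origin) (λ _ → 1#) (σ t))
                (cong (_- A′ i origin · σ t) (prob-·-const (endpoint repaired i origin) 1#))))))

      -- The walk of M′ from u, with every restart at origin within the first i steps replaced by a.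
      ideal : ℕ → Fin n → Fin n → Carrier
      ideal i u v = ((N ^ i) u ⊡ A′ t) v + (1# - σ i u) * prob a v

      -- At a bad state the walk restarts at once, `ideal` is just `a`, and `origin-close` applies
      -- with full weight. At a good state both laws are averages over the next state, and so are
      -- the death probabilities `1# - σ i w`.
      ideal-close : ∀ i → i ℕ.≤ t → ∀ u → ℓ₁ (A′ (i ℕ.+ t) u) (ideal i u) ≤ (1# - σ i u) * γ
      ideal-close zero _ u = ≤-trans (ℓ₁-≡ λ v → sym (trans
          (cong₂ (λ x s → x + (1# - s) * prob a v) (e-· u λ w → A′ t w v) (sum-e u))
          (solve 2 (λ x a → x :+ (con (pos 1) :- con (pos 1)) :* a := x) refl (A′ t u v) (prob a v))))
        (*-nonNegative (0≤1-σ 0 u) 0≤γ)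
      ideal-close (suc i) i<t u = [ after-restart , after-step ]′ (true-or-false (bad u))
        where
        after-restart : bad u ≡ true → ℓ₁ (A′ (suc i ℕ.+ t) u) (ideal (suc i) u) ≤ (1# - σ (suc i) u) * γ
        after-restart eq = ≤-trans (≤-reflexive (ℓ₁-cong restart idle))
            (≤-trans (origin-close (suc i) i<t) (≤-reflexive (trans
              (solve 1 (λ g → g := (con (pos 1) :- con (pos 0)) :* g) refl γ)
              (cong (λ s → (1# - s) * γ) (sym (survival-bad M bad (suc i) u eq))))))
          where
          restart : ∀ v → A′ (suc (i ℕ.+ t)) u v ≡ A′ (suc (i ℕ.+ t)) origin v
          -- `redirect origin` is `origin` whether or not `origin` is bad, so the rows of `u` and
          -- `origin` coincide in both cases.
          restart v with bad origin
          ... | true  rewrite eq = refl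
          ... | false rewrite eq = refl
          idle : ∀ v → ideal (suc i) u v ≡ prob a v
          idle v = trans (cong₂ (λ x s → x + (1# - s) * prob a v)
              (sum-0 λ w → trans (cong (_* A′ t w v) (sum-0 λ z → trans
                (cong (λ b → (if b then 0# else matrix M u z) * (N ^ i) z w) eq) (zeroˡ _))) (zeroˡ _))
              (survival-bad M bad (suc i) u eq))
            (solve 1 (λ a → con (pos 0) :+ (con (pos 1) :- con (pos 0)) :* a := a) refl (prob a v))
        after-step : bad u ≡ false → ℓ₁ (A′ (suc i ℕ.+ t) u) (ideal (suc i) u) ≤ (1# - σ (suc i) u) * γ
        after-step eq = begin
            ℓ₁ (A′ (suc (i ℕ.+ t)) u) (ideal (suc i) u)
              ≡⟨ ‖‖-cong step ⟩
            ‖ (λ v → matrix M u · λ w → A′ (i ℕ.+ t) w v - ideal i w v) ‖₁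
              ≤⟨ ‖·‖-≤ (matrix M u) (λ w v → A′ (i ℕ.+ t) w v - ideal i w v) (nonNegative (M u)) ⟩
            matrix M u · (λ w → ℓ₁ (A′ (i ℕ.+ t) w) (ideal i w))
              ≤⟨ ·-monoʳ (nonNegative (M u)) (ideal-close i (ℕ.<⇒≤ i<t)) ⟩
            matrix M u · (λ w → (1# - σ i w) * γ)
              ≡⟨ trans (·-congʳ (matrix M u) (λ w → *-comm (1# - σ i w) γ))
                (trans (·-scale (matrix M u) (λ w → 1# - σ i w) γ)
                   (trans (*-comm γ _) (cong (_* γ) death))) ⟩
            (1# - σ (suc i) u) * γ ∎
          where
          open ≤-Reasoning
          death : matrix M u · (λ w → 1# - σ i w) ≡ 1# - σ (suc i) u
          death = trans (·-sub (matrix M u) (λ _ → 1#) (σ i))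
            (cong₂ (λ x y → x - y) (prob-·-const (M u) 1#) (sym (survival-good M bad i u eq)))
          row : ∀ v → A′ (suc (i ℕ.+ t)) u v ≡ matrix M u · λ w → A′ (i ℕ.+ t) w v
          row v rewrite eq = refl
          kept : ∀ v → ((N ^ suc i) u ⊡ A′ t) v ≡ matrix M u · λ w → ((N ^ i) w ⊡ A′ t) v
          kept v = trans (⊡-· (N u) (N ^ i) λ w → A′ t w v)
            (sum-cong-≗ λ w → cong (λ b → (if b then 0# else matrix M u w) * ((N ^ i) w ⊡ A′ t) v) eq)
          step : ∀ v → A′ (suc (i ℕ.+ t)) u v - ideal (suc i) u v ≡ matrix M u · λ w → A′ (i ℕ.+ t) w v -
            ideal i w v
          step v = sym (trans (·-sub (matrix M u) (λ w → A′ (i ℕ.+ t) w v) (λ w → ideal i w v))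
            (cong₂ (λ x y → x - y) (sym (row v))
              (trans (·-+ (matrix M u) (λ w → ((N ^ i) w ⊡ A′ t) v) (λ w → (1# - σ i w) * prob a v))
                (cong₂ _+_ (sym (kept v))
                  (trans (·-congʳ (matrix M u) λ w → *-comm (1# - σ i w) (prob a v))
                    (trans (·-scale (matrix M u) (λ w → 1# - σ i w) (prob a v))
                      (trans (cong (prob a v *_) death) (*-comm (prob a v) _))))))))

      -- A uniform walk that survives 2t steps survives its last t steps. Forgetting the killing in
      -- the first half only increases survival and makes the law at time t equal to `a`.
      a-safe : prob a · (λ w → 1# - σ t w) ≤ κ
      a-safe = begin
        prob a · (λ w → 1# - σ t w)     ≡⟨ ·-sub (prob a) (λ _ → 1#) (σ t) ⟩
        prob a · (λ _ → 1#) - prob a · σ t   ≡⟨ cong₂ (λ x y → x - y) (prob-·-const a 1#)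
          (mean-· (matrix M ^ t) (σ t)) ⟩
        1# - mean (λ u → (matrix M ^ t) u · σ t)
          ≤⟨ +-monoʳ-≤ 1# (neg-mono-≤ (mean-mono λ u → ≤-trans (≤-reflexive (survival-+ M bad t t u))
               (·-mono (^-nonNeg 0≤N t u) (^-mono 0≤N N≼M t u) (survival-nonNeg M bad t) λ _ → ≤-refl))) ⟩
        κ ∎
        where open ≤-Reasoning

      unhit-close : ∀ u → (N ^ t) u · distance ≤ (fromℕ 2 * ε) * σ t u + fromℕ 4 * κ + (fromℕ 2 - fromℕ 2 * ε)
        * ε
      unhit-close u = [ dead , alive ]′ (true-or-false (bad u))
        where
        open ≤-Reasoning
        0≤2-2ε : 0# ≤ fromℕ 2 - fromℕ 2 * ε
        0≤2-2ε = subst (0# ≤_) (solve 1 (λ ε → con (pos 2) :* (con (pos 1) :- ε) := con (pos 2) :- con (pos 2)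
          :* ε) refl ε)
          (*-nonNegative (0≤fromℕ 2) (slack ε≤1))
        dead : bad u ≡ true → (N ^ t) u · distance ≤ (fromℕ 2 * ε) * σ t u + fromℕ 4 * κ +
          (fromℕ 2 - fromℕ 2 * ε) * ε
        dead eq = begin
          (N ^ t) u · distance             ≤⟨ ·-monoʳ (^-nonNeg 0≤N t u)
            (λ w → ℓ₁-≤2 (endpoint repaired t w) a) ⟩
          (N ^ t) u · (λ _ → fromℕ 2)      ≡⟨ ·-const ((N ^ t) u) (fromℕ 2) ⟩
          σ t u * fromℕ 2                  ≡⟨ cong (_* fromℕ 2) (survival-bad M bad t u eq) ⟩
          0# * fromℕ 2                     ≡⟨ zeroˡ _ ⟩
          0#                               ≤⟨ 0≤+ (0≤+ (*-nonNegative (*-nonNegative (0≤fromℕ 2) 0≤ε)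
            (survival-nonNeg M bad t u))
                                                (*-nonNegative (0≤fromℕ 4) 0≤κ)) (*-nonNegative 0≤2-2ε 0≤ε) ⟩
          (fromℕ 2 * ε) * σ t u + fromℕ 4 * κ + (fromℕ 2 - fromℕ 2 * ε) * ε   ∎
        alive : bad u ≡ false → (N ^ t) u · distance ≤ (fromℕ 2 * ε) * σ t u + fromℕ 4 * κ +
          (fromℕ 2 - fromℕ 2 * ε) * ε
        alive eq = dominated (excess (endpoint M t u) a (good u eq))
          where
          dominated : Σ[ y ∈ (Fin n → Carrier) ] (∀ v → 0# ≤ y v) ×
            (∀ v → (matrix M ^ t) u v ≤ prob a v + y v) × sum y ≤ ε →
                      (N ^ t) u · distance ≤ (fromℕ 2 * ε) * σ t u + fromℕ 4 * κ + (fromℕ 2 - fromℕ 2 * ε) * ε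
          dominated (y , 0≤y , p≤a+y , sum-y≤ε) = begin
            (N ^ t) u · distance
              ≤⟨ sum-mono (λ w → weighted-bound (^-nonNeg 0≤N t u w) (nonNegative a w) (0≤y w)
                   (≤-trans (^-mono 0≤N N≼M t u w) (p≤a+y w)) (ℓ₁-≤2 (endpoint repaired t w) a)
                   (distance-≤ w) (0≤1-σ t w) ε≤1) ⟩
            sum (λ w → (fromℕ 2 * ε) * (N ^ t) u w + fromℕ 4 * (prob a w * (1# - σ t w)) +
              (fromℕ 2 - fromℕ 2 * ε) * y w)
              ≡⟨ trans (∑-distrib-+ {n} (λ w → (fromℕ 2 * ε) * (N ^ t) u w + fromℕ 4 *
                (prob a w * (1# - σ t w))) (λ w → (fromℕ 2 - fromℕ 2 * ε) * y w))
                (cong₂ _+_ (trans (∑-distrib-+ {n} (λ w → (fromℕ 2 * ε) * (N ^ t) u w)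
                (λ w → fromℕ 4 * (prob a w * (1# - σ t w))))
                   (cong₂ _+_ (sym (*-distribˡ-sum (fromℕ 2 * ε) ((N ^ t) u)))
                     (sym (*-distribˡ-sum (fromℕ 4) λ w → prob a w * (1# - σ t w)))))
                   (sym (*-distribˡ-sum (fromℕ 2 - fromℕ 2 * ε) y))) ⟩
            (fromℕ 2 * ε) * σ t u + fromℕ 4 * prob a · (λ w → 1# - σ t w) + (fromℕ 2 - fromℕ 2 * ε) * sum y
              ≤⟨ +-mono-≤ (+-monoʳ-≤ _ (*-monoˡ-≤ (0≤fromℕ 4) a-safe)) (*-monoˡ-≤ 0≤2-2ε sum-y≤ε) ⟩
            (fromℕ 2 * ε) * σ t u + fromℕ 4 * κ + (fromℕ 2 - fromℕ 2 * ε) * ε   ∎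

      endpoint-close : ∀ u → ℓ₁ (A′ (t ℕ.+ t) u) (prob a) ≤ fromℕ 4 * ε
      endpoint-close u = begin
        ℓ₁ (A′ (t ℕ.+ t) u) (prob a)
          ≤⟨ ℓ₁-triangle (A′ (t ℕ.+ t) u) (ideal t u) (prob a) ⟩
        ℓ₁ (A′ (t ℕ.+ t) u) (ideal t u) + ℓ₁ (ideal t u) (prob a)
          ≤⟨ +-mono-≤ (ideal-close t ℕ.≤-refl u) (begin
               ℓ₁ (ideal t u) (prob a)
                 ≤⟨ ℓ₁-shift ((N ^ t) u ⊡ A′ t) (λ v → (1# - σ t u) * prob a v) (prob a) ⟩
               ℓ₁ ((N ^ t) u ⊡ A′ t) (λ v → prob a v - (1# - σ t u) * prob a v)
                 ≡⟨ ℓ₁-cong (λ _ → refl) (λ v → solve 2 (λ s a → a :- (con (pos 1) :- s) :* a := s :* a) refl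
                   (σ t u) (prob a v)) ⟩
               ℓ₁ ((N ^ t) u ⊡ A′ t) (λ v → sum ((N ^ t) u) * prob a v)
                 ≤⟨ mixture-close ((N ^ t) u) (A′ t) (prob a) (^-nonNeg 0≤N t u) ⟩
               (N ^ t) u · distance
                 ≤⟨ unhit-close u ⟩
               (fromℕ 2 * ε) * σ t u + fromℕ 4 * κ + (fromℕ 2 - fromℕ 2 * ε) * ε ∎) ⟩
        (1# - σ t u) * γ + ((fromℕ 2 * ε) * σ t u + fromℕ 4 * κ + (fromℕ 2 - fromℕ 2 * ε) * ε)
          -- The sum equals 4ε + 8κ - 4κσ - 2ε², so `safe`, doubled, is exactly what brings it down
          -- to 4ε.
          ≤⟨ ≤-by (fromℕ 2 * (ε * ε - fromℕ 4 * κ) + fromℕ 4 * (κ * σ t u))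
               (0≤+ (*-nonNegative (0≤fromℕ 2) (slack safe)) (*-nonNegative (0≤fromℕ 4)
                 (*-nonNegative 0≤κ (survival-nonNeg M bad t u))))
               (solve 3 (λ s k ε →
                  (con (pos 1) :- s) :* (con (pos 2) :* ε :+ con (pos 4) :* k) :+
                    ((con (pos 2) :* ε) :* s :+ con (pos 4) :* k :+ (con (pos 2) :- con (pos 2) :* ε) :* ε)
                    :+ (con (pos 2) :* (ε :* ε :- con (pos 4) :* k) :+ con (pos 4) :* (k :* s))
                  := con (pos 4) :* ε) refl (σ t u) κ ε) ⟩
        fromℕ 4 * ε ∎
        where open ≤-Reasoning

    repaired-mixing : Mixing (fromℕ 4 * ε) (2 ℕ.* t) repaired
    repaired-mixing = a , λ u → ≤-trans
      (≤-reflexive (ℓ₁-cong (λ v → trans (e-· u λ w → A′ (2 ℕ.* t) w v)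
        (cong (λ s → A′ s u v) (cong (t ℕ.+_) (ℕ.+-identityʳ t)))) λ _ → refl))
      (endpoint-close u)

    private
      -- Both averages contain the averaged killed walk, whose mass is at least 1 - κ. Hence they
      -- differ by at most 2κ, well below the allowed bound.
      average-close : ℓ₁ (average M t) (average repaired t) ≤ (101 ÷ 100) * ε
      average-close = begin
        ℓ₁ (average M t) (average repaired t)
          ≡⟨ ℓ₁-cong (average≡mean M t) (average≡mean repaired t) ⟩
        ℓ₁ (prob a) (prob a′)
          ≤⟨ ℓ₁-common (prob a) (prob a′) c
               (λ v → mean-mono λ u → ^-mono 0≤N N≼M t u v) (λ v → mean-mono λ u → ^-mono 0≤N N≼M′ t u v) ⟩
        (sum (prob a) - sum c) + (sum (prob a′) - sum c)
          ≡⟨ cong₂ (λ x y → (x - sum c) + (y - sum c)) (total a) (total a′) ⟩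
        (1# - sum c) + (1# - sum c)
          ≡⟨ cong (λ s → (1# - s) + (1# - s)) (sum-mean (N ^ t)) ⟩
        (1# - mean (σ t)) + (1# - mean (σ t))
          ≤⟨ +-mono-≤ mean-κ mean-κ ⟩
        κ + κ
          ≤⟨ ≤-by (fromℕ 2 * κ) (*-nonNegative (0≤fromℕ 2) 0≤κ)
               (solve 1 (λ k → (k :+ k) :+ con (pos 2) :* k := con (pos 4) :* k) refl κ) ⟩
        fromℕ 4 * κ
          ≤⟨ 4κ≤ε ⟩
        ε
          ≡⟨ trans (sym (*-identityˡ ε)) (cong (_* ε) (sym (*-inverseʳ (fromℕ 100) (<⇒≢ (0<fromℕ 100))))) ⟩
        fromℕ 100 * fromℕ 100 ⁻¹ * ε
          ≤⟨ ≤-by (fromℕ 100 ⁻¹ * ε) (*-nonNegative (0≤1/ 100) 0≤ε)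
               (solve 3 (λ k c ε → k :* c :* ε :+ c :* ε := (con (pos 1) :+ k) :* c :* ε) refl (fromℕ 100)
                 (fromℕ 100 ⁻¹) ε) ⟩
        (101 ÷ 100) * ε ∎
        where
        open ≤-Reasoning
        a′ = averageD repaired t
        c : Fin n → Carrier
        c v = mean λ u → (N ^ t) u v
        mean-κ : 1# - mean (σ t) ≤ κ
        mean-κ = +-monoʳ-≤ 1# (neg-mono-≤ (mean-mono (survival-antitone M bad t t)))

      -- A walk that starts at a bad state has met one already, so the fraction of bad states is at
      -- most κ.
      few-bad : sum (λ u → indicator (bad u)) ≤ fromℕ n * κ
      few-bad = begin
        sum (λ u → indicator (bad u))               ≤⟨ sum-mono bad≤ ⟩
        sum (λ u → 1# - σ (t ℕ.+ t) u)              ≡⟨ *-identityˡ _ ⟨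
        1# * sum (λ u → 1# - σ (t ℕ.+ t) u)
          ≡⟨ cong (_* sum (λ u → 1# - σ (t ℕ.+ t) u)) (*-inverseʳ (fromℕ n) (<⇒≢ (0<fromℕ n))) ⟨
        fromℕ n * fromℕ n ⁻¹ * sum (λ u → 1# - σ (t ℕ.+ t) u)   ≡⟨ *-assoc _ _ _ ⟩
        fromℕ n * mean (λ u → 1# - σ (t ℕ.+ t) u)
          ≡⟨ cong (fromℕ n *_) (trans (mean-sub (λ _ → 1#) (σ (t ℕ.+ t)))
            (cong (_- mean (σ (t ℕ.+ t))) (mean-const {n} 1#))) ⟩
        fromℕ n * κ                                 ∎
        where
        open ≤-Reasoning
        bad≤ : ∀ u → indicator (bad u) ≤ 1# - σ (t ℕ.+ t) u
        bad≤ u with bad u in eq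
        ... | false = 0≤1-σ (t ℕ.+ t) u
        ... | true  = ≤-reflexive (trans (solve 0 (con (pos 1) := con (pos 1) :- con (pos 0)) refl)
          (cong (λ s → 1# - s) (sym (extinct t))))
          where
          extinct : ∀ s .{{_ : NonZero s}} → σ (s ℕ.+ t) u ≡ 0#
          extinct (suc s) = survival-bad M bad (suc (s ℕ.+ t)) u eq

      -- Only rows of bad states change. Old and new row have at most d nonzero entries each, so a
      -- changed row counts at most 2d times; this is the 2 of 2ε.
      few-differences : ∀ d → Sparse d M → fromℕ (differences M repaired) ≤ fromℕ (d ℕ.* n) * (fromℕ 2 * ε)
      few-differences d sparse = begin
        fromℕ (differences M repaired)
          ≤⟨ count-product (λ (u , v) → ¬? (matrix M u v ≟ matrix repaired u v)) id (allFin n)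
            (λ u → indicator (bad u) * fromℕ (d ℕ.+ d)) row ⟩
        sum (λ u → indicator (bad u) * fromℕ (d ℕ.+ d))   ≡⟨ *-distribʳ-sum (fromℕ (d ℕ.+ d))
          (λ u → indicator (bad u)) ⟨
        sum (λ u → indicator (bad u)) * fromℕ (d ℕ.+ d)   ≡⟨ *-comm _ _ ⟩
        fromℕ (d ℕ.+ d) * sum (λ u → indicator (bad u))   ≤⟨ *-monoˡ-≤ (0≤fromℕ (d ℕ.+ d))
          (≤-trans few-bad (*-monoˡ-≤ (0≤fromℕ n) κ≤ε)) ⟩
        fromℕ (d ℕ.+ d) * (fromℕ n * ε)                   ≡⟨ cong (_* (fromℕ n * ε)) (fromℕ-+ d d) ⟩
        (fromℕ d + fromℕ d) * (fromℕ n * ε)               ≡⟨ solve 3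
          (λ d n ε → (d :+ d) :* (n :* ε) := (d :* n) :* (con (pos 2) :* ε)) refl (fromℕ d) (fromℕ n) ε ⟩
        (fromℕ d * fromℕ n) * (fromℕ 2 * ε)               ≡⟨ cong (_* (fromℕ 2 * ε)) (fromℕ-* d n) ⟨
        fromℕ (d ℕ.* n) * (fromℕ 2 * ε)                   ∎
        where
        open ≤-Reasoning
        row : ∀ u → fromℕ (length (filter (λ v → ¬? (matrix M u v ≟ matrix repaired u v)) (allFin n))) ≤
          indicator (bad u) * fromℕ (d ℕ.+ d)
        row u with bad u
        ... | true  = ≤-trans (fromℕ-mono-≤ (ℕ.≤-trans (count-≢ (matrix M u) (matrix M origin) (allFin n))
          (ℕ.+-mono-≤ (sparse u) (sparse origin))))
                        (≤-reflexive (sym (*-identityˡ _)))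
        ... | false = ≤-trans (≤-reflexive (cong fromℕ (count-≡ (matrix M u) (allFin n))))
          (≤-reflexive (sym (zeroˡ (fromℕ (d ℕ.+ d)))))

    repaired-close : ∀ d → Sparse d M → Close d t (fromℕ 2 * ε) ((101 ÷ 100) * ε) M repaired
    repaired-close d sparse = cancel-÷ {differences M repaired} {d ℕ.* n} (few-differences d sparse)
      (*-nonNegative (0≤fromℕ 2) 0≤ε) , average-close

    repaired-sparse : ∀ d → Sparse d M → Sparse d repaired
    repaired-sparse d sparse u = sparse (redirect u)

-- The program of the test

-- Cells of the test: 0 holds n, 1 holds t, 2 the number K of walks, 3 the remaining budget, 4 the
-- walks left, 5 the visits left, 6 the current state, 7 the counter, 9 the stride S, and 10 and 11
-- the position and the steps left of a walk that answers a query of the tester.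
--
-- While the tester runs with budget y, its cell a lives at 12 + (y + S * a); since y changes after
-- every run, each run finds its cells initialised to 0.
address : NExp → NExp
address a = nop add (lit 12) (nop add N[ lit 3 ] (nop mul N[ lit 9 ] a))

relocateᴺ : NExp → NExp
relocateᴺ (lit k)     = lit k
relocateᴺ N[ a ]      = N[ address (relocateᴺ a) ]
relocateᴺ (nop o a b) = nop o (relocateᴺ a) (relocateᴺ b)

relocateᴿ : RExp → RExp
relocateᴿ (cast a)    = cast (relocateᴺ a)
relocateᴿ R[ a ]      = R[ address (relocateᴺ a) ]
relocateᴿ (rop o x y) = rop o (relocateᴿ x) (relocateᴿ y)

relocateᵀ : Test → Test
relocateᵀ (leqN a b) = leqN (relocateᴺ a) (relocateᴺ b)
relocateᵀ (leqR x y) = leqR (relocateᴿ x) (relocateᴿ y)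
relocateᵀ (neg b)    = neg (relocateᵀ b)

walkLoop : Instr
walkLoop = while (leqN (lit 1) N[ lit 11 ])
  (N[ lit 10 ]≔query N[ lit 10 ] ∷ N[ lit 11 ]≔ nop sub N[ lit 11 ] (lit 1) ∷ [])

-- Query 0 samples the midpoint of the t-step distribution of the state in cell 6 and the average
-- one, every other query samples the average one.
sample : NExp → NExp → Program
sample a b =
  N[ lit 10 ]≔rand N[ lit 0 ] ∷
  cond (leqN b (lit 0))
    (N[ lit 11 ]≔rand lit 2 ∷
     cond (leqN N[ lit 11 ] (lit 0)) (N[ lit 10 ]≔ N[ lit 6 ] ∷ []) [] ∷ [])
    [] ∷
  N[ lit 11 ]≔ N[ lit 1 ] ∷
  walkLoop ∷
  N[ a ]≔ N[ lit 10 ] ∷ []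

relocateᴵ : Instr → Program
relocate  : Program → Program
relocateᴵ (N[ a ]≔ b)      = N[ address (relocateᴺ a) ]≔ relocateᴺ b ∷ []
relocateᴵ (R[ a ]≔ x)      = R[ address (relocateᴺ a) ]≔ relocateᴿ x ∷ []
relocateᴵ (N[ a ]≔rand b)  = N[ address (relocateᴺ a) ]≔rand relocateᴺ b ∷ []
relocateᴵ (N[ a ]≔query b) = sample (address (relocateᴺ a)) (relocateᴺ b)
relocateᴵ (cond b P₁ P₂)   = cond (relocateᵀ b) (relocate P₁) (relocate P₂) ∷ []
relocateᴵ (while b P₁)     = while (relocateᵀ b) (relocate P₁) ∷ []
relocate []       = []
relocate (i ∷ P)  = relocateᴵ i ++ relocate P

decrement increment : ℕ → Instr
decrement a = N[ lit a ]≔ nop sub N[ lit a ] (lit 1)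
increment a = N[ lit a ]≔ nop add N[ lit a ] (lit 1)

gambleBody : Program → Program
gambleBody P =
  N[ address (lit 0) ]≔ N[ lit 0 ] ∷
  R[ address (lit 0) ]≔ R[ lit 0 ] ∷
  R[ address (lit 1) ]≔ rop div (cast (lit 1)) (cast (nop mul (lit 6) N[ lit 1 ])) ∷
  (relocate P ++
  cond (leqN N[ address (lit 0) ] (lit 0)) (increment 7 ∷ []) (decrement 7 ∷ []) ∷
  decrement 3 ∷ [])

-- The product expresses the conjunction "counter positive and budget positive" in one comparison.
gambleLoop : Program → Instr
gambleLoop P = while (leqN (lit 1) (nop mul N[ lit 7 ] N[ lit 3 ])) (gambleBody P)

visitLoop : Program → Instr
visitLoop P = while (leqN (lit 1) N[ lit 5 ])
  (N[ lit 7 ]≔ lit 1 ∷ gambleLoop P ∷ N[ lit 6 ]≔query N[ lit 6 ] ∷ decrement 5 ∷ [])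

startLoop : Program → Instr
startLoop P = while (leqN (lit 1) N[ lit 4 ])
  (N[ lit 6 ]≔rand N[ lit 0 ] ∷ N[ lit 5 ]≔ nop mul (lit 2) N[ lit 1 ] ∷ visitLoop P ∷ decrement 4 ∷ [])

enough : Test
enough = leqR (cast (lit 10)) (rop mul (cast N[ lit 2 ]) (rop mul R[ lit 0 ] R[ lit 0 ]))

-- Once the budget is 0, every gamble is skipped and the remaining walks only move, so the loops
-- still end. The budget left at the end serves as the verdict.
mixingTest : Program → Program
mixingTest P =
  -- The machine cannot round a real to a natural number, so the least K with 10 ≤ Kε² is found by
  -- counting up from the initial 0 in cell 2.
  while (neg enough) (increment 2 ∷ []) ∷
  N[ lit 3 ]≔ nop mul (lit 10) (nop mul N[ lit 2 ] N[ lit 1 ]) ∷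
  -- The stride has to exceed every value of the budget, the initial one included, so that the
  -- residue of an offset identifies the run.
  N[ lit 9 ]≔ nop add (lit 1) N[ lit 3 ] ∷
  N[ lit 4 ]≔ N[ lit 2 ] ∷
  startLoop P ∷
  N[ lit 0 ]≔ N[ lit 3 ] ∷ []

-- Step counts

module Arithmetic where

  open import Data.Nat using (_+_; _*_; _^_; _≤_; >-nonZero⁻¹)
  open import Data.Nat.Properties using (+-mono-≤; *-mono-≤; *-monoʳ-≤; ≤-refl; module ≤-Reasoning)
  open +-*-Solver

  sample-time : ∀ t J → 5 + (2 + (t * 3 + suc J)) ≡ 8 + t * 3 + J
  sample-time = solve 2 (λ t J → con 5 :+ (con 2 :+ (t :* con 3 :+ (con 1 :+ J))) := con 8 :+ t :* con 3 :+ J)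
    refl

  round-time : ∀ q Y J → suc (3 + (q + (3 + suc (Y * (q + 7) + J)))) ≡ suc (suc Y * (q + 7) + J)
  round-time = solve 3 (λ q Y J → con 1 :+ (con 3 :+ (q :+ (con 3 :+ (con 1 :+ (Y :* (q :+ con 7) :+ J)))))
    := con 1 :+ ((con 1 :+ Y) :* (q :+ con 7) :+ J)) refl

  visit-time : ∀ j r J → suc (suc (suc (r + (3 + (j * 5 + J))))) ≡ suc (suc j * 5 + (r + J))
  visit-time = solve 3 (λ j r J → con 3 :+ (r :+ (con 3 :+ (j :* con 5 :+ J))) := con 1 :+
    ((con 1 :+ j) :* con 5 :+ (r :+ J))) refl

  move-time : ∀ j r J → suc (suc (suc (j * 5 + (r + J)))) ≡ r + (3 + (j * 5 + J))
  move-time = solve 3 (λ j r J → con 3 :+ (j :* con 5 :+ (r :+ J)) := r :+ (con 3 :+ (j :* con 5 :+ J))) refl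

  start-time : ∀ i l r J → suc (suc (suc (suc (l + (r + (2 + (i * (5 + l) + J))))))) ≡ suc
    (suc i * (5 + l) + (r + J))
  start-time = solve 4 (λ i l r J → con 4 :+ (l :+ (r :+ (con 2 :+ (i :* (con 5 :+ l) :+ J)))) := con 1 :+
    ((con 1 :+ i) :* (con 5 :+ l) :+ (r :+ J))) refl

  again-time : ∀ m r J → suc (suc (m + (r + J))) ≡ r + (2 + (m + J))
  again-time = solve 3 (λ m r J → con 2 :+ (m :+ (r :+ J)) := r :+ (con 2 :+ (m :+ J))) refl

  -- Each monomial is at most K t² T because all three factors are at least 1; 204 is the sum 7 + 7
  -- + 80 + 80 + 30 of the coefficients. The monomials are padded with ones so that `bound` fits all
  -- of them.
  total-time : ∀ K t T .{{_ : NonZero K}} .{{_ : NonZero t}} .{{_ : NonZero T}} →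
               suc (K * 2 + (3 + suc (K * (5 + 2 * t * 5) + (10 * (K * t) * (T * (8 + t * 3) + 7) + 2))))
               ≤ 204 * (K * t ^ 2 * T)
  total-time K t T = begin
    suc (K * 2 + (3 + suc (K * (5 + 2 * t * 5) + (10 * (K * t) * (T * (8 + t * 3) + 7) + 2))))
      ≡⟨ solve 3 (λ K t T → con 1 :+ (K :* con 2 :+ (con 3 :+
        (con 1 :+ (K :* (con 5 :+ con 2 :* t :* con 5) :+ (con 10 :* (K :* t) :*
        (T :* (con 8 :+ t :* con 3) :+ con 7) :+ con 2)))))
           := con 7 :* (con 1 :* (con 1 :* (con 1 :* con 1)) :* con 1) :+ con 7 :*
             (K :* (con 1 :* (con 1 :* con 1)) :* con 1) :+ con 80 :* (K :* (t :* (con 1 :* con 1)) :* con 1)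
              :+ con 80 :* (K :* (t :* (con 1 :* con 1)) :* T) :+ con 30 :* (K :* (t :* (t :* con 1)) :* T))
                refl K t T ⟩
    7 * (1 * (1 * (1 * 1)) * 1) + 7 * (K * (1 * (1 * 1)) * 1) + 80 * (K * (t * (1 * 1)) * 1) + 80 *
      (K * (t * (1 * 1)) * T) + 30 * (K * t ^ 2 * T)
      ≤⟨ +-mono-≤ (+-mono-≤ (+-mono-≤ (+-mono-≤
           (bound 7 1≤K 1≤t 1≤t 1≤T) (bound 7 ≤-refl 1≤t 1≤t 1≤T)) (bound 80 ≤-refl ≤-refl 1≤t 1≤T))
             (bound 80 ≤-refl ≤-refl 1≤t ≤-refl)) (bound 30 {K} {t} {t} {T} ≤-refl ≤-refl ≤-refl ≤-refl) ⟩
    7 * (K * t ^ 2 * T) + 7 * (K * t ^ 2 * T) + 80 * (K * t ^ 2 * T) + 80 * (K * t ^ 2 * T) + 30 *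
      (K * t ^ 2 * T)
      ≡⟨ solve 1 (λ m → con 7 :* m :+ con 7 :* m :+ con 80 :* m :+ con 80 :* m :+ con 30 :* m := con 204 :* m)
        refl (K * t ^ 2 * T) ⟩
    204 * (K * t ^ 2 * T) ∎
    where
    open ≤-Reasoning
    1≤K = >-nonZero⁻¹ K
    1≤t = >-nonZero⁻¹ t
    1≤T = >-nonZero⁻¹ T
    bound : ∀ c {k l m n} → k ≤ K → l ≤ t → m ≤ t → n ≤ T → c * (k * (l * (m * 1)) * n) ≤ c * (K * t ^ 2 * T)
    bound c k≤K l≤t m≤t n≤T = *-monoʳ-≤ c (*-mono-≤ (*-mono-≤ k≤K (*-mono-≤ l≤t (*-mono-≤ m≤t ≤-refl))) n≤T)

open Arithmetic

-- From the program to a game: expectations and execution rules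

module Simulation (ℝ : ArchimedeanField) where

  open OrderedField ℝ
  open Chains ℝ
  open Repair ℝ using (true-or-false)

  E : {A : Set} → Tree A → (A → Carrier) → Carrier
  E (leaf a)        G = G a
  E (choice m w ts) G = w · λ i → E (ts i) G

  -- A halting run of the tester influences what follows only through its verdict, so in the
  -- analysis it can be replaced by the toss of a biased coin.
  halting-E : ∀ τ → Halts τ → ∀ G → E τ G ≡ Pr isAccept τ * G accept + Pr isReject τ * G reject
  halting-E (leaf accept)  h G = solve 2 (λ a r → a := con (pos 1) :* a :+ con (pos 0) :* r) refl (G accept)
    (G reject)
  halting-E (leaf reject)  h G = solve 2 (λ a r → r := con (pos 0) :* a :+ con (pos 1) :* r) refl (G accept)
    (G reject)
  halting-E (leaf timeout) h G = contradiction refl h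
  halting-E (choice m w ts) h G = begin
    w · (λ i → E (ts i) G)
      ≡⟨ ·-congʳ w (λ i → halting-E (ts i) (h i) G) ⟩
    w · (λ i → A i * G accept + R i * G reject)
      ≡⟨ ·-+ w (λ i → A i * G accept) (λ i → R i * G reject) ⟩
    w · (λ i → A i * G accept) + w · (λ i → R i * G reject)
      ≡⟨ cong₂ _+_ (factor A (G accept)) (factor R (G reject)) ⟩
    w · A * G accept + w · R * G reject   ∎
    where
    open ≡-Reasoning
    A R : Fin m → Carrier
    A i = Pr isAccept (ts i)
    R i = Pr isReject (ts i)
    factor : ∀ f c → w · (λ i → f i * c) ≡ w · f * c
    factor f c = trans (·-congʳ w λ i → *-comm (f i) c) (trans (·-scale w f c) (*-comm c _))

  -- Trees may carry arbitrary weights. This condition is what makes acceptance and rejection of a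
  -- halting run complementary.
  IsProb : {A : Set} → Tree A → Set
  IsProb (leaf a)        = ⊤
  IsProb (choice m w ts) = (∀ i → 0# ≤ w i) × sum w ≡ 1# × (∀ i → IsProb (ts i))

  Pr-nonNeg : ∀ {A : Set} (φ : A → Bool) τ → IsProb τ → 0# ≤ Pr φ τ
  Pr-nonNeg φ (leaf a) _ with φ a
  ... | true  = 0≤1
  ... | false = ≤-refl
  Pr-nonNeg φ (choice m w ts) (0≤w , _ , prob-ts) = ·-nonNeg 0≤w λ i → Pr-nonNeg φ (ts i) (prob-ts i)

  E-1 : ∀ {A : Set} (τ : Tree A) → IsProb τ → E τ (λ _ → 1#) ≡ 1#
  E-1 (leaf a) _ = refl
  E-1 (choice m w ts) (_ , sum-w , prob-ts) =
    trans (·-congʳ w λ i → E-1 (ts i) (prob-ts i)) (trans (·-const w 1#) (trans (*-identityʳ _) sum-w))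

  accept+reject : ∀ τ → IsProb τ → Halts τ → Pr isAccept τ + Pr isReject τ ≡ 1#
  accept+reject τ prob-τ h = trans (cong₂ _+_ (sym (*-identityʳ _)) (sym (*-identityʳ _)))
    (trans (sym (halting-E τ h λ _ → 1#)) (E-1 τ prob-τ))

  IsProb->>= : ∀ {A B : Set} (τ : Tree A) {k : A → Tree B} → IsProb τ → (∀ a → IsProb (k a)) → IsProb (τ >>= k)
  IsProb->>= (leaf a)        {k} _                      prob-k = prob-k a
  IsProb->>= (choice m w ts) {k} (0≤w , sum-w , prob-ts) prob-k = 0≤w , sum-w , λ i → IsProb->>= (ts i) {k}
    (prob-ts i) prob-k

  IsProb-draw : ∀ {n} (p : Distribution n) → IsProb (draw p)
  IsProb-draw p = nonNegative p , total p , λ _ → tt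

  IsProb-uniform : ∀ m → IsProb (uniform m)
  IsProb-uniform zero      = tt
  IsProb-uniform m@(suc _) = (λ _ → 0≤1/ m) , trans (sum-const m (fromℕ m ⁻¹))
    (*-inverseʳ (fromℕ m) (<⇒≢ (0<fromℕ m))) , λ _ → tt

  IsProb-run : ∀ {O : Oracle} → (∀ a → IsProb (O a)) → ∀ k P s → IsProb (run O k P s)
  IsProb-run O-prob zero    P                      s = tt
  IsProb-run O-prob (suc k) []                     s = tt
  IsProb-run O-prob (suc k) (N[ a ]≔ b      ∷ P) s = IsProb-run O-prob k P _
  IsProb-run O-prob (suc k) (R[ a ]≔ x      ∷ P) s = IsProb-run O-prob k P _
  IsProb-run {O} O-prob (suc k) (N[ a ]≔rand b  ∷ P) s = IsProb->>= (uniform (⟦ b ⟧ⁿ s))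
    (IsProb-uniform (⟦ b ⟧ⁿ s)) λ v → IsProb-run O-prob k P (setN a s v)
  IsProb-run {O} O-prob (suc k) (N[ a ]≔query b ∷ P) s = IsProb->>= (O (⟦ b ⟧ⁿ s)) (O-prob (⟦ b ⟧ⁿ s)) λ v →
    IsProb-run O-prob k P (setN a s v)
  IsProb-run O-prob (suc k) (cond b P₁ P₂   ∷ P) s = IsProb-run O-prob k _ s
  IsProb-run O-prob (suc k) (while b P₁     ∷ P) s = IsProb-run O-prob k _ s

  IsProb-samplers : ∀ {n} (p q : Distribution n) a → IsProb (samplers p q a)
  IsProb-samplers p q zero    = IsProb-draw p
  IsProb-samplers p q (suc a) = IsProb-draw q

  IsProb-nextNode : ∀ {n} (M : MarkovChain n) a → IsProb (nextNode M a)
  IsProb-nextNode {n} M a with a ℕ.<? n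
  ... | yes a<n = IsProb-draw (M (fromℕ< a<n))
  ... | no  _   = tt

  nextNode-toℕ : ∀ {n} (M : MarkovChain n) u → nextNode M (toℕ u) ≡ draw (M u)
  nextNode-toℕ {n} M u with toℕ u ℕ.<? n
  ... | yes u<n = cong (draw ∘ M) (Fin.fromℕ<-toℕ u u<n)
  ... | no  u≮n = contradiction (Fin.toℕ<n u) u≮n

  module Execution {n} (M : MarkovChain n) where

    -- A specification of everything still to be executed, so rules for single instructions compose
    -- backwards. Asking for all larger time limits allows branches of different lengths to share
    -- one bound.
    Runs : Program → Memory → ℕ → Carrier → Set
    Runs c s j x = ∀ k → j ℕ.≤ k → Halts (run (nextNode M) k c s) × Pr isAccept (run (nextNode M) k c s) ≡ x

    runs-weaken : ∀ {c s j j′ x} → j ℕ.≤ j′ → Runs c s j x → Runs c s j′ x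
    runs-weaken j≤j′ r k j′≤k = r k (ℕ.≤-trans j≤j′ j′≤k)

    runs-setN : ∀ {c s a b j x} → Runs c (setN a s (⟦ b ⟧ⁿ s)) j x → Runs (N[ a ]≔ b ∷ c) s (suc j) x
    runs-setN r (suc k) (ℕ.s≤s j≤k) = r k j≤k

    runs-setR : ∀ {c s a b j x} → Runs c (setR a s (⟦ b ⟧ʳ s)) j x → Runs (R[ a ]≔ b ∷ c) s (suc j) x
    runs-setR r (suc k) (ℕ.s≤s j≤k) = r k j≤k

    runs-rand : ∀ {c s a b j} m .{{_ : NonZero m}} {G : Fin m → Carrier} → ⟦ b ⟧ⁿ s ≡ m →
                (∀ v → Runs c (setN a s (toℕ v)) j (G v)) →
                Runs (N[ a ]≔rand b ∷ c) s (suc j) (mean G)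
    runs-rand (suc m) {G} b≡m r (suc k) (ℕ.s≤s j≤k) rewrite b≡m =
      (λ v → proj₁ (r v k j≤k)) ,
      trans (sum-cong-≗ λ v → cong (fromℕ (suc m) ⁻¹ *_) (proj₂ (r v k j≤k)))
        (sym (*-distribˡ-sum (fromℕ (suc m) ⁻¹) G))

    runs-query : ∀ {c s a b j} u {G : Fin n → Carrier} → ⟦ b ⟧ⁿ s ≡ toℕ u →
                 (∀ v → Runs c (setN a s (toℕ v)) j (G v)) →
                 Runs (N[ a ]≔query b ∷ c) s (suc j) (matrix M u · G)
    runs-query u b≡u r (suc k) (ℕ.s≤s j≤k) rewrite b≡u | nextNode-toℕ M u =
      (λ v → proj₁ (r v k j≤k)) , ·-congʳ (matrix M u) λ v → proj₂ (r v k j≤k)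

    runs-cond : ∀ {c s b P₁ P₂ j x} β → ⟦ b ⟧ᵗ s ≡ β → Runs ((if β then P₁ else P₂) ++ c) s j x →
                Runs (cond b P₁ P₂ ∷ c) s (suc j) x
    runs-cond β b≡β r (suc k) (ℕ.s≤s j≤k) rewrite b≡β = r k j≤k

    runs-while : ∀ {c s b P₁ j x} β → ⟦ b ⟧ᵗ s ≡ β → Runs (if β then P₁ ++ while b P₁ ∷ c else c) s j x →
                 Runs (while b P₁ ∷ c) s (suc j) x
    runs-while β b≡β r (suc k) (ℕ.s≤s j≤k) rewrite b≡β = r k j≤k

    ≤-test : ∀ {s a b} {k l} → ⟦ a ⟧ⁿ s ≡ k → ⟦ b ⟧ⁿ s ≡ l → ⟦ leqN a b ⟧ᵗ s ≡ ⌊ k ℕ.≤? l ⌋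
    ≤-test a≡k b≡l = cong₂ (λ k l → ⌊ k ℕ.≤? l ⌋) a≡k b≡l

    -- Walks take place in the middle of a simulated run; `I` will be the simulation relation, which
    -- ignores the working cells 10 and 11. A step costs 3: the loop test and two instructions.
    walk-runs : (I : Memory → Set) →
                (∀ s k → I s → I (setN (lit 10) s k)) → (∀ s k → I s → I (setN (lit 11) s k)) →
                ∀ {c j H} → (∀ v s → I s → nats s 10 ≡ toℕ v → Runs c s j (H v)) →
                ∀ τ v s → I s → nats s 10 ≡ toℕ v → nats s 11 ≡ τ →
                Runs (walkLoop ∷ c) s (suc (τ ℕ.* 3 ℕ.+ j)) ((matrix M ^ τ) v · H)
    walk-runs I I-10 I-11 {c} {j} {H} post zero v s Is pos≡ left≡ =
      runs-while false (cong (λ l → ⌊ 1 ℕ.≤? l ⌋) left≡)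
        (subst (Runs c s j) (sym (e-· v H)) (post v s Is pos≡))
    walk-runs I I-10 I-11 {c} {j} {H} post (suc τ) v s Is pos≡ left≡ =
      runs-while true (cong (λ l → ⌊ 1 ℕ.≤? l ⌋) left≡)
        (subst (Runs _ s _) (sym (⊡-· (matrix M v) (matrix M ^ τ) H))
          (runs-query v pos≡ λ w → runs-setN
            (walk-runs I I-10 I-11 post τ w (setN (lit 11) (setN (lit 10) s (toℕ w)) (nats s 11 ℕ.∸ 1))
              (I-11 (setN (lit 10) s (toℕ w)) _ (I-10 s _ Is)) refl (cong (ℕ._∸ 1) left≡))))

  cell : ℕ → ℕ → ℕ → ℕ
  cell S y a = 12 ℕ.+ (y ℕ.+ S ℕ.* a)

  -- The residue modulo `S` of the offset recovers the budget, and then the quotient recovers the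
  -- address.
  cell-injective : ∀ {S y y′ a a′} → y ℕ.< S → y′ ℕ.< S → cell S y a ≡ cell S y′ a′ → y ≡ y′ × a ≡ a′
  cell-injective {S@(suc _)} {y} {y′} {a} {a′} y<S y′<S cell≡ = y≡y′ , ℕ.*-cancelˡ-≡ a a′ S
    (ℕ.+-cancelˡ-≡ y _ _ (trans sum≡ (cong (ℕ._+ S ℕ.* a′) (sym y≡y′))))
    where
    sum≡ : y ℕ.+ S ℕ.* a ≡ y′ ℕ.+ S ℕ.* a′
    sum≡ = ℕ.+-cancelˡ-≡ 12 _ _ cell≡
    residue : ∀ {y} a → y ℕ.< S → (y ℕ.+ S ℕ.* a) ℕ.% S ≡ y
    residue {y} a y<S = trans (cong (λ k → (y ℕ.+ k) ℕ.% S) (ℕ.*-comm S a))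
      (trans (ℕ.[m+kn]%n≡m%n y a S) (ℕ.m<n⇒m%n≡m y<S))
    y≡y′ : y ≡ y′
    y≡y′ = trans (sym (residue a y<S)) (trans (cong (ℕ._% S) sum≡) (residue a′ y′<S))

  update-here : ∀ {A : Set} (f : ℕ → A) {i j} x → i ≡ j → update f i x j ≡ x
  update-here f {i} {j} x i≡j with i ℕ.≟ j
  ... | yes _   = refl
  ... | no  i≢j = contradiction i≡j i≢j

  update-there : ∀ {A : Set} (f : ℕ → A) {i j} x → i ≢ j → update f i x j ≡ f j
  update-there f {i} {j} x i≢j with i ℕ.≟ j
  ... | yes i≡j = contradiction i≡j i≢j
  ... | no  _   = refl

  target : ∀ {n} .{{_ : NonZero n}} → MarkovChain n → ℕ → Distribution n
  target M t = averageD M t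

  candidate : ∀ {n} .{{_ : NonZero n}} → MarkovChain n → ℕ → Fin n → Distribution n
  candidate M t w = midpoint (endpoint M t w) (target M t)

  positive : ℕ → Carrier
  positive zero    = 0#
  positive (suc _) = 1#

  -- α w and β w are the probabilities with which the tester accepts and rejects at w, Y is what is left
  -- of the budget and x the counter.
  module Game {n} (M : MarkovChain n) (α β : Fin n → Carrier) where

    gamble : Fin n → ℕ → ℕ → (ℕ → Carrier) → Carrier
    gamble w Y       zero    G = G Y
    gamble w zero    (suc x) G = G zero
    gamble w (suc Y) (suc x) G = α w * gamble w Y x G + β w * gamble w Y (suc (suc x)) G

    visits : ℕ → Fin n → (ℕ → Carrier) → ℕ → Carrier
    visits zero    w G Y = G Y
    visits (suc j) w G Y = gamble w Y 1 λ Y′ → matrix M w · λ v → visits j v G Y′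

    starts : ℕ → ℕ → (ℕ → Carrier) → ℕ → Carrier
    starts L zero    G Y = G Y
    starts L (suc i) G Y = mean λ v → visits L v (starts L i G) Y

  -- Simulating the tester inside the memory of the test

  module Tester {n} .{{n≢0 : NonZero n}} (M : MarkovChain n) (t : ℕ) (ε : Carrier) (S : ℕ) where

    open Execution M

    -- Cells of budgets below the bound F have not been used yet.
    record Frame (F Y i j w x : ℕ) (s : Memory) : Set where
      field
        n≡     : nats s 0 ≡ n
        t≡     : nats s 1 ≡ t
        Y≡     : nats s 3 ≡ Y
        i≡     : nats s 4 ≡ i
        j≡     : nats s 5 ≡ j
        w≡     : nats s 6 ≡ w
        x≡     : nats s 7 ≡ x
        S≡     : nats s 9 ≡ S
        ε≡     : reals s 0 ≡ ε
        Y<S    : Y ℕ.< S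
        fresh  : ∀ y → y ℕ.< F → ∀ a → nats s (cell S y a) ≡ 0
        freshᴿ : ∀ y → y ℕ.< F → ∀ a → reals s (cell S y a) ≡ 0#

    open Frame

    -- Simulated cells have addresses of the form 12 + ..., so comparing them with a smaller literal
    -- computes and the old equations remain valid definitionally. The other frame rules use this as
    -- well.
    frame-10 : ∀ {F Y i j w x s k} → Frame F Y i j w x s → Frame F Y i j w x (setN (lit 10) s k)
    frame-10 fr = record { Frame fr }

    frame-11 : ∀ {F Y i j w x s k} → Frame F Y i j w x s → Frame F Y i j w x (setN (lit 11) s k)
    frame-11 fr = record { Frame fr }

    frame-3 : ∀ {Y i j w x s k} → k ≡ Y → Frame (suc Y) (suc Y) i j w x s → Frame (suc Y) Y i j w x
      (setN (lit 3) s k)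
    frame-3 k≡Y fr = record { Frame fr hiding (Y≡; Y<S) ; Y≡ = k≡Y ; Y<S = ℕ.<⇒≤ (Y<S fr) }

    frame-4 : ∀ {F Y i j w x s k i′} → k ≡ i′ → Frame F Y i j w x s → Frame F Y i′ j w x (setN (lit 4) s k)
    frame-4 k≡i fr = record { Frame fr hiding (i≡) ; i≡ = k≡i }

    frame-5 : ∀ {F Y i j w x s k j′} → k ≡ j′ → Frame F Y i j w x s → Frame F Y i j′ w x (setN (lit 5) s k)
    frame-5 k≡j fr = record { Frame fr hiding (j≡) ; j≡ = k≡j }

    frame-6 : ∀ {F Y i j w x s} k → Frame F Y i j w x s → Frame F Y i j k x (setN (lit 6) s k)
    frame-6 k fr = record { Frame fr hiding (w≡) ; w≡ = refl }

    frame-7 : ∀ {F Y i j w x s k x′} → k ≡ x′ → Frame F Y i j w x s → Frame F Y i j w x′ (setN (lit 7) s k)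
    frame-7 k≡x fr = record { Frame fr hiding (x≡) ; x≡ = k≡x }

    module Simulated (Y i j : ℕ) (w : Fin n) (x : ℕ) where

      record Simulates (u s : Memory) : Set where
        field
          frame   : Frame Y Y i j (toℕ w) x s
          nats≡   : ∀ a → nats s (cell S Y a) ≡ nats u a
          reals≡  : ∀ a → reals s (cell S Y a) ≡ reals u a

      open Simulates

      address-≡ : ∀ {u s} → Simulates u s → ∀ {a k} → ⟦ a ⟧ⁿ s ≡ k → ⟦ address a ⟧ⁿ s ≡ cell S Y k
      address-≡ sim a≡k = cong (12 ℕ.+_) (cong₂ ℕ._+_ (Y≡ (frame sim)) (cong₂ ℕ._*_ (S≡ (frame sim)) a≡k))

      relocateᴺ-≡ : ∀ {u s} → Simulates u s → ∀ a → ⟦ relocateᴺ a ⟧ⁿ s ≡ ⟦ a ⟧ⁿ u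
      relocateᴺ-≡ sim (lit k) = refl
      relocateᴺ-≡ {u} {s} sim N[ a ] =
        trans (cong (nats s) (address-≡ sim {relocateᴺ a} (relocateᴺ-≡ sim a))) (nats≡ sim (⟦ a ⟧ⁿ u))
      relocateᴺ-≡ sim (nop o a b) = cong₂ (evalNatOp o) (relocateᴺ-≡ sim a) (relocateᴺ-≡ sim b)

      relocateᴿ-≡ : ∀ {u s} → Simulates u s → ∀ x → ⟦ relocateᴿ x ⟧ʳ s ≡ ⟦ x ⟧ʳ u
      relocateᴿ-≡ sim (cast a) = cong fromℕ (relocateᴺ-≡ sim a)
      relocateᴿ-≡ {u} {s} sim R[ a ] =
        trans (cong (reals s) (address-≡ sim {relocateᴺ a} (relocateᴺ-≡ sim a))) (reals≡ sim (⟦ a ⟧ⁿ u))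
      relocateᴿ-≡ sim (rop o x y) = cong₂ (evalRealOp o) (relocateᴿ-≡ sim x) (relocateᴿ-≡ sim y)

      relocateᵀ-≡ : ∀ {u s} → Simulates u s → ∀ b → ⟦ relocateᵀ b ⟧ᵗ s ≡ ⟦ b ⟧ᵗ u
      relocateᵀ-≡ sim (leqN a b) = cong₂ (λ k l → ⌊ k ℕ.≤? l ⌋) (relocateᴺ-≡ sim a) (relocateᴺ-≡ sim b)
      relocateᵀ-≡ sim (leqR x y) = cong₂ (λ k l → ⌊ k ≤? l ⌋) (relocateᴿ-≡ sim x) (relocateᴿ-≡ sim y)
      relocateᵀ-≡ sim (neg b)    = cong not (relocateᵀ-≡ sim b)

      private
        write-fresh : ∀ {A : Set} {z : A} (f : ℕ → A) {y} b k v → y ℕ.< Y → Y ℕ.< S → f (cell S y b) ≡ z →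
                      update f (cell S Y k) v (cell S y b) ≡ z
        write-fresh f {y} b k v y<Y Y<S f≡z = trans
          (update-there f v λ cell≡ → ℕ.<⇒≢ y<Y (sym (proj₁
            (cell-injective {a = k} {a′ = b} Y<S (ℕ.<-trans y<Y Y<S) cell≡)))) f≡z

        write-sim : ∀ {A : Set} (f g : ℕ → A) k v b → Y ℕ.< S → f (cell S Y b) ≡ g b →
                    update f (cell S Y k) v (cell S Y b) ≡ update g k v b
        write-sim f g k v b Y<S f≡g with k ℕ.≟ b
        ... | yes refl = update-here f v refl
        ... | no  k≢b  = trans (update-there f v λ cell≡ → k≢b
          (proj₂ (cell-injective {a = k} {a′ = b} Y<S Y<S cell≡))) f≡g

      simulates-writeN : ∀ {u s} → Simulates u s → ∀ {k} b v → k ≡ cell S Y b →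
                         Simulates ⟨ update (nats u) b v , reals u ⟩ ⟨ update (nats s) k v , reals s ⟩
      simulates-writeN {u} {s} sim b v refl = record
        { frame  = record { Frame (frame sim) hiding (fresh)
                          ; fresh = λ y y<Y c → write-fresh (nats s) c b v y<Y (Y<S (frame sim))
                            (fresh (frame sim) y y<Y c) }
        ; nats≡  = λ c → write-sim (nats s) (nats u) b v c (Y<S (frame sim)) (nats≡ sim c)
        ; reals≡ = reals≡ sim }

      simulates-writeR : ∀ {u s} → Simulates u s → ∀ {k} b v → k ≡ cell S Y b →
                         Simulates ⟨ nats u , update (reals u) b v ⟩ ⟨ nats s , update (reals s) k v ⟩
      simulates-writeR {u} {s} sim b v refl = record
        { frame  = record { Frame (frame sim) hiding (freshᴿ)
                          ; freshᴿ = λ y y<Y c → write-fresh (reals s) c b v y<Y (Y<S (frame sim))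
                            (freshᴿ (frame sim) y y<Y c) }
        ; nats≡  = nats≡ sim
        ; reals≡ = λ c → write-sim (reals s) (reals u) b v c (Y<S (frame sim)) (reals≡ sim c) }

      simulates-setN : ∀ {u s} → Simulates u s → ∀ a v → Simulates (setN a u v)
        (setN (address (relocateᴺ a)) s v)
      simulates-setN {u} {s} sim a v =
        simulates-writeN sim (⟦ a ⟧ⁿ u) v (address-≡ sim {relocateᴺ a} (relocateᴺ-≡ sim a))

      simulates-setR : ∀ {u s} → Simulates u s → ∀ a v → Simulates (setR a u v)
        (setR (address (relocateᴺ a)) s v)
      simulates-setR {u} {s} sim a v =
        simulates-writeR sim (⟦ a ⟧ⁿ u) v (address-≡ sim {relocateᴺ a} (relocateᴺ-≡ sim a))

      simulates-10 : ∀ {u} s k → Simulates u s → Simulates u (setN (lit 10) s k)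
      simulates-10 s k sim = record { frame = frame-10 (frame sim) ; nats≡ = nats≡ sim ; reals≡ = reals≡ sim }

      simulates-11 : ∀ {u} s k → Simulates u s → Simulates u (setN (lit 11) s k)
      simulates-11 s k sim = record { frame = frame-11 (frame sim) ; nats≡ = nats≡ sim ; reals≡ = reals≡ sim }

      queryTime : ℕ
      queryTime = 8 ℕ.+ t ℕ.* 3

      private
        coin : Carrier → Carrier → Fin 2 → Carrier
        coin x y zero    = x
        coin x y (suc _) = y

        mean-split : ∀ x (f : Fin n → Carrier) → mean (λ v → mean (coin x (f v))) ≡ ½ * x + ½ * mean f
        mean-split x f = begin
          mean (λ v → ½ * (x + (f v + 0#)))
            ≡⟨ mean-cong (λ v → solve 3 (λ h x y → h :* (x :+ (y :+ con (pos 0))) := h :* x :- :- (h :* y))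
              refl ½ x (f v)) ⟩
          mean (λ v → ½ * x - - (½ * f v))
            ≡⟨ mean-sub (λ _ → ½ * x) (λ v → - (½ * f v)) ⟩
          mean (λ (v : Fin n) → ½ * x) - mean (λ v → - (½ * f v))
            ≡⟨ cong₂ (λ a b → a - b) (mean-const (½ * x)) (cong (fromℕ n ⁻¹ *_)
              (trans (sum-neg λ v → ½ * f v) (cong -_ (sym (*-distribˡ-sum ½ f))))) ⟩
          ½ * x - fromℕ n ⁻¹ * - (½ * sum f)
            ≡⟨ solve 4 (λ h x c s → h :* x :- c :* (:- (h :* s)) := h :* x :+ h :* (c :* s)) refl ½ x
              (fromℕ n ⁻¹) (sum f) ⟩
          ½ * x + ½ * mean f ∎
          where open ≡-Reasoning

      answers : ℕ → Fin n → Carrier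
      answers zero    = prob (candidate M t w)
      answers (suc _) = prob (target M t)

      sample-runs : ∀ {u s} → Simulates u s → ∀ a b {c J H} →
                    (∀ v s′ → Simulates u s′ → Runs c (setN (address (relocateᴺ a)) s′ (toℕ v)) J (H v)) →
                    Runs (sample (address (relocateᴺ a)) (relocateᴺ b) ++ c) s (queryTime ℕ.+ J)
                      (answers (⟦ b ⟧ⁿ u) · H)
      sample-runs {u} {s} sim a b {c} {J} {H} post = choose (⟦ b ⟧ⁿ u) refl
        where
        from : Fin n → Carrier
        from v = (matrix M ^ t) v · H

        tail : Program
        tail = N[ lit 11 ]≔ N[ lit 1 ] ∷ walkLoop ∷ N[ address (relocateᴺ a) ]≔ N[ lit 10 ] ∷ c

        tail-runs : ∀ v s′ → Simulates u s′ → nats s′ 10 ≡ toℕ v → Runs tail s′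
          (suc (suc (t ℕ.* 3 ℕ.+ suc J))) (from v)
        tail-runs v s′ sim′ pos≡ = runs-setN (walk-runs (Simulates u) simulates-10 simulates-11
          (λ v′ s″ sim″ pos″≡ → runs-setN (subst (λ k → Runs c (setN (address (relocateᴺ a)) s″ k) J (H v′))
            (sym pos″≡) (post v′ s″ sim″)))
          t v (setN (lit 11) s′ (nats s′ 1)) (simulates-11 s′ (nats s′ 1) sim′) pos≡ (t≡ (frame sim′)))

        choose : ∀ k → ⟦ b ⟧ⁿ u ≡ k → Runs (sample (address (relocateᴺ a)) (relocateᴺ b) ++ c) s
          (queryTime ℕ.+ J) (answers k · H)
        choose zero b≡0 = subst (Runs (sample (address (relocateᴺ a)) (relocateᴺ b) ++ c) s (queryTime ℕ.+ J))
          (trans (mean-split (from w) from)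
            (sym (trans (midpoint-· (endpoint M t w) (target M t) H)
              (cong (λ z → ½ * from w + ½ * z) (mean-· (matrix M ^ t) H)))))
          (runs-weaken (ℕ.≤-reflexive (sample-time t J))
            (runs-rand n (n≡ (frame sim)) λ v →
              let s₁ = setN (lit 10) s (toℕ v) ; sim₁ = simulates-10 s (toℕ v) sim in
              runs-cond true (≤-test {s₁} {relocateᴺ b} {lit 0} (trans (relocateᴺ-≡ sim₁ b) b≡0) refl)
                (runs-rand 2 {coin (from w) (from v)} refl λ
                  { zero → let s₂ = setN (lit 11) s₁ 0 ; sim₂ = simulates-11 s₁ 0 sim₁ in
                      runs-cond true refl (runs-setN (tail-runs w (setN (lit 10) s₂ (nats s₂ 6))
                        (simulates-10 s₂ (nats s₂ 6) sim₂) (w≡ (frame sim))))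
                  ; (suc zero) → let s₂ = setN (lit 11) s₁ 1 ; sim₂ = simulates-11 s₁ 1 sim₁ in
                      runs-cond false refl (runs-weaken (ℕ.n≤1+n _) (tail-runs v s₂ sim₂ refl)) })))
        choose (suc k) b≡1+k = subst (Runs (sample (address (relocateᴺ a)) (relocateᴺ b) ++ c) s
          (queryTime ℕ.+ J))
          (sym (mean-· (matrix M ^ t) H))
          (runs-weaken (ℕ.≤-trans (ℕ.m≤n+m _ 3) (ℕ.≤-reflexive (sample-time t J)))
            (runs-rand n (n≡ (frame sim)) λ v →
              let s₁ = setN (lit 10) s (toℕ v) ; sim₁ = simulates-10 s (toℕ v) sim in
              runs-cond false (≤-test {s₁} {relocateᴺ b} {lit 0} (trans (relocateᴺ-≡ sim₁ b) b≡1+k) refl)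
                (tail-runs v s₁ sim₁ refl)))

      relocate-++ : ∀ P₁ P₂ → relocate (P₁ ++ P₂) ≡ relocate P₁ ++ relocate P₂
      relocate-++ []       P₂ = refl
      relocate-++ (I ∷ P₁) P₂ = trans (cong (relocateᴵ I ++_) (relocate-++ P₁ P₂))
        (sym (List.++-assoc (relocateᴵ I) (relocate P₁) (relocate P₂)))

      -- Every step of the tester is charged the price of a query, which keeps the time of a
      -- simulated run linear in `k`.
      one-step : ∀ {c s J x} k → Runs c s (suc (k ℕ.* queryTime ℕ.+ J)) x → Runs c s
        (suc k ℕ.* queryTime ℕ.+ J) x
      one-step {J = J} k = runs-weaken
        (ℕ.≤-trans (s≤s (ℕ.m≤n+m _ (7 ℕ.+ t ℕ.* 3))) (ℕ.≤-reflexive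
          (sym (ℕ.+-assoc queryTime (k ℕ.* queryTime) J))))

      -- The induction is on the number of steps granted to the tester, not on its code. Since it
      -- halts within them, the relocated code ends by itself and carries no clock.
      relocate-runs : ∀ k P {u s c J G} → Simulates u s → Halts
        (run (samplers (candidate M t w) (target M t)) k P u) →
                      (∀ u′ s′ → Simulates u′ s′ → Runs c s′ J (G (verdict (nats u′ 0)))) →
                      Runs (relocate P ++ c) s (k ℕ.* queryTime ℕ.+ J)
                        (E (run (samplers (candidate M t w) (target M t)) k P u) G)
      relocate-runs zero P sim halts post = contradiction refl halts
      relocate-runs (suc k) [] {J = J} sim halts post = runs-weaken (ℕ.m≤n+m J _) (post _ _ sim)
      relocate-runs (suc k) (N[ a ]≔ b ∷ P) {u} {s} {c} {J} {G} sim halts post =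
        one-step k (runs-setN (relocate-runs k P
            (subst (λ v → Simulates (setN a u (⟦ b ⟧ⁿ u)) (setN (address (relocateᴺ a)) s v))
              (sym (relocateᴺ-≡ sim b)) (simulates-setN sim a (⟦ b ⟧ⁿ u)))
            halts post))
      relocate-runs (suc k) (R[ a ]≔ b ∷ P) {u} {s} {c} {J} {G} sim halts post =
        one-step k (runs-setR (relocate-runs k P
            (subst (λ v → Simulates (setR a u (⟦ b ⟧ʳ u)) (setR (address (relocateᴺ a)) s v))
              (sym (relocateᴿ-≡ sim b)) (simulates-setR sim a (⟦ b ⟧ʳ u)))
            halts post))
      relocate-runs (suc k) (N[ a ]≔rand b ∷ P) {u} {s} {c} {J} {G} sim halts post =
        one-step k (rand-runs (⟦ b ⟧ⁿ u) refl halts)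
        where
        rand-runs : ∀ m → ⟦ b ⟧ⁿ u ≡ m → Halts (uniform m >>= λ v → run
          (samplers (candidate M t w) (target M t)) k P (setN a u v)) →
                    Runs (relocate (N[ a ]≔rand b ∷ P) ++ c) s (suc (k ℕ.* queryTime ℕ.+ J))
                         (E (uniform m >>= λ v → run (samplers (candidate M t w) (target M t)) k P
                           (setN a u v)) G)
        rand-runs zero b≡0 halts zero ()
        rand-runs zero b≡0 halts (suc l) (s≤s J≤l) rewrite trans (relocateᴺ-≡ sim b) b≡0 =
          relocate-runs k P (simulates-setN sim a 0) halts post l J≤l
        rand-runs m@(suc _) b≡m halts = subst (Runs (relocate (N[ a ]≔rand b ∷ P) ++ c) s
          (suc (k ℕ.* queryTime ℕ.+ J)))
          (*-distribˡ-sum {m} (fromℕ m ⁻¹) (λ v → E (run (samplers (candidate M t w) (target M t)) k P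
            (setN a u (toℕ v))) G))
          (runs-rand m (trans (relocateᴺ-≡ sim b) b≡m) λ v → relocate-runs k P (simulates-setN sim a (toℕ v))
            (halts v) post)
      relocate-runs (suc k) (N[ a ]≔query b ∷ P) {u} {s} {c} {J} {G} sim halts post =
        query-runs (⟦ b ⟧ⁿ u) refl halts
        where
        after : Fin n → Tree Outcome
        after v = run (samplers (candidate M t w) (target M t)) k P (setN a u (toℕ v))
        code≡ : (sample (address (relocateᴺ a)) (relocateᴺ b) ++ relocate P) ++ c ≡ sample
          (address (relocateᴺ a)) (relocateᴺ b) ++ relocate P ++ c
        code≡ = List.++-assoc (sample (address (relocateᴺ a)) (relocateᴺ b)) (relocate P) c
        sampled : (∀ v → Halts (after v)) →
                  Runs (relocate (N[ a ]≔query b ∷ P) ++ c) s (suc k ℕ.* queryTime ℕ.+ J)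
                    (answers (⟦ b ⟧ⁿ u) · λ v → E (after v) G)
        sampled halts-after = runs-weaken (ℕ.≤-reflexive (sym (ℕ.+-assoc queryTime _ J)))
          (subst (λ c′ → Runs c′ s (queryTime ℕ.+ (k ℕ.* queryTime ℕ.+ J))
            (answers (⟦ b ⟧ⁿ u) · λ v → E (after v) G)) (sym code≡)
            (sample-runs sim a b λ v s′ sim′ → relocate-runs k P (simulates-setN sim′ a (toℕ v))
              (halts-after v) post))
        query-runs : ∀ l → ⟦ b ⟧ⁿ u ≡ l → Halts (samplers (candidate M t w) (target M t) l >>= λ v → run
          (samplers (candidate M t w) (target M t)) k P (setN a u v)) →
                     Runs (relocate (N[ a ]≔query b ∷ P) ++ c) s (suc k ℕ.* queryTime ℕ.+ J)
                          (E (samplers (candidate M t w) (target M t) l >>= λ v → run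
                            (samplers (candidate M t w) (target M t)) k P (setN a u v)) G)
        query-runs zero    b≡l halts = subst (λ l → Runs (relocate (N[ a ]≔query b ∷ P) ++ c) s
          (suc k ℕ.* queryTime ℕ.+ J) (answers l · λ v → E (after v) G)) b≡l (sampled halts)
        query-runs (suc l) b≡l halts = subst (λ l → Runs (relocate (N[ a ]≔query b ∷ P) ++ c) s
          (suc k ℕ.* queryTime ℕ.+ J) (answers l · λ v → E (after v) G)) b≡l (sampled halts)
      relocate-runs (suc k) (cond b P₁ P₂ ∷ P) {u} {s} {c} {J} {G} sim halts post =
        one-step k (runs-cond (⟦ b ⟧ᵗ u) (relocateᵀ-≡ sim b)
            (subst (λ c′ → Runs c′ s (k ℕ.* queryTime ℕ.+ J)
              (E (run (samplers (candidate M t w) (target M t)) k ((if ⟦ b ⟧ᵗ u then P₁ else P₂) ++ P) u) G))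
              (code≡ (⟦ b ⟧ᵗ u))
              (relocate-runs k ((if ⟦ b ⟧ᵗ u then P₁ else P₂) ++ P) sim halts post)))
        where
        code≡ : ∀ β → relocate ((if β then P₁ else P₂) ++ P) ++ c ≡ (if β then relocate P₁ else relocate P₂)
          ++ relocate P ++ c
        code≡ true  = trans (cong (_++ c) (relocate-++ P₁ P)) (List.++-assoc (relocate P₁) (relocate P) c)
        code≡ false = trans (cong (_++ c) (relocate-++ P₂ P)) (List.++-assoc (relocate P₂) (relocate P) c)
      relocate-runs (suc k) (while b P₁ ∷ P) {u} {s} {c} {J} {G} sim halts post =
        one-step k (runs-while (⟦ b ⟧ᵗ u) (relocateᵀ-≡ sim b)
            (subst (λ c′ → Runs c′ s (k ℕ.* queryTime ℕ.+ J)
              (E (run (samplers (candidate M t w) (target M t)) k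
              (if ⟦ b ⟧ᵗ u then P₁ ++ while b P₁ ∷ P else P) u) G))
              (code≡ (⟦ b ⟧ᵗ u))
              (relocate-runs k (if ⟦ b ⟧ᵗ u then P₁ ++ while b P₁ ∷ P else P) sim halts post)))
        where
        code≡ : ∀ β → relocate (if β then P₁ ++ while b P₁ ∷ P else P) ++ c
                    ≡ (if β then relocate P₁ ++ while (relocateᵀ b) (relocate P₁) ∷ (relocate P ++ c) else
                      relocate P ++ c)
        code≡ true  = trans (cong (_++ c) (relocate-++ P₁ (while b P₁ ∷ P)))
          (List.++-assoc (relocate P₁) (relocate (while b P₁ ∷ P)) c)
        code≡ false = refl

      -- Memories are functions: the zero memory after writing the inputs agrees with the initial
      -- memory of the tester only pointwise.
      simulates-≗ : ∀ {u u′ s} → (∀ a → nats u a ≡ nats u′ a) → (∀ a → reals u a ≡ reals u′ a) → Simulates u s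
        → Simulates u′ s
      simulates-≗ nats≗ reals≗ sim = record
        { frame = frame sim ; nats≡ = λ a → trans (nats≡ sim a) (nats≗ a) ; reals≡ = λ a → trans
          (reals≡ sim a) (reals≗ a) }

      simulates-fresh : ∀ {s} → Frame (suc Y) Y i j (toℕ w) x s → Simulates ⟨ (λ _ → 0) , (λ _ → 0#) ⟩ s
      simulates-fresh fr = record
        { frame  = record { Frame fr hiding (fresh; freshᴿ) ; fresh = λ y y<Y → fresh fr y (ℕ.m<n⇒m<1+n y<Y)
                                                            ; freshᴿ = λ y y<Y → freshᴿ fr y (ℕ.m<n⇒m<1+n y<Y) }
        ; nats≡  = fresh fr Y (ℕ.n<1+n Y)
        ; reals≡ = freshᴿ fr Y (ℕ.n<1+n Y) }

    -- The nested loops compute the game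

    module Loops (P : Program) (k : ℕ)
                 (halts : ∀ w → Halts (runTester P k n ε (1 ÷ (6 ℕ.* t)) (candidate M t w) (target M t))) where

      trial : Fin n → Tree Outcome
      trial w = runTester P k n ε (1 ÷ (6 ℕ.* t)) (candidate M t w) (target M t)

      open Game M (λ w → Pr isAccept (trial w)) (λ w → Pr isReject (trial w)) public

      roundTime : ℕ
      roundTime = k ℕ.* (8 ℕ.+ t ℕ.* 3) ℕ.+ 7

      -- Time is paid out of the budget: the continuation still owns one `roundTime` for every unit
      -- it finds. In this way all visits together cost one budget's worth of rounds rather than one
      -- each.
      gamble-runs : ∀ {i j w c J G} → (∀ Y′ x′ s′ → Frame (suc Y′) Y′ i j (toℕ w) x′ s′ → Runs c s′
        (Y′ ℕ.* roundTime ℕ.+ J) (G Y′)) →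
                    ∀ Y x s → Frame (suc Y) Y i j (toℕ w) x s →
                    Runs (gambleLoop P ∷ c) s (suc (Y ℕ.* roundTime ℕ.+ J)) (gamble w Y x G)
      gamble-runs post Y zero s fr =
        runs-while false (cong₂ (λ x Y → ⌊ 1 ℕ.≤? x ℕ.* Y ⌋) (x≡ fr) (Y≡ fr)) (post Y 0 s fr)
      gamble-runs post zero (suc x) s fr =
        runs-while false (trans (cong₂ (λ x Y → ⌊ 1 ℕ.≤? x ℕ.* Y ⌋) (x≡ fr) (Y≡ fr))
          (cong (λ z → ⌊ 1 ℕ.≤? z ⌋) (ℕ.*-zeroʳ x)))
          (post zero (suc x) s fr)
      gamble-runs {i} {j} {w} {c} {J} {G} post (suc Y) (suc x) s fr =
        runs-weaken (ℕ.≤-reflexive (round-time (k ℕ.* (8 ℕ.+ t ℕ.* 3)) Y J))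
        (runs-while true (cong₂ (λ x Y → ⌊ 1 ℕ.≤? x ℕ.* Y ⌋) (x≡ fr) (Y≡ fr))
        (runs-setN (runs-setR (runs-setR
          (subst₂ (λ c′ z → Runs c′ s₃ (k ℕ.* (8 ℕ.+ t ℕ.* 3) ℕ.+ (3 ℕ.+ suc (Y ℕ.* roundTime ℕ.+ J))) z)
            (sym (List.++-assoc (relocate P) _ _)) (halting-E (trial w) (halts w) next)
            (relocate-runs k P sim₃ (halts w) continue))))))
        where
        open Simulated (suc Y) i j w (suc x)
        open Simulates
        rest : Program
        rest = cond (leqN N[ address (lit 0) ] (lit 0)) (increment 7 ∷ []) (decrement 7 ∷ []) ∷ decrement 3 ∷
          gambleLoop P ∷ c
        s₁ = setN (address (lit 0)) s (nats s 0)
        s₂ = setR (address (lit 0)) s₁ (reals s₁ 0)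
        s₃ = setR (address (lit 1)) s₂ (fromℕ 1 * fromℕ (6 ℕ.* nats s₂ 1) ⁻¹)
        sim₀ = simulates-fresh fr
        sim₁ = simulates-writeN sim₀ 0 (nats s 0) (address-≡ sim₀ {lit 0} refl)
        sim₂ = simulates-writeR sim₁ 0 (reals s₁ 0) (address-≡ sim₁ {lit 0} refl)
        sim₃ : Simulates ⟨ load 0 (n ∷ []) , load 0# (ε ∷ 1 ÷ (6 ℕ.* t) ∷ []) ⟩ s₃
        sim₃ = simulates-≗
          (λ { zero → n≡ fr ; (suc a) → refl })
          (λ { zero → ε≡ (frame sim₁) ; (suc zero) → cong (λ t → 1 ÷ (6 ℕ.* t)) (t≡ (frame sim₂)) ;
            (suc (suc a)) → refl })
          (simulates-writeR sim₂ 1 (fromℕ 1 * fromℕ (6 ℕ.* nats s₂ 1) ⁻¹) (address-≡ sim₂ {lit 1} refl))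
        next : Outcome → Carrier
        next accept  = gamble w Y x G
        next reject  = gamble w Y (suc (suc x)) G
        next timeout = 0#
        continue : ∀ u′ s′ → Simulates u′ s′ → Runs rest s′ (3 ℕ.+ suc (Y ℕ.* roundTime ℕ.+ J))
          (next (verdict (nats u′ 0)))
        continue u′ s′ sim′ = decide (nats u′ 0) (trans (cong (nats s′) (address-≡ sim′ {lit 0} refl))
          (nats≡ sim′ 0))
          where
          fr′ = frame sim′
          decide : ∀ v → ⟦ N[ address (lit 0) ] ⟧ⁿ s′ ≡ v → Runs rest s′ (3 ℕ.+ suc (Y ℕ.* roundTime ℕ.+ J))
            (next (verdict v))
          decide zero v≡ = runs-cond true (cong (λ v → ⌊ v ℕ.≤? 0 ⌋) v≡) (runs-setN (runs-setN
            (gamble-runs post Y (suc (suc x)) _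
              (frame-3 (cong (ℕ._∸ 1) (Y≡ fr′)) (frame-7 (trans (cong (ℕ._+ 1) (x≡ fr′)) (ℕ.+-comm (suc x) 1))
                fr′)))))
          decide (suc v) v≡ = runs-cond false (cong (λ v → ⌊ v ℕ.≤? 0 ⌋) v≡) (runs-setN (runs-setN
            (gamble-runs post Y x _
              (frame-3 (cong (ℕ._∸ 1) (Y≡ fr′)) (frame-7 (cong (ℕ._∸ 1) (x≡ fr′)) fr′)))))

      visits-runs : ∀ {i c J G} → (∀ Y′ {w′ x′} s′ → Frame (suc Y′) Y′ i 0 w′ x′ s′ → Runs c s′
        (Y′ ℕ.* roundTime ℕ.+ J) (G Y′)) →
                    ∀ j w Y {x} s → Frame (suc Y) Y i j (toℕ w) x s →
                    Runs (visitLoop P ∷ c) s (suc (j ℕ.* 5 ℕ.+ (Y ℕ.* roundTime ℕ.+ J))) (visits j w G Y)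
      visits-runs post zero w Y s fr = runs-while false (cong (λ j → ⌊ 1 ℕ.≤? j ⌋) (j≡ fr)) (post Y s fr)
      visits-runs {i} {c} {J} {G} post (suc j) w Y s fr =
        runs-weaken (ℕ.≤-reflexive (visit-time j (Y ℕ.* roundTime) J))
        (runs-while true (cong (λ j → ⌊ 1 ℕ.≤? j ⌋) (j≡ fr))
        (runs-setN (gamble-runs move Y 1 _ (frame-7 refl fr))))
        where
        move : ∀ Y′ x′ s′ → Frame (suc Y′) Y′ i (suc j) (toℕ w) x′ s′ →
               Runs (N[ lit 6 ]≔query N[ lit 6 ] ∷ decrement 5 ∷ visitLoop P ∷ c) s′
                 (Y′ ℕ.* roundTime ℕ.+ (3 ℕ.+ (j ℕ.* 5 ℕ.+ J)))
                    (matrix M w · λ v → visits j v G Y′)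
        move Y′ x′ s′ fr′ = runs-weaken (ℕ.≤-reflexive (move-time j (Y′ ℕ.* roundTime) J))
          (runs-query w (w≡ fr′) λ v → runs-setN
            (visits-runs post j v Y′ _ (frame-5 (cong (ℕ._∸ 1) (j≡ fr′)) (frame-6 (toℕ v) fr′))))

      starts-runs : ∀ {c J G} → (∀ Y′ {j′ w′ x′} s′ → Frame (suc Y′) Y′ 0 j′ w′ x′ s′ → Runs c s′
        (Y′ ℕ.* roundTime ℕ.+ J) (G Y′)) →
                    ∀ i Y {j w x} s → Frame (suc Y) Y i j w x s →
                    Runs (startLoop P ∷ c) s (suc (i ℕ.* (5 ℕ.+ 2 ℕ.* t ℕ.* 5) ℕ.+ (Y ℕ.* roundTime ℕ.+ J)))
                      (starts (2 ℕ.* t) i G Y)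
      starts-runs post zero Y s fr = runs-while false (cong (λ i → ⌊ 1 ℕ.≤? i ⌋) (i≡ fr)) (post Y s fr)
      starts-runs {c} {J} {G} post (suc i) Y s fr =
        runs-weaken (ℕ.≤-reflexive (start-time i (2 ℕ.* t ℕ.* 5) (Y ℕ.* roundTime) J))
        (runs-while true (cong (λ i → ⌊ 1 ℕ.≤? i ⌋) (i≡ fr))
        (runs-rand n (n≡ fr) λ v → runs-setN
          (visits-runs again (2 ℕ.* t) v Y _ (frame-5 (cong (2 ℕ.*_) (t≡ fr)) (frame-6 (toℕ v) fr)))))
        where
        again : ∀ Y′ {w′ x′} s′ → Frame (suc Y′) Y′ (suc i) 0 w′ x′ s′ →
                Runs (decrement 4 ∷ startLoop P ∷ c) s′ (Y′ ℕ.* roundTime ℕ.+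
                  (2 ℕ.+ (i ℕ.* (5 ℕ.+ 2 ℕ.* t ℕ.* 5) ℕ.+ J)))
                     (starts (2 ℕ.* t) i G Y′)
        again Y′ s′ fr′ = runs-weaken (ℕ.≤-reflexive (again-time (i ℕ.* (5 ℕ.+ 2 ℕ.* t ℕ.* 5))
          (Y′ ℕ.* roundTime) J))
          (runs-setN (starts-runs post i Y′ _ (frame-4 (cong (ℕ._∸ 1) (i≡ fr′)) fr′)))

  -- Execution of the whole test

  module Whole {n} .{{n≢0 : NonZero n}} (M : MarkovChain n) (t : ℕ) (ε : Carrier) (P : Program) (k : ℕ)
               (halts : ∀ w → Halts (runTester P k n ε (1 ÷ (6 ℕ.* t)) (candidate M t w) (target M t)))
               (K : ℕ) (K-enough : fromℕ 10 ≤ fromℕ K * (ε * ε))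
               (K-least : ∀ i → i ℕ.< K → ¬ (fromℕ 10 ≤ fromℕ i * (ε * ε))) where

    budget : ℕ
    budget = 10 ℕ.* (K ℕ.* t)

    open Execution M
    open Tester M t ε (suc budget)
    open Loops P k halts public

    private
      record Initial (i : ℕ) (s : Memory) : Set where
        field
          n≡    : nats s 0 ≡ n
          t≡    : nats s 1 ≡ t
          i≡    : nats s 2 ≡ i
          ε≡    : reals s 0 ≡ ε
          zero≡  : ∀ a → nats s (12 ℕ.+ a) ≡ 0
          zeroᴿ≡ : ∀ a → reals s (12 ℕ.+ a) ≡ 0#

      open Initial

      enough-≡ : ∀ {i s} → Initial i s → ⟦ enough ⟧ᵗ s ≡ ⌊ fromℕ 10 ≤? fromℕ i * (ε * ε) ⌋
      enough-≡ init = cong₂ (λ i ε → ⌊ fromℕ 10 ≤? fromℕ i * (ε * ε) ⌋) (i≡ init) (ε≡ init)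

      ⌊⌋-true : ∀ {x y} → x ≤ y → ⌊ x ≤? y ⌋ ≡ true
      ⌊⌋-true {x} {y} x≤y with x ≤? y
      ... | yes _   = refl
      ... | no  x≰y = contradiction x≤y x≰y

      ⌊⌋-false : ∀ {x y} → ¬ (x ≤ y) → ⌊ x ≤? y ⌋ ≡ false
      ⌊⌋-false {x} {y} x≰y with x ≤? y
      ... | yes x≤y = contradiction x≤y x≰y
      ... | no  _   = refl

      count-runs : ∀ {c J x} → (∀ s → Initial K s → Runs c s J x) → ∀ l i s → Initial i s → l ℕ.+ i ≡ K →
                   Runs (while (neg enough) (increment 2 ∷ []) ∷ c) s (suc (l ℕ.* 2 ℕ.+ J)) x
      count-runs post zero i s init refl =
        runs-while false (cong not (trans (enough-≡ init) (⌊⌋-true K-enough))) (post s init)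
      count-runs post (suc l) i s init 1+l+i≡K =
        runs-while true (cong not (trans (enough-≡ init) (⌊⌋-false
          (K-least i (subst (i ℕ.<_) 1+l+i≡K (s≤s (ℕ.m≤n+m i l)))))))
        (runs-setN (count-runs post l (suc i) _
          (record { Initial init hiding (i≡) ; i≡ = trans (cong (ℕ._+ 1) (i≡ init)) (ℕ.+-comm i 1) })
          (trans (ℕ.+-suc l i) 1+l+i≡K)))

    totalTime : ℕ
    totalTime = suc (K ℕ.* 2 ℕ.+ (3 ℕ.+ suc (K ℕ.* (5 ℕ.+ 2 ℕ.* t ℕ.* 5) ℕ.+ (budget ℕ.* roundTime ℕ.+ 2))))

    test-runs : Runs (mixingTest P) ⟨ load 0 (n ∷ t ∷ []) , load 0# (ε ∷ []) ⟩ totalTime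
      (starts (2 ℕ.* t) K positive budget)
    test-runs = count-runs prepare K 0 _
        (record { n≡ = refl ; t≡ = refl ; i≡ = refl ; ε≡ = refl ; zero≡ = λ _ → refl ; zeroᴿ≡ = λ _ → refl })
          (ℕ.+-identityʳ K)
      where
      halt : ∀ Y s → nats s 0 ≡ Y → Runs [] s 1 (positive Y)
      halt zero    s 0≡ (suc l) _ rewrite 0≡ = (λ ()) , refl
      halt (suc Y) s 0≡ (suc l) _ rewrite 0≡ = (λ ()) , refl
      finish : ∀ Y {j w x} s → Frame (suc Y) Y 0 j w x s → Runs (N[ lit 0 ]≔ N[ lit 3 ] ∷ []) s
        (Y ℕ.* roundTime ℕ.+ 2) (positive Y)
      finish Y s fr = runs-weaken (ℕ.m≤n+m 2 _) (runs-setN (halt Y _ (Frame.Y≡ fr)))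
      prepare : ∀ s → Initial K s → Runs _ s (3 ℕ.+ suc (K ℕ.* (5 ℕ.+ 2 ℕ.* t ℕ.* 5) ℕ.+
        (budget ℕ.* roundTime ℕ.+ 2))) (starts (2 ℕ.* t) K positive budget)
      prepare s init = runs-setN (runs-setN (runs-setN (starts-runs finish K budget _ (record
        { n≡ = n≡ init ; t≡ = t≡ init ; Y≡ = budget≡ ; i≡ = i≡ init ; j≡ = refl ; w≡ = refl ; x≡ = refl ; S≡ =
          cong suc budget≡
        ; ε≡ = ε≡ init ; Y<S = ℕ.n<1+n budget ; fresh = λ y _ a → zero≡ init (y ℕ.+ suc budget ℕ.* a)
        ; freshᴿ = λ y _ a → zeroᴿ≡ init (y ℕ.+ suc budget ℕ.* a) }))))
        where
        budget≡ : 10 ℕ.* (nats s 2 ℕ.* nats s 1) ≡ budget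
        budget≡ = cong₂ (λ K t → 10 ℕ.* (K ℕ.* t)) (i≡ init) (t≡ init)

-- Probability of winning the game

module Analysis (ℝ : ArchimedeanField) where

  open OrderedField ℝ
  open Chains ℝ
  open Repair ℝ
  open Simulation ℝ

  uniformD : ∀ n .{{_ : NonZero n}} → Distribution n
  uniformD n = record
    { prob        = λ _ → fromℕ n ⁻¹
    ; nonNegative = λ _ → 0≤1/ n
    ; total       = trans (sum-const n (fromℕ n ⁻¹)) (*-inverseʳ (fromℕ n) (<⇒≢ (0<fromℕ n)))
    }

  mean-uniform : ∀ {n} .{{_ : NonZero n}} (f : Fin n → Carrier) → mean f ≡ prob (uniformD n) · f
  mean-uniform {n} f = *-distribˡ-sum (fromℕ n ⁻¹) f

  prob-·-affine : ∀ {n} (p : Distribution n) r c f → prob p · (λ v → c + r * f v) ≡ c + r * prob p · f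
  prob-·-affine p r c f = trans (·-+ (prob p) (λ _ → c) (λ v → r * f v))
    (cong₂ _+_ (prob-·-const p c) (·-scale (prob p) f r))

  prob-·-≥ : ∀ {n} (p : Distribution n) {r c b} f → (∀ v → b ≤ r * f v + c) → b ≤ r * prob p · f + c
  prob-·-≥ p {r} {c} {b} f b≤ = begin
    b                                    ≡⟨ prob-·-const p b ⟨
    prob p · (λ _ → b)                   ≤⟨ ·-monoʳ (nonNegative p)
      (λ v → ≤-trans (b≤ v) (≤-reflexive (+-comm _ c))) ⟩
    prob p · (λ v → c + r * f v)         ≡⟨ prob-·-affine p r c f ⟩
    c + r * prob p · f                   ≡⟨ +-comm c _ ⟩
    r * prob p · f + c                   ∎
    where open ≤-Reasoning

  module Bounds {n} .{{n≢0 : NonZero n}} (M : MarkovChain n) (α β : Fin n → Carrier)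
                (0≤α : ∀ w → 0# ≤ α w) (0≤β : ∀ w → 0# ≤ β w) (α+β : ∀ w → α w + β w ≡ 1#) where

    open Game M α β

    private
      β≡1-α : ∀ w → β w ≡ 1# - α w
      β≡1-α w = trans (solve 2 (λ a b → b := (a :+ b) :- a) refl (α w) (β w)) (cong (_- α w) (α+β w))

      convex : ∀ w {x y g} → x ≤ g → y ≤ g → α w * x + β w * y ≤ g
      convex w {x} {y} {g} x≤g y≤g = ≤-trans (+-mono-≤ (*-monoˡ-≤ (0≤α w) x≤g) (*-monoˡ-≤ (0≤β w) y≤g))
        (≤-reflexive (trans (solve 3 (λ a b g → a :* g :+ b :* g := (a :+ b) :* g) refl (α w) (β w) g)
          (trans (cong (_* g) (α+β w)) (*-identityˡ g))))

    -- 2 Y - 3 x does not decrease on average: the drift of x is β - α ≤ -2/3 per unit of the budget.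
    module Accepting (5≤6α : ∀ w → fromℕ 5 ≤ fromℕ 6 * α w) (R : ℕ) where

      -- An affine lower bound (2Y - c)/r on the success probability with remaining budget Y. Being
      -- affine, it passes through averages, and each visit only adds 3 to `c`. The restriction to Y
      -- ≤ R is what makes it true of `positive`, with r = 2R.
      Pays : Carrier → Carrier → (ℕ → Carrier) → Set
      Pays r c G = ∀ Y → Y ℕ.≤ R → fromℕ 2 * fromℕ Y ≤ r * G Y + c

      gamble-pays : ∀ {r c G} w → Pays r c G → ∀ x → Pays r (c + fromℕ 3 * fromℕ x) (λ Y → gamble w Y x G)
      gamble-pays {r} {c} {G} w pays zero Y Y≤R = ≤-trans (pays Y Y≤R)
        (≤-reflexive (solve 2 (λ y c → y :+ c := y :+ (c :+ con (pos 3) :* con (pos 0))) refl (r * G Y) c))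
      gamble-pays {r} {c} {G} w pays (suc x) zero Y≤R = ≤-trans (pays zero Y≤R)
        (≤-by (fromℕ 3 * fromℕ (suc x)) (*-nonNegative (0≤fromℕ 3) (0≤fromℕ (suc x))) (+-assoc _ _ _))
      -- The last summand is the drift: a run uses 2 in the budget term while 3x falls by 3(α - β)
      -- on average, and 3(α - β) - 2 = 6α - 5.
      gamble-pays {r} {c} {G} w pays (suc x) (suc Y) Y<R = ≤-by
        (α w * (r * A + (c + fromℕ 3 * fromℕ x) - fromℕ 2 * fromℕ Y)
          + (β w * (r * B + (c + fromℕ 3 * fromℕ (suc (suc x))) - fromℕ 2 * fromℕ Y) +
            (fromℕ 6 * α w - fromℕ 5)))
        (0≤+ (*-nonNegative (0≤α w) (slack (gamble-pays w pays x Y (ℕ.<⇒≤ Y<R))))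
          (0≤+ (*-nonNegative (0≤β w) (slack (gamble-pays w pays (suc (suc x)) Y (ℕ.<⇒≤ Y<R))))
            (slack (5≤6α w))))
        (trans (cong (λ b → fromℕ 2 * fromℕ (suc Y) + (α w *
          (r * A + (c + fromℕ 3 * fromℕ x) - fromℕ 2 * fromℕ Y)
            + (b * (r * B + (c + fromℕ 3 * fromℕ (suc (suc x))) - fromℕ 2 * fromℕ Y) +
              (fromℕ 6 * α w - fromℕ 5)))) (β≡1-α w))
          (trans (solve 7 (λ a r A B c x Y →
              con (pos 2) :* (con (pos 1) :+ Y) :+ (a :* (r :* A :+ (c :+ con (pos 3) :* x) :- con (pos 2) :* Y)
                :+ ((con (pos 1) :- a) :* (r :* B :+ (c :+ con (pos 3) :* (con (pos 1) :+ (con (pos 1) :+ x)))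
                  :- con (pos 2) :* Y) :+ (con (pos 6) :* a :- con (pos 5))))
              := r :* (a :* A :+ (con (pos 1) :- a) :* B) :+ (c :+ con (pos 3) :* (con (pos 1) :+ x)))
            refl (α w) r A B c (fromℕ x) (fromℕ Y))
          (cong (λ b → r * (α w * A + b * B) + (c + fromℕ 3 * fromℕ (suc x))) (sym (β≡1-α w)))))
        where
        A = gamble w Y x G
        B = gamble w Y (suc (suc x)) G

      visits-pays : ∀ {r c G} → Pays r c G → ∀ j w → Pays r (c + fromℕ 3 * fromℕ j) (visits j w G)
      visits-pays {r} {c} {G} pays zero w Y Y≤R = ≤-trans (pays Y Y≤R)
        (≤-reflexive (solve 2 (λ y c → y :+ c := y :+ (c :+ con (pos 3) :* con (pos 0))) refl (r * G Y) c))
      visits-pays {r} {c} {G} pays (suc j) w Y Y≤R = ≤-trans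
        (gamble-pays w (λ Y′ Y′≤R → prob-·-≥ (M w) (λ v → visits j v G Y′) λ v → visits-pays pays j v Y′ Y′≤R)
          1 Y Y≤R)
        (≤-reflexive (solve 3 (λ y c j → y :+ (c :+ con (pos 3) :* j :+ con (pos 3) :*
          (con (pos 1) :+ con (pos 0))) := y :+ (c :+ con (pos 3) :* (con (pos 1) :+ j)))
          refl (r * visits (suc j) w G Y) c (fromℕ j)))

      starts-pays : ∀ {r c G} L → Pays r c G → ∀ i → Pays r (c + fromℕ 3 * (fromℕ L * fromℕ i)) (starts L i G)
      starts-pays {r} {c} {G} L pays zero Y Y≤R = ≤-trans (pays Y Y≤R)
        (≤-reflexive (solve 3 (λ y c l → y :+ c := y :+ (c :+ con (pos 3) :* (l :* con (pos 0)))) refl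
          (r * G Y) c (fromℕ L)))
      starts-pays {r} {c} {G} L pays (suc i) Y Y≤R = ≤-trans
        (subst (λ z → fromℕ 2 * fromℕ Y ≤ r * z + (c + fromℕ 3 * (fromℕ L * fromℕ i) + fromℕ 3 * fromℕ L))
          (sym (mean-uniform (λ v → visits L v (starts L i G) Y)))
          (prob-·-≥ (uniformD n) (λ v → visits L v (starts L i G) Y) λ v → visits-pays (starts-pays L pays i)
            L v Y Y≤R))
        (≤-reflexive (solve 4 (λ y c l i → y :+ (c :+ con (pos 3) :* (l :* i) :+ con (pos 3) :* l) := y :+
          (c :+ con (pos 3) :* (l :* (con (pos 1) :+ i))))
          refl (r * starts L (suc i) G Y) c (fromℕ L) (fromℕ i)))

      positive-pays : Pays (fromℕ 2 * fromℕ R) 0# positive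
      positive-pays zero    _   = ≤-reflexive (solve 1 (λ r → con (pos 2) :* con (pos 0) := con (pos 2) :* r
        :* con (pos 0) :+ con (pos 0)) refl (fromℕ R))
      positive-pays (suc Y) Y<R = ≤-trans (*-monoˡ-≤ (0≤fromℕ 2) (fromℕ-mono-≤ Y<R))
        (≤-reflexive (solve 1 (λ r → con (pos 2) :* r := con (pos 2) :* r :* con (pos 1) :+ con (pos 0)) refl
          (fromℕ R)))

    -- The 2tK visits cost 6Kt out of 2R = 20Kt, so the probability of success is at least 14/20,
    -- which exceeds 2/3.
    accept-likely : (∀ w → fromℕ 5 ≤ fromℕ 6 * α w) → ∀ t K .{{_ : NonZero t}} .{{_ : NonZero K}} →
                    2 ÷ 3 ≤ starts (2 ℕ.* t) K positive (10 ℕ.* (K ℕ.* t))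
    accept-likely 5≤6α t K = *-cancelˡ-≤ (0<fromℕ 3) (begin
      fromℕ 3 * (fromℕ 2 * fromℕ 3 ⁻¹)   ≡⟨ solve 3 (λ a b c → a :* (b :* c) := (a :* c) :* b) refl (fromℕ 3)
        (fromℕ 2) (fromℕ 3 ⁻¹) ⟩
      fromℕ 3 * fromℕ 3 ⁻¹ * fromℕ 2     ≡⟨ trans (cong (_* fromℕ 2) (*-inverseʳ (fromℕ 3) (<⇒≢ (0<fromℕ 3))))
        (*-identityˡ _) ⟩
      fromℕ 2                            ≤⟨ *-cancelˡ-≤ (0<* (0<fromℕ 20) 0<x) scaled ⟩
      fromℕ 3 * res                      ∎)
      where
      open ≤-Reasoning
      R = 10 ℕ.* (K ℕ.* t)
      res = starts (2 ℕ.* t) K positive R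
      x = fromℕ K * fromℕ t
      0<x : 0# < x
      0<x = 0<* (0<fromℕ K) (0<fromℕ t)
      R≡ : fromℕ R ≡ fromℕ 10 * x
      R≡ = trans (fromℕ-* 10 (K ℕ.* t)) (cong (fromℕ 10 *_) (fromℕ-* K t))
      paid : fromℕ 2 * (fromℕ 10 * x) ≤ fromℕ 2 * (fromℕ 10 * x) * res +
        (0# + fromℕ 3 * (fromℕ 2 * fromℕ t * fromℕ K))
      paid = subst₂ (λ r l → fromℕ 2 * r ≤ fromℕ 2 * r * res + (0# + fromℕ 3 * (l * fromℕ K))) R≡ (fromℕ-* 2 t)
        (Accepting.starts-pays 5≤6α R (2 ℕ.* t) (Accepting.positive-pays 5≤6α R) K R ℕ.≤-refl)
      scaled : fromℕ 20 * x * fromℕ 2 ≤ fromℕ 20 * x * (fromℕ 3 * res)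
      scaled = ≤-by (fromℕ 3 * (fromℕ 2 * (fromℕ 10 * x) * res +
        (0# + fromℕ 3 * (fromℕ 2 * fromℕ t * fromℕ K)) - fromℕ 2 * (fromℕ 10 * x)) + fromℕ 2 * x)
        (0≤+ (*-nonNegative (0≤fromℕ 3) (slack paid)) (*-nonNegative (0≤fromℕ 2) (proj₁ 0<x)))
        (solve 3 (λ K t r →
          con (pos 20) :* (K :* t) :* con (pos 2)
            :+ (con (pos 3) :* (con (pos 2) :* (con (pos 10) :* (K :* t)) :* r :+
              (con (pos 0) :+ con (pos 3) :* (con (pos 2) :* t :* K)) :- con (pos 2) :*
              (con (pos 10) :* (K :* t))) :+ con (pos 2) :* (K :* t))
          := con (pos 20) :* (K :* t) :* (con (pos 3) :* r)) refl (fromℕ K) (fromℕ t) res)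

    ⅕ : Carrier
    ⅕ = fromℕ 5 ⁻¹

    private
      5*⅕ : fromℕ 5 * ⅕ ≡ 1#
      5*⅕ = *-inverseʳ (fromℕ 5) (<⇒≢ (0<fromℕ 5))

      0≤⅕ : 0# ≤ ⅕
      0≤⅕ = 0≤1/ 5

      ⅕≤1 : ⅕ ≤ 1#
      ⅕≤1 = ≤-by (fromℕ 4 * ⅕) (*-nonNegative (0≤fromℕ 4) 0≤⅕)
        (trans (solve 1 (λ q → q :+ con (pos 4) :* q := con (pos 5) :* q) refl ⅕) 5*⅕)

      -- The gambler's ruin probability from x when down and up steps have probabilities 1/6 and
      -- 5/6: the x-th power of their ratio.
      ruin : ℕ → Carrier
      ruin zero    = 1#
      ruin (suc x) = ⅕ * ruin x

      0≤ruin : ∀ x → 0# ≤ ruin x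
      0≤ruin zero    = 0≤1
      0≤ruin (suc x) = *-nonNegative 0≤⅕ (0≤ruin x)

    gamble-≤ : ∀ {G g} w → (∀ Y → G Y ≤ g) → ∀ Y x → gamble w Y x G ≤ g
    gamble-≤ w G≤g Y       zero    = G≤g Y
    gamble-≤ w G≤g zero    (suc x) = G≤g zero
    gamble-≤ w G≤g (suc Y) (suc x) = convex w (gamble-≤ w G≤g Y x) (gamble-≤ w G≤g Y (suc (suc x)))

    -- 5^(-x) does not increase on average when α ≤ 1/6.
    gamble-ruin : ∀ {G g} w → fromℕ 6 * α w ≤ 1# → 0# ≤ g → G 0 ≤ 0# → (∀ Y → G Y ≤ g) →
                  ∀ Y x → gamble w Y x G ≤ ruin x * g
    gamble-ruin {G} {g} w 6α≤1 0≤g G0≤0 G≤g Y zero = ≤-trans (G≤g Y) (≤-reflexive (sym (*-identityˡ g)))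
    gamble-ruin {G} {g} w 6α≤1 0≤g G0≤0 G≤g zero (suc x) = ≤-trans G0≤0 (*-nonNegative (0≤ruin (suc x)) 0≤g)
    gamble-ruin {G} {g} w 6α≤1 0≤g G0≤0 G≤g (suc Y) (suc x) = begin
      α w * gamble w Y x G + β w * gamble w Y (suc (suc x)) G
        ≤⟨ +-mono-≤ (*-monoˡ-≤ (0≤α w) (gamble-ruin w 6α≤1 0≤g G0≤0 G≤g Y x))
          (*-monoˡ-≤ (0≤β w) (gamble-ruin w 6α≤1 0≤g G0≤0 G≤g Y (suc (suc x)))) ⟩
      α w * (ruin x * g) + β w * (⅕ * (⅕ * ruin x) * g)
        ≡⟨ cong (λ b → α w * (ruin x * g) + b * (⅕ * (⅕ * ruin x) * g)) (β≡1-α w) ⟩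
      α w * (ruin x * g) + (1# - α w) * (⅕ * (⅕ * ruin x) * g)
        ≤⟨ ≤-by (fromℕ 4 * (⅕ * ⅕) * (1# - fromℕ 6 * α w) * (ruin x * g))
             (*-nonNegative (*-nonNegative (*-nonNegative (0≤fromℕ 4) (*-nonNegative 0≤⅕ 0≤⅕)) (slack 6α≤1))
               (*-nonNegative (0≤ruin x) 0≤g))
             (solve 4 (λ a q r g →
                a :* (r :* g) :+ (con (pos 1) :- a) :* (q :* (q :* r) :* g) :+ con (pos 4) :* (q :* q) :*
                  (con (pos 1) :- con (pos 6) :* a) :* (r :* g)
                := (a :+ (con (pos 5) :* q) :* q :- a :* ((con (pos 5) :* q) :* (con (pos 5) :* q))) :*
                  (r :* g)) refl (α w) ⅕ (ruin x) g) ⟩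
      (α w + (fromℕ 5 * ⅕) * ⅕ - α w * ((fromℕ 5 * ⅕) * (fromℕ 5 * ⅕))) * (ruin x * g)
        ≡⟨ cong (λ k → (α w + k * ⅕ - α w * (k * k)) * (ruin x * g)) 5*⅕ ⟩
      (α w + 1# * ⅕ - α w * (1# * 1#)) * (ruin x * g)
        ≡⟨ solve 4 (λ a q r g → (a :+ con (pos 1) :* q :- a :* (con (pos 1) :* con (pos 1))) :* (r :* g) := q
          :* r :* g) refl (α w) ⅕ (ruin x) g ⟩
      ⅕ * ruin x * g ∎
      where open ≤-Reasoning

    module Rejecting (bad : Fin n → Bool) (6α≤1 : ∀ w → bad w ≡ true → fromℕ 6 * α w ≤ 1#) where

      private
        σ = survival M bad

      -- Bounds the probability of completing j visits: 1 if no bad state is met, and 1/5 otherwise.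
      pass : ℕ → Fin n → Carrier
      pass j w = ⅕ + (1# - ⅕) * σ j w

      private
        0≤pass : ∀ j w → 0# ≤ pass j w
        0≤pass j w = 0≤+ 0≤⅕ (*-nonNegative (slack ⅕≤1) (survival-nonNeg M bad j w))

        pass≤1 : ∀ j w → pass j w ≤ 1#
        pass≤1 j w = ≤-by ((1# - ⅕) * (1# - σ j w)) (*-nonNegative (slack ⅕≤1) (slack (survival-≤1 M bad j w)))
          (solve 2 (λ q s → q :+ (con (pos 1) :- q) :* s :+ (con (pos 1) :- q) :* (con (pos 1) :- s) := con
            (pos 1)) refl ⅕ (σ j w))

      -- An exhausted budget stays exhausted, so running out during a gamble never helps acceptance;
      -- `gamble-ruin` relies on this.
      visits-broke : ∀ {G} → G 0 ≤ 0# → ∀ j w → visits j w G 0 ≤ 0#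
      visits-broke G0≤0 zero    w = G0≤0
      visits-broke {G} G0≤0 (suc j) w = prob-·-≤ (M w) λ v → visits-broke {G} G0≤0 j v

      visits-≤ : ∀ {G g} → 0# ≤ g → G 0 ≤ 0# → (∀ Y → G Y ≤ g) → ∀ j w Y → visits j w G Y ≤ g * pass j w
      visits-≤ {G} {g} 0≤g G0≤0 G≤g zero w Y = ≤-trans (G≤g Y) (≤-reflexive (sym (trans
        (cong (λ s → g * (⅕ + (1# - ⅕) * s)) (sum-e w)) (solve 2
          (λ g q → g :* (q :+ (con (pos 1) :- q) :* con (pos 1)) := g) refl g ⅕))))
      visits-≤ {G} {g} 0≤g G0≤0 G≤g (suc j) w Y = [ at-bad , at-good ]′ (true-or-false (bad w))
        where
        open ≤-Reasoning
        next : ℕ → Carrier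
        next Y′ = matrix M w · λ v → visits j v G Y′
        at-bad : bad w ≡ true → visits (suc j) w G Y ≤ g * pass (suc j) w
        at-bad eq = begin
          gamble w Y 1 next
            ≤⟨ gamble-ruin w (6α≤1 w eq) 0≤g (prob-·-≤ (M w) λ v → visits-broke {G} G0≤0 j v)
                 (λ Y′ → prob-·-≤ (M w) λ v → ≤-trans (visits-≤ 0≤g G0≤0 G≤g j v Y′)
                   (≤-trans (*-monoˡ-≤ 0≤g (pass≤1 j v)) (≤-reflexive (*-identityʳ g)))) Y 1 ⟩
          ⅕ * 1# * g
            ≡⟨ solve 2 (λ q g → q :* con (pos 1) :* g := g :* (q :+ (con (pos 1) :- q) :* con (pos 0))) refl ⅕
              g ⟩
          g * (⅕ + (1# - ⅕) * 0#)
            ≡⟨ cong (λ s → g * (⅕ + (1# - ⅕) * s)) (survival-bad M bad (suc j) w eq) ⟨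
          g * pass (suc j) w ∎
        at-good : bad w ≡ false → visits (suc j) w G Y ≤ g * pass (suc j) w
        at-good eq = gamble-≤ w (λ Y′ → begin
          next Y′
            ≤⟨ ·-monoʳ (nonNegative (M w)) (λ v → visits-≤ 0≤g G0≤0 G≤g j v Y′) ⟩
          matrix M w · (λ v → g * pass j v)
            ≡⟨ ·-scale (matrix M w) (pass j) g ⟩
          g * matrix M w · pass j
            ≡⟨ cong (g *_) (prob-·-affine (M w) (1# - ⅕) ⅕ (σ j)) ⟩
          g * (⅕ + (1# - ⅕) * matrix M w · σ j)
            ≡⟨ cong (λ s → g * (⅕ + (1# - ⅕) * s)) (survival-good M bad j w eq) ⟨
          g * pass (suc j) w ∎) Y 1

      -- At a bad state the counter never returns to 0 with probability at least 4/5.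
      loss : ℕ → Carrier
      loss L = (1# - ⅕) * (1# - mean (σ L))

      private
        mean-pass : ∀ L → mean (pass L) ≡ 1# - loss L
        mean-pass L = begin
          mean (pass L)                            ≡⟨ mean-uniform (pass L) ⟩
          prob (uniformD n) · pass L               ≡⟨ prob-·-affine (uniformD n) (1# - ⅕) ⅕ (σ L) ⟩
          ⅕ + (1# - ⅕) * prob (uniformD n) · σ L   ≡⟨ cong (λ s → ⅕ + (1# - ⅕) * s) (mean-uniform (σ L)) ⟨
          ⅕ + (1# - ⅕) * mean (σ L)                ≡⟨ solve 2
            (λ q s → q :+ (con (pos 1) :- q) :* s := con (pos 1) :- (con (pos 1) :- q) :* (con (pos 1) :- s))
            refl ⅕ (mean (σ L)) ⟩
          1# - loss L                              ∎
          where open ≡-Reasoning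

        0≤1-loss : ∀ L → 0# ≤ 1# - loss L
        0≤1-loss L = subst (0# ≤_) (mean-pass L) (*-nonNegative (0≤1/ n) (sum-nonNeg (0≤pass L)))

        0≤loss : ∀ L → 0# ≤ loss L
        0≤loss L = *-nonNegative (slack ⅕≤1) (slack (≤-trans (mean-mono (survival-≤1 M bad L))
          (≤-reflexive (mean-const {n} 1#))))

      bound : ℕ → ℕ → Carrier
      bound L zero    = 1#
      bound L (suc i) = bound L i * (1# - loss L)

      private
        0≤bound : ∀ L i → 0# ≤ bound L i
        0≤bound L zero    = 0≤1
        0≤bound L (suc i) = *-nonNegative (0≤bound L i) (0≤1-loss L)

      -- Takes the place of an exponential estimate of the power of 1 - loss, and uses ordered field
      -- arithmetic only.
      bernoulli : ∀ L i → bound L i * (1# + fromℕ i * loss L) ≤ 1#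
      bernoulli L zero    = ≤-reflexive (solve 1 (λ l → con (pos 1) :* (con (pos 1) :+ con (pos 0) :* l) :=
        con (pos 1)) refl (loss L))
      bernoulli L (suc i) = ≤-trans
        (≤-by (bound L i * (loss L * loss L + fromℕ i * (loss L * loss L)))
          (*-nonNegative (0≤bound L i) (0≤+ (*-nonNegative (0≤loss L) (0≤loss L))
            (*-nonNegative (0≤fromℕ i) (*-nonNegative (0≤loss L) (0≤loss L)))))
          (solve 3 (λ b l i → b :* (con (pos 1) :- l) :* (con (pos 1) :+ (con (pos 1) :+ i) :* l) :+ b :*
            (l :* l :+ i :* (l :* l)) := b :* (con (pos 1) :+ i :* l))
            refl (bound L i) (loss L) (fromℕ i)))
        (bernoulli L i)

      starts-broke : ∀ {G} → G 0 ≤ 0# → ∀ L i → starts L i G 0 ≤ 0#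
      starts-broke G0≤0 L zero    = G0≤0
      starts-broke {G} G0≤0 L (suc i) = ≤-trans (≤-reflexive (mean-uniform (λ v → visits L v (starts L i G) 0)))
        (prob-·-≤ (uniformD n) λ v → visits-broke {starts L i G} (starts-broke {G} G0≤0 L i) L v)

      starts-≤ : ∀ {G} → G 0 ≤ 0# → (∀ Y → G Y ≤ 1#) → ∀ L i Y → starts L i G Y ≤ bound L i
      starts-≤ G0≤0 G≤1 L zero Y = G≤1 Y
      starts-≤ {G} G0≤0 G≤1 L (suc i) Y = begin
        mean (λ v → visits L v (starts L i G) Y)
          ≤⟨ mean-mono (λ v → visits-≤ (0≤bound L i) (starts-broke {G} G0≤0 L i) (starts-≤ G0≤0 G≤1 L i) L v
            Y) ⟩
        mean (λ v → bound L i * pass L v)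
          ≡⟨ trans (mean-uniform (λ v → bound L i * pass L v))
            (trans (·-scale (prob (uniformD n)) (pass L) (bound L i))
            (cong (bound L i *_) (sym (mean-uniform (pass L))))) ⟩
        bound L i * mean (pass L)
          ≡⟨ cong (bound L i *_) (mean-pass L) ⟩
        bound L (suc i) ∎
        where open ≤-Reasoning

      positive-≤1 : ∀ Y → positive Y ≤ 1#
      positive-≤1 zero    = 0≤1
      positive-≤1 (suc Y) = ≤-refl

      -- Here δ will be ε². Each walk loses with probability at least (4/5)(δ/4) = δ/5, so K times
      -- the loss is at least 2 and `bernoulli` leaves at most 1/3. This is the origin of the
      -- constant 10.
      accept-unlikely : ∀ {δ} L K Y → 0# ≤ δ → δ ≤ fromℕ 4 * (1# - mean (σ L)) → fromℕ 10 ≤ fromℕ K * δ →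
                        fromℕ 3 * starts L K positive Y ≤ 1#
      accept-unlikely {δ} L K Y 0≤δ δ≤ 10≤Kδ = begin
        fromℕ 3 * starts L K positive Y        ≤⟨ *-monoˡ-≤ (0≤fromℕ 3) (starts-≤ ≤-refl positive-≤1 L K Y) ⟩
        fromℕ 3 * bound L K                    ≡⟨ *-comm _ _ ⟩
        bound L K * fromℕ 3                    ≤⟨ *-monoˡ-≤ (0≤bound L K) 3≤1+Kl ⟩
        bound L K * (1# + fromℕ K * loss L)    ≤⟨ bernoulli L K ⟩
        1#                                     ∎
        where
        open ≤-Reasoning
        m = 1# - mean (σ L)
        4m≡5loss : fromℕ 4 * m ≡ fromℕ 5 * loss L
        4m≡5loss = sym (trans (solve 2 (λ q m → con (pos 5) :* ((con (pos 1) :- q) :* m) :=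
          (con (pos 5) :- con (pos 5) :* q) :* m) refl ⅕ m)
          (trans (cong (λ k → (fromℕ 5 - k) * m) 5*⅕) (cong (_* m)
            (solve 0 (con (pos 5) :- con (pos 1) := con (pos 4)) refl))))
        3≤1+Kl : fromℕ 3 ≤ 1# + fromℕ K * loss L
        3≤1+Kl = *-cancelˡ-≤ (0<fromℕ 5) (≤-by
          ((fromℕ K * δ - fromℕ 10) + fromℕ K * (fromℕ 5 * loss L - δ))
          (0≤+ (slack 10≤Kδ) (*-nonNegative (0≤fromℕ K) (slack (subst (δ ≤_) 4m≡5loss δ≤))))
          (solve 3 (λ K d l → con (pos 5) :* con (pos 3) :+
            ((K :* d :- con (pos 10)) :+ K :* (con (pos 5) :* l :- d)) := con (pos 5) :*
            (con (pos 1) :+ K :* l))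
            refl (fromℕ K) δ (loss L)))

-- Minimality is needed twice: it describes where the counting loop of the test stops, and it bounds
-- K from above in the running time.
least : ∀ {A : ℕ → Set} → (∀ i → Dec (A i)) → ∀ k → A k → ∃[ K ] A K × (∀ i → i ℕ.< K → ¬ A i)
least A? zero    a = 0 , a , λ i ()
least A? (suc k) a with A? 0
... | yes a₀ = 0 , a₀ , λ i ()
... | no ¬a₀ with least (A? ∘ suc) k a
...   | K , aᴷ , min = suc K , aᴷ , λ { zero _ → ¬a₀ ; (suc i) (s≤s i<K) → min i i<K }

-- Correctness and running time of the test

module Tested (ℝ : ArchimedeanField) where

  open OrderedField ℝ
  open Chains ℝ
  open Repair ℝ
  open Simulation ℝ
  open Analysis ℝ

  module _ (P : Program) (f : Carrier → Carrier) (T : ℕ → Carrier → Carrier → ℕ)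
    (tester : IsDistanceTester P f T)
           (n : ℕ) .{{n≢0 : NonZero n}} (d : ℕ) (M : MarkovChain n) (sparse : Sparse d M)
           (t : ℕ) .{{t≢0 : NonZero t}} (ε : Carrier) (0<ε : 0# < ε) where

    private
      δ : Carrier
      δ = 1 ÷ (6 ℕ.* t)

      instance
        6t≢0 : NonZero (6 ℕ.* t)
        6t≢0 = ℕ.m*n≢0 6 t

      6tδ≡1 : fromℕ (6 ℕ.* t) * δ ≡ 1#
      6tδ≡1 = trans (solve 2 (λ a b → a :* ((con (pos 1) :+ con (pos 0)) :* b) := a :* b) refl
        (fromℕ (6 ℕ.* t)) (fromℕ (6 ℕ.* t) ⁻¹))
        (*-inverseʳ _ (<⇒≢ (0<fromℕ (6 ℕ.* t))))

      0<δ : 0# < δ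
      0<δ = 0<* (0<fromℕ 1) (0<⁻¹ (0<fromℕ (6 ℕ.* t)))

      6δ≤1 : fromℕ 6 * δ ≤ 1#
      6δ≤1 = subst (fromℕ 6 * δ ≤_) 6tδ≡1 (subst₂ _≤_ (*-comm δ _) (*-comm δ _)
        (*-monoˡ-≤ (proj₁ 0<δ) (fromℕ-mono-≤ (ℕ.m≤m*n 6 t))))

      δ<1 : δ < 1#
      δ<1 = ≰⇒> λ 1≤δ → <⇒≱ (0<fromℕ 5) (≤-by (fromℕ 6 * (δ - 1#) + (1# - fromℕ 6 * δ))
        (0≤+ (*-nonNegative (0≤fromℕ 6) (slack 1≤δ)) (slack 6δ≤1))
        (solve 1 (λ d → con (pos 5) :+ (con (pos 6) :* (d :- con (pos 1)) :+
          (con (pos 1) :- con (pos 6) :* d)) := con (pos 0)) refl δ))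

      k : ℕ
      k = T n ε δ

      trial-halts : ∀ w → Halts (runTester P k n ε δ (candidate M t w) (target M t))
      trial-halts w = IsDistanceTester.halts tester 0<ε 0<δ δ<1 (candidate M t w) (target M t)

      -- With no steps at all the tester would time out. The time bound uses this to absorb the
      -- terms that do not contain T.
      k≢0 : NonZero k
      k≢0 = nonZero k (trial-halts (proj₁ (argmax {n} λ _ → 0#)))
        where
        nonZero : ∀ k {p q : Distribution n} → Halts (runTester P k n ε δ p q) → NonZero k
        nonZero zero    halts = contradiction refl halts
        nonZero (suc k) _     = _

      0<ε² : 0# < ε * ε
      0<ε² = 0<* 0<ε 0<ε

      enough-starts : ∃[ K ] fromℕ 10 ≤ fromℕ K * (ε * ε) × (∀ i → i ℕ.< K → ¬ (fromℕ 10 ≤ fromℕ i * (ε * ε)))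
      enough-starts with archimedean (fromℕ 10 * (ε * ε) ⁻¹)
      ... | k₀ , 10/ε²≤k₀ = least (λ i → fromℕ 10 ≤? fromℕ i * (ε * ε)) k₀ (begin
        fromℕ 10                               ≡⟨ *-identityʳ _ ⟨
        fromℕ 10 * 1#                          ≡⟨ cong (fromℕ 10 *_) (*-inverseʳ (ε * ε) (<⇒≢ 0<ε²)) ⟨
        fromℕ 10 * (ε * ε * (ε * ε) ⁻¹)        ≡⟨ solve 3 (λ a b c → a :* (b :* c) := b :* (a :* c)) refl
          (fromℕ 10) (ε * ε) ((ε * ε) ⁻¹) ⟩
        ε * ε * (fromℕ 10 * (ε * ε) ⁻¹)        ≤⟨ *-monoˡ-≤ (proj₁ 0<ε²) 10/ε²≤k₀ ⟩
        ε * ε * fromℕ k₀                       ≡⟨ *-comm _ _ ⟩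
        fromℕ k₀ * (ε * ε)                     ∎)
        where open ≤-Reasoning

      K : ℕ
      K = proj₁ enough-starts

      10≤Kε² : fromℕ 10 ≤ fromℕ K * (ε * ε)
      10≤Kε² = proj₁ (proj₂ enough-starts)

      K-least : ∀ i → i ℕ.< K → ¬ (fromℕ 10 ≤ fromℕ i * (ε * ε))
      K-least = proj₂ (proj₂ enough-starts)

      K≢0 : NonZero K
      K≢0 = nonZero K 10≤Kε²
        where
        nonZero : ∀ K → fromℕ 10 ≤ fromℕ K * (ε * ε) → NonZero K
        nonZero zero    10≤0 = contradiction (≤-trans 10≤0 (≤-reflexive (zeroˡ _))) (<⇒≱ (0<fromℕ 10))
        nonZero (suc K) _    = _

      open Whole M t ε P k trial-halts K 10≤Kε² K-least

    steps : ℕ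
    steps = totalTime

    private
      outcome : Tree Outcome
      outcome = runTest (mixingTest P) steps t ε M

      outcome-runs : Halts outcome × Pr isAccept outcome ≡ starts (2 ℕ.* t) K positive budget
      outcome-runs = test-runs steps ℕ.≤-refl

      trial-prob : ∀ w → IsProb (trial w)
      trial-prob w = IsProb-run (IsProb-samplers (candidate M t w) (target M t)) k P _

      open Bounds M (λ w → Pr isAccept (trial w)) (λ w → Pr isReject (trial w))
        (λ w → Pr-nonNeg isAccept (trial w) (trial-prob w)) (λ w → Pr-nonNeg isReject (trial w) (trial-prob w))
        (λ w → accept+reject (trial w) (trial-prob w) (trial-halts w))

    test-halts : Halts outcome
    test-halts = proj₁ outcome-runs

    test-accepts : Mixing (f ε) t M → 2 ÷ 3 ≤ Pr isAccept outcome
    test-accepts (s , close) = subst (2 ÷ 3 ≤_) (sym (proj₂ outcome-runs))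
      (accept-likely 5≤6α t K {{t≢0}} {{K≢0}})
      where
      open ≤-Reasoning
      near : ∀ w → ℓ₁ ((matrix M ^ t) w) (prob s) ≤ f ε
      near w = subst (_≤ f ε) (ℓ₁-cong (λ v → e-· w λ u → (matrix M ^ t) u v) λ _ → refl) (close w)
      average-near : ℓ₁ (prob (target M t)) (prob s) ≤ f ε
      average-near = begin
        ℓ₁ (prob (target M t)) (prob s)
          ≡⟨ ℓ₁-cong (λ v → mean-uniform λ u → (matrix M ^ t) u v)
               (λ v → sym (trans (cong (_* prob s v) (total (uniformD n))) (*-identityˡ _))) ⟩
        ℓ₁ (prob (uniformD n) ⊡ matrix M ^ t) (λ v → sum (prob (uniformD n)) * prob s v)
          ≤⟨ mixture-close (prob (uniformD n)) (matrix M ^ t) (prob s) (nonNegative (uniformD n)) ⟩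
        prob (uniformD n) · (λ w → ℓ₁ ((matrix M ^ t) w) (prob s))
          ≤⟨ prob-·-≤ (uniformD n) near ⟩
        f ε ∎
      candidate-near : ∀ w → ℓ₁ (prob (candidate M t w)) (prob (target M t)) ≤ f ε
      candidate-near w = begin
        ℓ₁ (prob (candidate M t w)) (prob (target M t))
          ≤⟨ midpoint-ℓ₁-≤ (endpoint M t w) (target M t) ⟩
        ½ * ℓ₁ ((matrix M ^ t) w) (prob (target M t))
          ≤⟨ *-monoˡ-≤ 0≤½ (≤-trans (ℓ₁-triangle ((matrix M ^ t) w) (prob s) (prob (target M t)))
               (+-mono-≤ (near w) (≤-trans (ℓ₁-sym (prob s) (prob (target M t))) average-near))) ⟩
        ½ * (f ε + f ε)
          ≡⟨ trans (solve 2 (λ h x → h :* (x :+ x) := (h :+ h) :* x) refl ½ (f ε))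
            (trans (cong (_* f ε) ½+½) (*-identityˡ _)) ⟩
        f ε ∎
      5≤6α : ∀ w → fromℕ 5 ≤ fromℕ 6 * Pr isAccept (trial w)
      5≤6α w = ≤-by (fromℕ 6 * (Pr isAccept (trial w) - (1# - δ)) + (1# - fromℕ 6 * δ))
        (0≤+ (*-nonNegative (0≤fromℕ 6) (slack (IsDistanceTester.accepts tester 0<ε 0<δ δ<1 (candidate M t w)
          (target M t) (candidate-near w)))) (slack 6δ≤1))
        (solve 2 (λ a d → con (pos 5) :+ (con (pos 6) :* (a :- (con (pos 1) :- d)) :+
          (con (pos 1) :- con (pos 6) :* d)) := con (pos 6) :* a) refl (Pr isAccept (trial w)) δ)

    private
      bad : Fin n → Bool
      bad w = not ⌊ ℓ₁ (prob (candidate M t w)) (prob (target M t)) ≤? ε ⌋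

      good-close : ∀ w → bad w ≡ false → ℓ₁ (prob (candidate M t w)) (prob (target M t)) ≤ ε
      good-close w eq with ℓ₁ (prob (candidate M t w)) (prob (target M t)) ≤? ε
      ... | yes close = close
      good-close w () | no _

      bad-far : ∀ w → bad w ≡ true → ε < ℓ₁ (prob (candidate M t w)) (prob (target M t))
      bad-far w eq with ℓ₁ (prob (candidate M t w)) (prob (target M t)) ≤? ε
      bad-far w () | yes _
      ... | no far = ≰⇒> far

      6α≤1 : ∀ w → bad w ≡ true → fromℕ 6 * Pr isAccept (trial w) ≤ 1#
      6α≤1 w eq = ≤-by (fromℕ 6 * (Pr isReject (trial w) - (1# - δ)) + (1# - fromℕ 6 * δ))
        (0≤+ (*-nonNegative (0≤fromℕ 6) (slack (IsDistanceTester.rejects tester 0<ε 0<δ δ<1 (candidate M t w)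
          (target M t) (bad-far w eq)))) (slack 6δ≤1))
        (trans (solve 3 (λ a r d → con (pos 6) :* a :+ (con (pos 6) :* (r :- (con (pos 1) :- d)) :+
          (con (pos 1) :- con (pos 6) :* d)) := con (pos 6) :* (a :+ r) :- con (pos 5))
            refl (Pr isAccept (trial w)) (Pr isReject (trial w)) δ)
          (trans (cong (λ z → fromℕ 6 * z - fromℕ 5) (accept+reject (trial w) (trial-prob w) (trial-halts w)))
            (solve 0 (con (pos 6) :* con (pos 1) :- con (pos 5) := con (pos 1)) refl)))

      Repairable : Set
      Repairable = Σ[ M′ ∈ MarkovChain n ] Sparse d M′ × Mixing (fromℕ 4 * ε) (2 ℕ.* t) M′
                     × Close d t (fromℕ 2 * ε) (101 ÷ 100 * ε) M M′

      -- The repair is carried out for ε at most 1. Beyond that, distributions are never more than 2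
      -- ≤ 4ε apart, so `M` itself is the witness.
      coarse : 1# ≤ ε → Repairable
      coarse 1≤ε = M , sparse
        , (target M t , λ u → ≤-trans (≤-reflexive (ℓ₁-cong (λ v → e-· u λ w → (matrix M ^ (2 ℕ.* t)) w v) λ _
          → refl))
             (≤-trans (ℓ₁-≤2 (endpoint M (2 ℕ.* t) u) (target M t))
               (≤-by (fromℕ 4 * (ε - 1#) + fromℕ 2) (0≤+ (*-nonNegative (0≤fromℕ 4) (slack 1≤ε)) (0≤fromℕ 2))
                 (solve 1 (λ ε → con (pos 2) :+ (con (pos 4) :* (ε :- con (pos 1)) :+ con (pos 2)) := con
                   (pos 4) :* ε) refl ε))))
        , cancel-÷ {differences M M} {d ℕ.* n}
            (≤-trans (count-product (λ (u , v) → ¬? (matrix M u v ≟ matrix M u v)) id (allFin n) (λ _ → 0#)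
                       λ u → ≤-reflexive (cong fromℕ (count-≡ (matrix M u) (allFin n))))
              (≤-trans (≤-reflexive (sum-0 {n} λ _ → refl)) (*-nonNegative (0≤fromℕ (d ℕ.* n)) 0≤2ε)))
            0≤2ε
        , ≤-trans (ℓ₁-≡ {x = average M t} λ _ → refl) (*-nonNegative (*-nonNegative (0≤fromℕ 101) (0≤1/ 100))
          (proj₁ 0<ε))
        where
        0≤2ε : 0# ≤ fromℕ 2 * ε
        0≤2ε = *-nonNegative (0≤fromℕ 2) (proj₁ 0<ε)

      fine : ε ≤ 1# → fromℕ 4 * (1# - mean (survival M bad (t ℕ.+ t))) ≤ ε * ε → Repairable
      fine ε≤1 safe = repaired , repaired-sparse d sparse , repaired-mixing , repaired-close d sparse
        where open Repaired M bad t (proj₁ 0<ε) ε≤1 good-close safe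

      unsafe : ¬ Repairable → ε * ε ≤ fromℕ 4 * (1# - mean (survival M bad (2 ℕ.* t)))
      unsafe hopeless with ≤-total ε 1#
      ... | inj₂ 1≤ε = contradiction (coarse 1≤ε) hopeless
      ... | inj₁ ε≤1 = subst (λ L → ε * ε ≤ fromℕ 4 * (1# - mean (survival M bad L)))
        (cong (t ℕ.+_) (sym (ℕ.+-identityʳ t)))
              (≰⇒≥ λ safe → hopeless (fine ε≤1 safe))

    test-rejects : ¬ Repairable → 2 ÷ 3 ≤ Pr isReject outcome
    test-rejects hopeless = *-cancelˡ-≤ (0<fromℕ 3) (begin
      fromℕ 3 * (fromℕ 2 * fromℕ 3 ⁻¹)   ≡⟨ solve 3 (λ a b c → a :* (b :* c) := (a :* c) :* b) refl (fromℕ 3)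
        (fromℕ 2) (fromℕ 3 ⁻¹) ⟩
      fromℕ 3 * fromℕ 3 ⁻¹ * fromℕ 2     ≡⟨ trans (cong (_* fromℕ 2) (*-inverseʳ (fromℕ 3) (<⇒≢ (0<fromℕ 3))))
        (*-identityˡ _) ⟩
      fromℕ 2                            ≤⟨ ≤-by (1# - fromℕ 3 * a) (slack rarely)
                                              (solve 1 (λ a → con (pos 2) :+ (con (pos 1) :- con (pos 3) :* a)
                                                := con (pos 3) :* (con (pos 1) :- a)) refl a) ⟩
      fromℕ 3 * (1# - a)                 ≡⟨ cong (fromℕ 3 *_)
        (trans (cong (_- a) (sym sum≡1)) (solve 2 (λ a r → a :+ r :- a := r) refl a (Pr isReject outcome))) ⟩
      fromℕ 3 * Pr isReject outcome      ∎)
      where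
      open ≤-Reasoning
      a : Carrier
      a = Pr isAccept outcome
      sum≡1 : a + Pr isReject outcome ≡ 1#
      sum≡1 = accept+reject outcome (IsProb-run (IsProb-nextNode M) steps (mixingTest P) _) test-halts
      rarely : fromℕ 3 * a ≤ 1#
      rarely = subst (λ z → fromℕ 3 * z ≤ 1#) (sym (proj₂ outcome-runs))
        (Rejecting.accept-unlikely bad 6α≤1 (2 ℕ.* t) K budget (proj₁ 0<ε²) (unsafe hopeless) 10≤Kε²)

    -- As K - 1 walks are not enough, Kε² is at most 10 + ε², and ε ≤ 2 turns this into 14.
    test-time : ε ≤ fromℕ 2 → fromℕ steps ≤ fromℕ (204 ℕ.* 14) * (ε * ε) ⁻¹ * fromℕ (t ℕ.^ 2) * fromℕ k
    test-time ε≤2 = begin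
      fromℕ steps
        ≤⟨ fromℕ-mono-≤ (total-time K t k {{K≢0}} {{t≢0}} {{k≢0}}) ⟩
      fromℕ (204 ℕ.* (K ℕ.* t ℕ.^ 2 ℕ.* k))
        ≡⟨ trans (fromℕ-* 204 (K ℕ.* t ℕ.^ 2 ℕ.* k)) (cong (fromℕ 204 *_)
          (trans (fromℕ-* (K ℕ.* t ℕ.^ 2) k) (cong (_* fromℕ k) (fromℕ-* K (t ℕ.^ 2))))) ⟩
      fromℕ 204 * (fromℕ K * fromℕ (t ℕ.^ 2) * fromℕ k)
        ≡⟨ solve 4 (λ c K t k → c :* (K :* t :* k) := (c :* t :* k) :* K) refl (fromℕ 204) (fromℕ K)
          (fromℕ (t ℕ.^ 2)) (fromℕ k) ⟩
      fromℕ 204 * fromℕ (t ℕ.^ 2) * fromℕ k * fromℕ K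
        ≤⟨ *-monoˡ-≤ (*-nonNegative (*-nonNegative (0≤fromℕ 204) (0≤fromℕ (t ℕ.^ 2))) (0≤fromℕ k)) K≤14/ε² ⟩
      fromℕ 204 * fromℕ (t ℕ.^ 2) * fromℕ k * (fromℕ 14 * (ε * ε) ⁻¹)
        ≡⟨ solve 5 (λ c t k b i → c :* t :* k :* (b :* i) := c :* b :* i :* t :* k) refl (fromℕ 204)
          (fromℕ (t ℕ.^ 2)) (fromℕ k) (fromℕ 14) ((ε * ε) ⁻¹) ⟩
      fromℕ 204 * fromℕ 14 * (ε * ε) ⁻¹ * fromℕ (t ℕ.^ 2) * fromℕ k
        ≡⟨ cong (λ c → c * (ε * ε) ⁻¹ * fromℕ (t ℕ.^ 2) * fromℕ k) (fromℕ-* 204 14) ⟨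
      fromℕ (204 ℕ.* 14) * (ε * ε) ⁻¹ * fromℕ (t ℕ.^ 2) * fromℕ k ∎
      where
      open ≤-Reasoning
      ε²≤4 : ε * ε ≤ fromℕ 4
      ε²≤4 = ≤-by ((fromℕ 2 - ε) * (fromℕ 2 + ε)) (*-nonNegative (slack ε≤2) (0≤+ (0≤fromℕ 2) (proj₁ 0<ε)))
        (solve 1 (λ ε → ε :* ε :+ (con (pos 2) :- ε) :* (con (pos 2) :+ ε) := con (pos 4)) refl ε)
      Kε²≤14 : ∀ K → (∀ i → i ℕ.< K → ¬ (fromℕ 10 ≤ fromℕ i * (ε * ε))) → ε * ε * fromℕ K ≤ fromℕ 14
      Kε²≤14 zero    _   = ≤-trans (≤-reflexive (zeroʳ (ε * ε))) (0≤fromℕ 14)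
      Kε²≤14 (suc K) min = ≤-trans (≤-reflexive (solve 2 (λ d K → d :* (con (pos 1) :+ K) := d :+ K :* d) refl
        (ε * ε) (fromℕ K)))
        (≤-trans (+-mono-≤ ε²≤4 (≰⇒≥ (min K ℕ.≤-refl))) (≤-reflexive (sym (fromℕ-+ 4 10))))
      K≤14/ε² : fromℕ K ≤ fromℕ 14 * (ε * ε) ⁻¹
      K≤14/ε² = *-cancelˡ-≤ 0<ε² (≤-trans (Kε²≤14 K K-least) (≤-reflexive (sym
        (trans (solve 3 (λ d b i → d :* (b :* i) := (d :* i) :* b) refl (ε * ε) (fromℕ 14) ((ε * ε) ⁻¹))
          (trans (cong (_* fromℕ 14) (*-inverseʳ (ε * ε) (<⇒≢ 0<ε²))) (*-identityˡ _))))))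

theorem35 : (ℝ : ArchimedeanField) → let open Model ℝ in
    (P : Program) (f : Carrier → Carrier) (T : ℕ → Carrier → Carrier → ℕ) →
    IsDistanceTester P f T →
    Σ[ Q ∈ Program ] Σ[ C ∈ ℕ ]
    (∀ (n : ℕ) .{{_ : NonZero n}} (d : ℕ) (M : MarkovChain n) → Sparse d M →
    ∀ (t : ℕ) .{{_ : NonZero t}} (ε : Carrier) → 0# < ε →
    ∃[ k ]
    Halts (runTest Q k t ε M)
    × (Mixing (f ε) t M → 2 ÷ 3 ≤ Pr isAccept (runTest Q k t ε M))
    × (¬ (Σ[ M′ ∈ MarkovChain n ] Sparse d M′
    × Mixing (fromℕ 4 * ε) (2 ℕ.* t) M′
    × Close d t (fromℕ 2 * ε) (101 ÷ 100 * ε) M M′) →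
    2 ÷ 3 ≤ Pr isReject (runTest Q k t ε M))
    × (ε ≤ fromℕ 2 →
    fromℕ k ≤ fromℕ C * (ε * ε) ⁻¹ * fromℕ (t ℕ.^ 2)
    * fromℕ (T n ε (1 ÷ (6 ℕ.* t)))))
theorem35 ℝ P f T tester = mixingTest P , 204 ℕ.* 14 , λ n d M sparse t ε 0<ε →
  let open Tested ℝ in
    steps P f T tester n d M sparse t ε 0<ε
  , test-halts P f T tester n d M sparse t ε 0<ε
  , test-accepts P f T tester n d M sparse t ε 0<ε
  , test-rejects P f T tester n d M sparse t ε 0<ε
  , test-time P f T tester n d M sparse t ε 0<ε
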